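{- Each of the sets of abelian projections, finite projections and infinite projections is definable (relative to the class of all C*-algebras). Therefore the class of C*-algebras having an abelian projection, respectively a finite projection, respectively an infinite projection, is elementary.
   Context: Continuous logic for C*-algebras. A C*-algebra $A$ is viewed as a metric structure whose sorts are the balls $B_n(A)=\{a:\|a\|\le n\}$, $n\in\mathbb N$, with metric $\|x-y\|$, and whose functions are the restrictions to these balls of $+,\cdot,{}^*$, scalar multiplication by each $\lambda\in\mathbb C$, the constant $0$ and the inclusions $B_m\to B_n$. Terms are *-polynomials, atomic formulas are distances between terms, and formulas are obtained from atomic ones by applying continuous functions $f:\mathbb R^n\to\mathbb R$ and the quantifiers $\sup_x,\inf_x$ over a sort; $\varphi^A(\bar a)$ is the value of $\varphi$ at $\bar a$ in $A$. A class $\mathcal C$ is elementary if there is a set $T$ of sentences (formulas without free variables) such that $A\in\mathcal C$ iff $\varphi^A=0$ for all $\varphi\in T$. A definable predicate relative to an elementary class $\mathcal C$ is an assignment of functions to members of $\mathcal C$ that is a uniform limit, uniformly over all members of $\mathcal C$, of interpretations of formulas. A uniform assignment assigns to each $A\in\mathcal C$ a closed subset $X(A)$ of a fixed finite product of sorts, functorially (morphisms $A\to B$ restrict to isometric maps $X(A)\to X(B)$). It is a definable set relative to $\mathcal C$ if for every formula $\psi(\bar x,\bar y)$ the functions $\sup_{\bar x\in X(A)}\psi^A(\bar x,\bar y)$ and $\inf_{\bar x\in X(A)}\psi^A(\bar x,\bar y)$ are definable predicates relative to $\mathcal C$. A projection $p$ in $A$ is abelian if $pAp$ is abelian, finite if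 $pAp$ is finite, and infinite if $pAp$ is not finite. Here a C*-algebra is infinite if it has nonzero orthogonal projections $p,q$ with $p+q$ Murray--von Neumann equivalent to $p$, and finite if it is not infinite. -}

module Defs where

open import Algebra.Bundles using (CommutativeRing)
open import Algebra.Module.Bundles using (LeftModule)
open import Algebra.Structures using (IsRingWithoutOne)
open import Axiom.ExcludedMiddle using (ExcludedMiddle)
open import Data.Fin.Base using (Fin)
open import Data.List.Base using (List; []; _∷_; _++_)
open import Data.List.Membership.Propositional using (_∈_)
open import Data.List.Relation.Unary.All as All using (All; []; _∷_)
open import Data.List.Relation.Unary.All.Properties using (++⁺)
open import Data.Nat.Base as ℕ using (ℕ)
open import Data.Product.Base using (Σ; Σ-syntax; ∃; ∃-syntax; _×_; _,_; proj₁; proj₂)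
open import Data.Sum.Base using (inj₁; inj₂)
open import Data.Unit.Polymorphic.Base using (⊤)
open import Data.Vec.Functional using (Vector)
open import Function.Bundles using (_⇔_)
open import Level using (Level; suc)
open import Relation.Binary.Bundles using (TotalOrder)
open import Relation.Binary.Core using (Rel)
open import Relation.Binary.Structures using (IsTotalOrder)
open import Relation.Nullary.Decidable.Core using (yes; no)
open import Relation.Nullary.Negation.Core using (¬_; contradiction)
open import Relation.Unary using (Pred)
import Algebra.Construct.NaturalChoice.Max as Max
import Algebra.Properties.CommutativeSemigroup as CommutativeSemigroupProperties
import Algebra.Properties.Ring as RingProperties
import Algebra.Properties.Semiring.Mult as SemiringMult
import Algebra.Solver.Ring.NaturalCoefficients.Default as SemiringSolver
import Relation.Binary.Construct.NonStrictToStrict as NonStrictToStrict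
import Relation.Binary.Reasoning.Setoid as SetoidReasoning

-- The real numbers are given axiomatically.  These axioms determine them up to
-- isomorphism in the presence of excluded middle, which is assumed throughout.

record CompleteOrderedField (ℓ : Level) : Set (suc ℓ) where
  infix 4 _≤_
  field
    commutativeRing : CommutativeRing ℓ ℓ

  open CommutativeRing commutativeRing public

  field
    _≤_          : Rel Carrier ℓ
    isTotalOrder : IsTotalOrder _≈_ _≤_
    0≉1          : ¬ 0# ≈ 1#
    invertible   : ∀ x → ¬ x ≈ 0# → ∃[ y ] x * y ≈ 1#
    +-monoˡ-≤    : ∀ z {x y} → x ≤ y → x + z ≤ y + z
    *-nonneg     : ∀ {x y} → 0# ≤ x → 0# ≤ y → 0# ≤ x * y

  totalOrder : TotalOrder ℓ ℓ ℓ
  totalOrder = record { isTotalOrder = isTotalOrder }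

  open TotalOrder totalOrder public using () renaming
    ( refl to ≤-refl; reflexive to ≤-reflexive; trans to ≤-trans
    ; antisym to ≤-antisym; total to ≤-total )

  IsUpperBound : Pred Carrier ℓ → Pred Carrier ℓ
  IsUpperBound S b = ∀ x → S x → x ≤ b

  IsLUB : Pred Carrier ℓ → Pred Carrier ℓ
  IsLUB S s = IsUpperBound S s × (∀ b → IsUpperBound S b → s ≤ b)

  field
    complete : ∀ (S : Pred Carrier ℓ) → ∃ S → ∃ (IsUpperBound S) → ∃ (IsLUB S)

  open NonStrictToStrict _≈_ _≤_ public using (_<_)
  open Max totalOrder public using (_⊔_)
  open SemiringMult semiring using (×1-homo-*; ×-homo-+) renaming (_×_ to _×ₙ_)

  ∣_∣ : Carrier → Carrier
  ∣ x ∣ = x ⊔ (- x)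

  fromℕ : ℕ → Carrier
  fromℕ n = n ×ₙ 1#

  Continuous : ∀ {k} → Pred (Vector Carrier k → Carrier) ℓ
  Continuous {k} f =
    ∀ x ε → 0# < ε → ∃[ δ ] 0# < δ ×
      (∀ y → (∀ (i : Fin k) → ∣ x i - y i ∣ ≤ δ) → ∣ f x - f y ∣ ≤ ε)


  private
    module RP = RingProperties ring

    ≤-cong : ∀ {x x′ y y′} → x ≈ x′ → y ≈ y′ → x ≤ y → x′ ≤ y′
    ≤-cong e e′ p = ≤-trans (≤-reflexive (sym e)) (≤-trans p (≤-reflexive e′))

    x≤y⇒0≤y-x : ∀ {x y} → x ≤ y → 0# ≤ y - x
    x≤y⇒0≤y-x {x} p = ≤-cong (-‿inverseʳ x) refl (+-monoˡ-≤ (- x) p)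

    0≤y-x⇒x≤y : ∀ {x y} → 0# ≤ y - x → x ≤ y
    0≤y-x⇒x≤y {x} {y} p = ≤-cong (+-identityˡ x)
      (trans (+-assoc y (- x) x) (trans (+-congˡ (-‿inverseˡ x)) (+-identityʳ y)))
      (+-monoˡ-≤ x p)

  +-mono-≤ : ∀ {x y u v} → x ≤ y → u ≤ v → x + u ≤ y + v
  +-mono-≤ {x} {y} {u} {v} p q =
    ≤-trans (+-monoˡ-≤ u p) (≤-cong (+-comm u y) (+-comm v y) (+-monoˡ-≤ y q))

  *-monoʳ-≤ : ∀ {x y z} → 0# ≤ z → x ≤ y → x * z ≤ y * z
  *-monoʳ-≤ {x} {y} {z} 0≤z p = 0≤y-x⇒x≤y
    (≤-cong refl (RP.[y-z]x≈yx-zx z y x) (*-nonneg (x≤y⇒0≤y-x p) 0≤z))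

  *-mono-≤ : ∀ {x y u v} → 0# ≤ u → 0# ≤ y → x ≤ y → u ≤ v → x * u ≤ y * v
  *-mono-≤ {x} {y} {u} {v} 0≤u 0≤y p q =
    ≤-trans (*-monoʳ-≤ 0≤u p) (≤-cong (*-comm u y) (*-comm v y) (*-monoʳ-≤ 0≤y q))

  x*x≈x⇒x≤1 : ∀ {x} → x * x ≈ x → x ≤ 1#
  x*x≈x⇒x≤1 {x} e with ≤-total x 1#
  ... | inj₁ x≤1 = x≤1
  ... | inj₂ 1≤x = 0≤y-x⇒x≤y (≤-cong refl eq (*-nonneg (x≤y⇒0≤y-x 1≤x) (x≤y⇒0≤y-x 1≤x)))
    where
    open SetoidReasoning setoid
    eq : (x - 1#) * (x - 1#) ≈ 1# - x
    eq = begin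
      (x - 1#) * (x - 1#)                ≈⟨ RP.x[y-z]≈xy-xz (x - 1#) x 1# ⟩
      (x - 1#) * x - (x - 1#) * 1#       ≈⟨ +-cong (RP.[y-z]x≈yx-zx x x 1#) (-‿cong (*-identityʳ _)) ⟩
      x * x - 1# * x - (x - 1#)          ≈⟨ +-congʳ (+-cong e (-‿cong (*-identityˡ x))) ⟩
      x - x - (x - 1#)                   ≈⟨ +-cong (-‿inverseʳ x) (RP.⁻¹-anti-homo‿- x 1#) ⟩
      0# + (1# - x)                      ≈⟨ +-identityˡ (1# - x) ⟩
      1# - x                             ∎

  0≤x*x : ∀ x → 0# ≤ x * x
  0≤x*x x with ≤-total 0# x
  ... | inj₁ 0≤x = *-nonneg 0≤x 0≤x
  ... | inj₂ x≤0 = ≤-cong refl eq (*-nonneg (x≤y⇒0≤y-x x≤0) (x≤y⇒0≤y-x x≤0))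
    where
    open SetoidReasoning setoid
    eq : (0# - x) * (0# - x) ≈ x * x
    eq = begin
      (0# - x) * (0# - x)  ≈⟨ *-cong (+-identityˡ (- x)) (+-identityˡ (- x)) ⟩
      - x * - x            ≈⟨ RP.-‿distribˡ-* x (- x) ⟨
      - (x * - x)          ≈⟨ -‿cong (RP.-‿distribʳ-* x x) ⟨
      - (- (x * x))        ≈⟨ RP.-‿involutive (x * x) ⟩
      x * x                ∎

  0≤1 : 0# ≤ 1#
  0≤1 = ≤-cong refl (*-identityˡ 1#) (0≤x*x 1#)

  *-cancelʳ-≤ : ∀ {x y z} → 0# ≤ z → ¬ z ≈ 0# → x * z ≤ y * z → x ≤ y
  *-cancelʳ-≤ {x} {y} {z} 0≤z z≉0 xz≤yz with ≤-total x y
  ... | inj₁ x≤y = x≤y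
  ... | inj₂ y≤x = ≤-reflexive (RP.x∙y⁻¹≈ε⇒x≈y x y (begin
    x - y              ≈⟨ *-identityʳ _ ⟨
    (x - y) * 1#       ≈⟨ *-congˡ zw≈1 ⟨
    (x - y) * (z * w)  ≈⟨ *-assoc _ _ _ ⟨
    (x - y) * z * w    ≈⟨ *-congʳ [x-y]z≈0 ⟩
    0# * w             ≈⟨ zeroˡ w ⟩
    0#                 ∎))
    where
    open SetoidReasoning setoid
    w     = proj₁ (invertible z z≉0)
    zw≈1  = proj₂ (invertible z z≉0)
    [x-y]z≈0 : (x - y) * z ≈ 0#
    [x-y]z≈0 = begin
      (x - y) * z      ≈⟨ RP.[y-z]x≈yx-zx z x y ⟩
      x * z - y * z    ≈⟨ +-congʳ (≤-antisym xz≤yz (*-monoʳ-≤ 0≤z y≤x)) ⟩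
      y * z - y * z    ≈⟨ -‿inverseʳ _ ⟩
      0#               ∎

  0≤fromℕ : ∀ n → 0# ≤ fromℕ n
  0≤fromℕ ℕ.zero    = ≤-refl
  0≤fromℕ (ℕ.suc n) = ≤-cong (+-identityˡ 0#) refl (+-mono-≤ 0≤1 (0≤fromℕ n))

  fromℕ-mono : ∀ {m n} → m ℕ.≤ n → fromℕ m ≤ fromℕ n
  fromℕ-mono {n = n} ℕ.z≤n = 0≤fromℕ n
  fromℕ-mono (ℕ.s≤s p)     = +-mono-≤ ≤-refl (fromℕ-mono p)

  fromℕ-+ : ∀ m n → fromℕ (m ℕ.+ n) ≈ fromℕ m + fromℕ n
  fromℕ-+ m n = ×-homo-+ 1# m n

  fromℕ-* : ∀ m n → fromℕ (m ℕ.* n) ≈ fromℕ m * fromℕ n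
  fromℕ-* m n = ×1-homo-* m n

module Complex {ℓ} (ℝ : CompleteOrderedField ℓ) where
  open CompleteOrderedField ℝ

  private
    module RP = RingProperties ring

    open SemiringSolver commutativeSemiring using (solve; _:=_; _:+_; _:*_)

  C : Set ℓ
  C = Carrier × Carrier

  _≈ᶜ_ : Rel C ℓ
  (a , b) ≈ᶜ (c , d) = a ≈ c × b ≈ d

  _+ᶜ_ _*ᶜ_ : C → C → C
  (a , b) +ᶜ (c , d) = a + c , b + d
  (a , b) *ᶜ (c , d) = a * c - b * d , a * d + b * c

  -ᶜ_ conj : C → C
  -ᶜ (a , b)   = - a , - b
  conj (a , b) = a , - b

  ∣_∣² : C → Carrier
  ∣ a , b ∣² = a * a + b * b

  private
    re : ∀ a b c d → a * c - b * d ≈ a * c + (- b) * d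
    re a b c d = +-congˡ (RP.-‿distribˡ-* b d)

    swap : ∀ b d → (- b) * d ≈ b * (- d)
    swap b d = trans (sym (RP.-‿distribˡ-* b d)) (RP.-‿distribʳ-* b d)

    comm : ∀ z w → (z *ᶜ w) ≈ᶜ (w *ᶜ z)
    comm (a , b) (c , d) =
      +-cong (*-comm a c) (-‿cong (*-comm b d)) ,
      trans (+-comm _ _) (+-cong (*-comm b c) (*-comm a d))

    assoc : ∀ z w v → ((z *ᶜ w) *ᶜ v) ≈ᶜ (z *ᶜ (w *ᶜ v))
    assoc (a , b) (c , d) (e , f) = first , second
      where
      open SetoidReasoning setoid
      first : (a * c - b * d) * e - (a * d + b * c) * f ≈
              a * (c * e - d * f) - b * (c * f + d * e)
      first = begin
        (a * c - b * d) * e - (a * d + b * c) * f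
          ≈⟨ +-cong (*-congʳ (re a b c d)) (RP.-‿distribʳ-* _ f) ⟩
        (a * c + (- b) * d) * e + (a * d + b * c) * (- f)
          ≈⟨ solve 8 (λ a b b′ c d e f f′ →
               (((a :* c) :+ (b′ :* d)) :* e) :+ (((a :* d) :+ (b :* c)) :* f′) :=
               (((a :* ((c :* e) :+ (d :* f′))) :+ (b′ :* (d :* e))) :+ (c :* (b :* f′))))
               refl a b (- b) c d e f (- f) ⟩
        a * (c * e + d * (- f)) + (- b) * (d * e) + c * (b * (- f))
          ≈⟨ +-cong (+-congʳ (*-congˡ (+-congˡ (RP.-‿distribʳ-* d f))))
                    (*-congˡ (swap b f)) ⟨
        a * (c * e - d * f) + (- b) * (d * e) + c * ((- b) * f)
          ≈⟨ solve 6 (λ x b′ c d e f →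
               ((x :+ (b′ :* (d :* e))) :+ (c :* (b′ :* f))) :=
               (x :+ (b′ :* ((c :* f) :+ (d :* e)))))
               refl (a * (c * e - d * f)) (- b) c d e f ⟩
        a * (c * e - d * f) + (- b) * (c * f + d * e)
          ≈⟨ +-congˡ (RP.-‿distribˡ-* b _) ⟨
        a * (c * e - d * f) - b * (c * f + d * e) ∎
      second : (a * c - b * d) * f + (a * d + b * c) * e ≈
               a * (c * f + d * e) + b * (c * e - d * f)
      second = begin
        (a * c - b * d) * f + (a * d + b * c) * e
          ≈⟨ +-congʳ (*-congʳ (re a b c d)) ⟩
        (a * c + (- b) * d) * f + (a * d + b * c) * e
          ≈⟨ solve 7 (λ a b b′ c d e f →
               (((a :* c) :+ (b′ :* d)) :* f) :+ (((a :* d) :+ (b :* c)) :* e) :=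
               (((a :* ((c :* f) :+ (d :* e))) :+ (b :* (c :* e))) :+ (b′ :* (d :* f))))
               refl a b (- b) c d e f ⟩
        a * (c * f + d * e) + b * (c * e) + (- b) * (d * f)
          ≈⟨ +-congˡ (swap b (d * f)) ⟩
        a * (c * f + d * e) + b * (c * e) + b * (- (d * f))
          ≈⟨ +-assoc _ _ _ ⟩
        a * (c * f + d * e) + (b * (c * e) + b * (- (d * f)))
          ≈⟨ +-congˡ (distribˡ b _ _) ⟨
        a * (c * f + d * e) + b * (c * e - d * f) ∎

    identityˡ : ∀ z → ((1# , 0#) *ᶜ z) ≈ᶜ z
    identityˡ (a , b) =
      trans (+-cong (*-identityˡ a) (trans (-‿cong (zeroˡ b)) RP.-0#≈0#)) (+-identityʳ a) ,
      trans (+-cong (*-identityˡ b) (zeroˡ a)) (+-identityʳ b)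

    identityʳ : ∀ z → (z *ᶜ (1# , 0#)) ≈ᶜ z
    identityʳ z = let p , q = comm z (1# , 0#); r , s = identityˡ z in trans p r , trans q s

    distˡ : ∀ z w v → (z *ᶜ (w +ᶜ v)) ≈ᶜ ((z *ᶜ w) +ᶜ (z *ᶜ v))
    distˡ (a , b) (c , d) (e , f) =
      trans (re a b (c + e) (d + f))
        (trans (solve 6 (λ a b′ c d e f →
                  ((a :* (c :+ e)) :+ (b′ :* (d :+ f))) :=
                  (((a :* c) :+ (b′ :* d)) :+ ((a :* e) :+ (b′ :* f))))
                  refl a (- b) c d e f)
               (sym (+-cong (re a b c d) (re a b e f)))) ,
      solve 6 (λ a b c d e f →
        ((a :* (d :+ f)) :+ (b :* (c :+ e))) :=
        (((a :* d) :+ (b :* c)) :+ ((a :* f) :+ (b :* e)))) refl a b c d e f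

    distʳ : ∀ z w v → ((w +ᶜ v) *ᶜ z) ≈ᶜ ((w *ᶜ z) +ᶜ (v *ᶜ z))
    distʳ z w v =
      let p , q = comm (w +ᶜ v) z; r , s = distˡ z w v
          t , u = comm z w; t′ , u′ = comm z v
      in trans p (trans r (+-cong t t′)) , trans q (trans s (+-cong u u′))

  ℂ : CommutativeRing ℓ ℓ
  ℂ = record
    { Carrier = C
    ; _≈_ = _≈ᶜ_
    ; _+_ = _+ᶜ_
    ; _*_ = _*ᶜ_
    ; -_  = -ᶜ_
    ; 0#  = 0# , 0#
    ; 1#  = 1# , 0#
    ; isCommutativeRing = record
      { isRing = record
        { +-isAbelianGroup = record
          { isGroup = record
            { isMonoid = record
              { isSemigroup = record
                { isMagma = record
                  { isEquivalence = record
                    { refl  = refl , refl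
                    ; sym   = λ (p , q) → sym p , sym q
                    ; trans = λ (p , q) (r , s) → trans p r , trans q s
                    }
                  ; ∙-cong = λ (p , q) (r , s) → +-cong p r , +-cong q s
                  }
                ; assoc = λ _ _ _ → +-assoc _ _ _ , +-assoc _ _ _
                }
              ; identity = (λ _ → +-identityˡ _ , +-identityˡ _) ,
                           (λ _ → +-identityʳ _ , +-identityʳ _)
              }
            ; inverse = (λ _ → -‿inverseˡ _ , -‿inverseˡ _) ,
                        (λ _ → -‿inverseʳ _ , -‿inverseʳ _)
            ; ⁻¹-cong = λ (p , q) → -‿cong p , -‿cong q
            }
          ; comm = λ _ _ → +-comm _ _ , +-comm _ _
          }
        ; *-cong = λ (p , q) (r , s) →
            +-cong (*-cong p r) (-‿cong (*-cong q s)) , +-cong (*-cong p s) (*-cong q r)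
        ; *-assoc = assoc
        ; *-identity = identityˡ , identityʳ
        ; distrib = distˡ , distʳ
        }
      ; *-comm = comm
      }
    }

record CStarAlgebra {ℓ} (ℝ : CompleteOrderedField ℓ) : Set (suc ℓ) where
  open CompleteOrderedField ℝ using (_≤_; _<_; 0#)
    renaming (Carrier to R; _≈_ to _≈ᴿ_; _+_ to _+ᴿ_; _*_ to _*ᴿ_)
  open Complex ℝ using (ℂ; C; conj; ∣_∣²)

  infixl 7 _∙_
  infix  8 _⋆
  field
    leftModule : LeftModule (CommutativeRing.ring ℂ) ℓ ℓ

  open LeftModule leftModule public renaming (Carrierᴹ to Carrier)

  field
    _∙_                : Carrier → Carrier → Carrier
    isRingWithoutOne   : IsRingWithoutOne _≈ᴹ_ _+ᴹ_ _∙_ -ᴹ_ 0ᴹ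
    *ₗ-∙-assoc         : ∀ c x y → (c *ₗ x) ∙ y ≈ᴹ c *ₗ (x ∙ y)
    *ₗ-∙-comm          : ∀ c x y → x ∙ (c *ₗ y) ≈ᴹ c *ₗ (x ∙ y)

    _⋆                 : Carrier → Carrier
    ⋆-cong             : ∀ {x y} → x ≈ᴹ y → x ⋆ ≈ᴹ y ⋆
    ⋆-involutive       : ∀ x → x ⋆ ⋆ ≈ᴹ x
    ⋆-homo-+           : ∀ x y → (x +ᴹ y) ⋆ ≈ᴹ x ⋆ +ᴹ y ⋆
    ⋆-homo-*ₗ          : ∀ c x → (c *ₗ x) ⋆ ≈ᴹ conj c *ₗ x ⋆
    ⋆-anti-homo-∙      : ∀ x y → (x ∙ y) ⋆ ≈ᴹ y ⋆ ∙ x ⋆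

    ‖_‖                : Carrier → R
    ‖‖-cong            : ∀ {x y} → x ≈ᴹ y → ‖ x ‖ ≈ᴿ ‖ y ‖
    ‖‖-nonneg          : ∀ x → 0# ≤ ‖ x ‖
    ‖‖-definite        : ∀ x → ‖ x ‖ ≈ᴿ 0# → x ≈ᴹ 0ᴹ
    ‖‖-triangle        : ∀ x y → ‖ x +ᴹ y ‖ ≤ ‖ x ‖ +ᴿ ‖ y ‖
    -- Squared, to avoid the square root in |c|.
    ‖‖-homogeneous     : ∀ c x → ‖ c *ₗ x ‖ *ᴿ ‖ c *ₗ x ‖ ≈ᴿ ∣ c ∣² *ᴿ (‖ x ‖ *ᴿ ‖ x ‖)
    ‖‖-submultiplicative : ∀ x y → ‖ x ∙ y ‖ ≤ ‖ x ‖ *ᴿ ‖ y ‖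
    C⋆-identity        : ∀ x → ‖ x ⋆ ∙ x ‖ ≈ᴿ ‖ x ‖ *ᴿ ‖ x ‖

  infixl 6 _-ᴹ_
  _-ᴹ_ : Carrier → Carrier → Carrier
  x -ᴹ y = x +ᴹ (-ᴹ y)

  Cauchy : Pred (ℕ → Carrier) ℓ
  Cauchy u = ∀ ε → 0# < ε → ∃[ N ] ∀ m n → N ℕ.≤ m → N ℕ.≤ n → ‖ u m -ᴹ u n ‖ ≤ ε

  _⟶_ : (ℕ → Carrier) → Carrier → Set ℓ
  u ⟶ x = ∀ ε → 0# < ε → ∃[ N ] ∀ n → N ℕ.≤ n → ‖ u n -ᴹ x ‖ ≤ ε

  field
    norm-complete : ∀ u → Cauchy u → ∃[ x ] u ⟶ x

  IsProjection : Pred Carrier ℓ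
  IsProjection p = (p ∙ p ≈ᴹ p) × (p ⋆ ≈ᴹ p)

  _∼ᴹᵛᴺ_ : Rel Carrier ℓ
  p ∼ᴹᵛᴺ q = ∃[ v ] (v ⋆ ∙ v ≈ᴹ p) × (v ∙ v ⋆ ≈ᴹ q)

  IsAbelian : Set ℓ
  IsAbelian = ∀ x y → x ∙ y ≈ᴹ y ∙ x

  IsInfinite : Set ℓ
  IsInfinite = ∃[ p ] ∃[ q ] IsProjection p × IsProjection q ×
    ¬ p ≈ᴹ 0ᴹ × ¬ q ≈ᴹ 0ᴹ × p ∙ q ≈ᴹ 0ᴹ × (p +ᴹ q) ∼ᴹᵛᴺ p

  IsFinite : Set ℓ
  IsFinite = ¬ IsInfinite

record Ball {ℓ} {ℝ : CompleteOrderedField ℓ} (A : CStarAlgebra ℝ) (n : ℕ) : Set ℓ where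
  constructor ball
  open CompleteOrderedField ℝ using (_≤_; fromℕ)
  open CStarAlgebra A using (Carrier; ‖_‖)
  field
    point : Carrier
    bound : ‖ point ‖ ≤ fromℕ n

open Ball using (point; bound)

module _ {ℓ} {ℝ : CompleteOrderedField ℓ} (A : CStarAlgebra ℝ) where
  open CStarAlgebra A
  private
    module ℝ = CompleteOrderedField ℝ
    module RWO = IsRingWithoutOne isRingWithoutOne

  -- The C*-algebra pAp = { pap : a ∈ A }, with the operations and norm of A.
  corner : ∀ p → IsProjection p → CStarAlgebra ℝ
  corner p (pp≈p , p⋆≈p) = record
    { leftModule = record
      { Carrierᴹ = Corner
      ; _≈ᴹ_ = λ x y → proj₁ x ≈ᴹ proj₁ y
      ; _+ᴹ_ = _+ᶜ_
      ; _*ₗ_ = _*ᶜ_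
      ; 0ᴹ = 0ᴹ , 0ᴹ , ≈ᴹ-sym (≈ᴹ-trans (RWO.*-congʳ (RWO.zeroʳ p)) (RWO.zeroˡ p))
      ; -ᴹ_ = -ᶜ_
      ; isLeftModule = record
        { isLeftSemimodule = record
          { +ᴹ-isCommutativeMonoid = record
            { isMonoid = record
              { isSemigroup = record
                { isMagma = record
                  { isEquivalence = record
                    { refl = ≈ᴹ-refl ; sym = ≈ᴹ-sym ; trans = ≈ᴹ-trans }
                  ; ∙-cong = +ᴹ-cong
                  }
                ; assoc = λ _ _ _ → +ᴹ-assoc _ _ _
                }
              ; identity = (λ _ → +ᴹ-identityˡ _) , (λ _ → +ᴹ-identityʳ _)
              }
            ; comm = λ _ _ → +ᴹ-comm _ _
            }
          ; isPreleftSemimodule = record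
            { *ₗ-cong = *ₗ-cong
            ; *ₗ-zeroˡ = λ _ → *ₗ-zeroˡ _
            ; *ₗ-distribʳ = λ _ _ _ → *ₗ-distribʳ _ _ _
            ; *ₗ-identityˡ = λ _ → *ₗ-identityˡ _
            ; *ₗ-assoc = λ _ _ _ → *ₗ-assoc _ _ _
            ; *ₗ-zeroʳ = *ₗ-zeroʳ
            ; *ₗ-distribˡ = λ _ _ _ → *ₗ-distribˡ _ _ _
            }
          }
        ; -ᴹ‿cong = -ᴹ‿cong
        ; -ᴹ‿inverse = (λ _ → -ᴹ‿inverseˡ _) , (λ _ → -ᴹ‿inverseʳ _)
        }
      }
    ; _∙_ = _∙ᶜ_
    ; isRingWithoutOne = record
      { +-isAbelianGroup = record
        { isGroup = record
          { isMonoid = record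
            { isSemigroup = record
              { isMagma = record
                { isEquivalence = record
                  { refl = ≈ᴹ-refl ; sym = ≈ᴹ-sym ; trans = ≈ᴹ-trans }
                ; ∙-cong = +ᴹ-cong
                }
              ; assoc = λ _ _ _ → +ᴹ-assoc _ _ _
              }
            ; identity = (λ _ → +ᴹ-identityˡ _) , (λ _ → +ᴹ-identityʳ _)
            }
          ; inverse = (λ _ → -ᴹ‿inverseˡ _) , (λ _ → -ᴹ‿inverseʳ _)
          ; ⁻¹-cong = -ᴹ‿cong
          }
        ; comm = λ _ _ → +ᴹ-comm _ _
        }
      ; *-cong = RWO.*-cong
      ; *-assoc = λ _ _ _ → RWO.*-assoc _ _ _
      ; distrib = (λ _ _ _ → proj₁ RWO.distrib _ _ _) , (λ _ _ _ → proj₂ RWO.distrib _ _ _)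
      }
    ; *ₗ-∙-assoc = λ _ _ _ → *ₗ-∙-assoc _ _ _
    ; *ₗ-∙-comm = λ _ _ _ → *ₗ-∙-comm _ _ _
    ; _⋆ = _⋆ᶜ
    ; ⋆-cong = ⋆-cong
    ; ⋆-involutive = λ _ → ⋆-involutive _
    ; ⋆-homo-+ = λ _ _ → ⋆-homo-+ _ _
    ; ⋆-homo-*ₗ = λ _ _ → ⋆-homo-*ₗ _ _
    ; ⋆-anti-homo-∙ = λ _ _ → ⋆-anti-homo-∙ _ _
    ; ‖_‖ = λ x → ‖ proj₁ x ‖
    ; ‖‖-cong = ‖‖-cong
    ; ‖‖-nonneg = λ _ → ‖‖-nonneg _
    ; ‖‖-definite = λ _ → ‖‖-definite _
    ; ‖‖-triangle = λ _ _ → ‖‖-triangle _ _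
    ; ‖‖-homogeneous = λ _ _ → ‖‖-homogeneous _ _
    ; ‖‖-submultiplicative = λ _ _ → ‖‖-submultiplicative _ _
    ; C⋆-identity = λ _ → C⋆-identity _
    ; norm-complete = norm-completeᶜ
    }
    where
    open SetoidReasoning ≈ᴹ-setoid
    Corner : Set _
    Corner = Σ[ x ∈ Carrier ] ∃[ a ] x ≈ᴹ p ∙ a ∙ p

    p[]p-cong : ∀ {a b} → a ≈ᴹ b → p ∙ a ∙ p ≈ᴹ p ∙ b ∙ p
    p[]p-cong e = RWO.*-congʳ (RWO.*-congˡ e)

    p[]p-+ : ∀ a b → p ∙ (a +ᴹ b) ∙ p ≈ᴹ p ∙ a ∙ p +ᴹ p ∙ b ∙ p
    p[]p-+ a b = ≈ᴹ-trans (RWO.*-congʳ (proj₁ RWO.distrib p a b))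
                          (proj₂ RWO.distrib p (p ∙ a) (p ∙ b))

    p[]p-- : ∀ a → p ∙ (-ᴹ a) ∙ p ≈ᴹ -ᴹ (p ∙ a ∙ p)
    p[]p-- a = uniqueʳ‿-ᴹ _ _ (begin
      p ∙ a ∙ p +ᴹ p ∙ (-ᴹ a) ∙ p  ≈⟨ p[]p-+ a (-ᴹ a) ⟨
      p ∙ (a +ᴹ -ᴹ a) ∙ p          ≈⟨ p[]p-cong (-ᴹ‿inverseʳ a) ⟩
      p ∙ 0ᴹ ∙ p                   ≈⟨ RWO.*-congʳ (RWO.zeroʳ p) ⟩
      0ᴹ ∙ p                       ≈⟨ RWO.zeroˡ p ⟩
      0ᴹ                           ∎)

    p[]p-idem : ∀ a → p ∙ (p ∙ a ∙ p) ∙ p ≈ᴹ p ∙ a ∙ p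
    p[]p-idem a = begin
      p ∙ (p ∙ a ∙ p) ∙ p    ≈⟨ RWO.*-congʳ (RWO.*-congˡ (RWO.*-assoc p a p)) ⟩
      p ∙ (p ∙ (a ∙ p)) ∙ p  ≈⟨ RWO.*-congʳ (RWO.*-assoc p p (a ∙ p)) ⟨
      p ∙ p ∙ (a ∙ p) ∙ p    ≈⟨ RWO.*-assoc _ _ _ ⟩
      p ∙ p ∙ (a ∙ p ∙ p)    ≈⟨ RWO.*-cong pp≈p (≈ᴹ-trans (RWO.*-assoc a p p) (RWO.*-congˡ pp≈p)) ⟩
      p ∙ (a ∙ p)            ≈⟨ RWO.*-assoc p a p ⟨
      p ∙ a ∙ p              ∎

    _+ᶜ_ _∙ᶜ_ : Corner → Corner → Corner
    (x , a , x≈) +ᶜ (y , b , y≈) =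
      x +ᴹ y , a +ᴹ b , ≈ᴹ-trans (+ᴹ-cong x≈ y≈) (≈ᴹ-sym (p[]p-+ a b))
    (x , a , x≈) ∙ᶜ (y , b , y≈) = x ∙ y , a ∙ p ∙ (p ∙ b) , (begin
      x ∙ y                        ≈⟨ RWO.*-cong x≈ y≈ ⟩
      p ∙ a ∙ p ∙ (p ∙ b ∙ p)      ≈⟨ RWO.*-congʳ (RWO.*-assoc p a p) ⟩
      p ∙ (a ∙ p) ∙ (p ∙ b ∙ p)    ≈⟨ RWO.*-assoc _ _ _ ⟩
      p ∙ (a ∙ p ∙ (p ∙ b ∙ p))    ≈⟨ RWO.*-congˡ (RWO.*-assoc _ _ _) ⟨
      p ∙ (a ∙ p ∙ (p ∙ b) ∙ p)    ≈⟨ RWO.*-assoc _ _ _ ⟨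
      p ∙ (a ∙ p ∙ (p ∙ b)) ∙ p    ∎)

    -ᶜ_ _⋆ᶜ : Corner → Corner
    -ᶜ (x , a , x≈) = -ᴹ x , -ᴹ a , ≈ᴹ-trans (-ᴹ‿cong x≈) (≈ᴹ-sym (p[]p-- a))
    (x , a , x≈) ⋆ᶜ = x ⋆ , a ⋆ , (begin
      x ⋆                  ≈⟨ ⋆-cong x≈ ⟩
      (p ∙ a ∙ p) ⋆        ≈⟨ ⋆-anti-homo-∙ _ _ ⟩
      p ⋆ ∙ (p ∙ a) ⋆      ≈⟨ RWO.*-congˡ (⋆-anti-homo-∙ _ _) ⟩
      p ⋆ ∙ (a ⋆ ∙ p ⋆)    ≈⟨ RWO.*-cong p⋆≈p (RWO.*-congˡ p⋆≈p) ⟩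
      p ∙ (a ⋆ ∙ p)        ≈⟨ RWO.*-assoc _ _ _ ⟨
      p ∙ a ⋆ ∙ p          ∎)

    _*ᶜ_ : Complex.C ℝ → Corner → Corner
    c *ᶜ (x , a , x≈) = c *ₗ x , c *ₗ a , (begin
      c *ₗ x              ≈⟨ *ₗ-congˡ x≈ ⟩
      c *ₗ (p ∙ a ∙ p)    ≈⟨ *ₗ-∙-assoc c (p ∙ a) p ⟨
      (c *ₗ (p ∙ a)) ∙ p  ≈⟨ RWO.*-congʳ (*ₗ-∙-comm c p a) ⟨
      p ∙ (c *ₗ a) ∙ p    ∎)

    ‖p‖≤1 : ‖ p ‖ ℝ.≤ ℝ.1#
    ‖p‖≤1 = ℝ.x*x≈x⇒x≤1 (ℝ.trans (ℝ.sym (C⋆-identity p))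
      (‖‖-cong (≈ᴹ-trans (RWO.*-congʳ p⋆≈p) pp≈p)))

    p[]p-contractive : ∀ a → ‖ p ∙ a ∙ p ‖ ℝ.≤ ‖ a ‖
    p[]p-contractive a =
      ℝ.≤-trans (‖‖-submultiplicative (p ∙ a) p)
     (ℝ.≤-trans (ℝ.*-mono-≤ (‖‖-nonneg p) (‖‖-nonneg _) ℝ.≤-refl ‖p‖≤1)
     (ℝ.≤-trans (ℝ.≤-reflexive (ℝ.*-identityʳ _))
     (ℝ.≤-trans (‖‖-submultiplicative p a)
     (ℝ.≤-trans (ℝ.*-monoʳ-≤ (‖‖-nonneg a) ‖p‖≤1)
                (ℝ.≤-reflexive (ℝ.*-identityˡ _))))))

    norm-completeᶜ : ∀ (u : ℕ → Corner) → Cauchy (λ n → proj₁ (u n)) →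
      Σ[ x ∈ Corner ] (λ n → proj₁ (u n)) ⟶ proj₁ x
    norm-completeᶜ u cauchy with norm-complete (λ n → proj₁ (u n)) cauchy
    ... | x , u⟶x = (p ∙ x ∙ p , x , ≈ᴹ-refl) , λ ε 0<ε →
      let N , close = u⟶x ε 0<ε in N , λ n N≤n →
        ℝ.≤-trans (ℝ.≤-reflexive (‖‖-cong (≈ᴹ-sym (compress n))))
       (ℝ.≤-trans (p[]p-contractive (proj₁ (u n) -ᴹ x)) (close n N≤n))
      where
      compress : ∀ n → p ∙ (proj₁ (u n) -ᴹ x) ∙ p ≈ᴹ proj₁ (u n) -ᴹ p ∙ x ∙ p
      compress n = let y , a , y≈ = u n in begin
        p ∙ (y -ᴹ x) ∙ p                   ≈⟨ p[]p-+ y (-ᴹ x) ⟩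
        p ∙ y ∙ p +ᴹ p ∙ (-ᴹ x) ∙ p        ≈⟨ +ᴹ-cong (p[]p-cong y≈) (p[]p-- x) ⟩
        p ∙ (p ∙ a ∙ p) ∙ p -ᴹ p ∙ x ∙ p   ≈⟨ +ᴹ-congʳ (p[]p-idem a) ⟩
        p ∙ a ∙ p -ᴹ p ∙ x ∙ p             ≈⟨ +ᴹ-congʳ y≈ ⟨
        y -ᴹ p ∙ x ∙ p                     ∎

  IsAbelianProjection : Pred Carrier ℓ
  IsAbelianProjection p = Σ[ proj ∈ IsProjection p ] CStarAlgebra.IsAbelian (corner p proj)

  IsFiniteProjection : Pred Carrier ℓ
  IsFiniteProjection p = Σ[ proj ∈ IsProjection p ] CStarAlgebra.IsFinite (corner p proj)

  IsInfiniteProjection : Pred Carrier ℓ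
  IsInfiniteProjection p = Σ[ proj ∈ IsProjection p ] ¬ CStarAlgebra.IsFinite (corner p proj)

module ContinuousLogic {ℓ} (ℝ : CompleteOrderedField ℓ) (lem : ExcludedMiddle ℓ) where
  open CompleteOrderedField ℝ renaming (Carrier to R)
  open Complex ℝ using (C; ∣_∣²)

  -- Supremum and infimum of an indexed family of reals.  As an empty or
  -- unbounded family has none, its value is then 0 by convention.  Sorts are
  -- nonempty and formulas are bounded on them, so this only concerns suprema
  -- over an empty definable set, where the choice of constant is immaterial to
  -- the notion of definability.
  ⨆ ⨅ : {I : Set ℓ} → (I → R) → R
  ⨆ {I} f with lem {I × ∃[ b ] (∀ i → f i ≤ b)}
  ... | yes (i , b , f≤b) = proj₁ (complete (λ r → ∃[ i ] r ≈ f i) (f i , i , refl)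
                              (b , λ _ (j , r≈) → ≤-trans (≤-reflexive r≈) (f≤b j)))
  ... | no _ = 0#
  ⨅ f = - ⨆ (λ i → - f i)

  -- Contexts list the sorts of the free variables, the sort n being the ball
  -- of radius n.

  Context : Set
  Context = List ℕ

  Env : CStarAlgebra ℝ → Context → Set ℓ
  Env A Γ = All (Ball A) Γ

  infixl 6 _+ᵗ_
  infixl 7 _∙ᵗ_
  infix  8 _⋆ᵗ

  data Term (Γ : Context) : ℕ → Set ℓ where
    var   : ∀ {n} → n ∈ Γ → Term Γ n
    0ᵗ    : ∀ {n} → Term Γ n
    _+ᵗ_  : ∀ {m n} → Term Γ m → Term Γ n → Term Γ (m ℕ.+ n)
    _∙ᵗ_  : ∀ {m n} → Term Γ m → Term Γ n → Term Γ (m ℕ.* n)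
    _⋆ᵗ   : ∀ {n} → Term Γ n → Term Γ n
    scale : ∀ {n} (c : C) (k : ℕ) → ∣ c ∣² ≤ fromℕ k * fromℕ k → Term Γ n → Term Γ (k ℕ.* n)
    incl  : ∀ {m n} → m ℕ.≤ n → Term Γ m → Term Γ n

  data Formula (Γ : Context) : Set ℓ where
    dist     : ∀ {n} → Term Γ n → Term Γ n → Formula Γ
    connect  : ∀ {k} (f : Vector R k → R) → Continuous f → (Fin k → Formula Γ) → Formula Γ
    sup inf  : ∀ n → Formula (n ∷ Γ) → Formula Γ

  Sentence : Set ℓ
  Sentence = Formula []

  private
    x*x≤y*x⇒x≤y : ∀ {x y} → 0# ≤ x → 0# ≤ y → x * x ≤ y * x → x ≤ y
    x*x≤y*x⇒x≤y {x} 0≤x 0≤y p with lem {x ≈ 0#}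
    ... | yes x≈0 = ≤-trans (≤-reflexive x≈0) 0≤y
    ... | no  x≉0 = *-cancelʳ-≤ 0≤x x≉0 p

    x*x≤y*y⇒x≤y : ∀ {x y} → 0# ≤ y → x * x ≤ y * y → x ≤ y
    x*x≤y*y⇒x≤y {x} {y} 0≤y p with ≤-total x y
    ... | inj₁ x≤y = x≤y
    ... | inj₂ y≤x = x*x≤y*x⇒x≤y (≤-trans 0≤y y≤x) 0≤y
      (≤-trans p (≤-trans (*-monoʳ-≤ 0≤y y≤x) (≤-reflexive (*-comm x y))))

  module Balls (A : CStarAlgebra ℝ) where
    open CStarAlgebra A hiding (isRingWithoutOne)

    private
      ‖0‖≤0 : ‖ 0ᴹ ‖ ≤ 0#
      ‖0‖≤0 = x*x≤y*y⇒x≤y ≤-refl (≤-reflexive (begin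
        ‖ 0ᴹ ‖ * ‖ 0ᴹ ‖                        ≈⟨ *-cong ‖0‖≈ ‖0‖≈ ⟩
        ‖ 0ᶜ *ₗ 0ᴹ ‖ * ‖ 0ᶜ *ₗ 0ᴹ ‖            ≈⟨ ‖‖-homogeneous 0ᶜ 0ᴹ ⟩
        (0# * 0# + 0# * 0#) * (‖ 0ᴹ ‖ * ‖ 0ᴹ ‖)  ≈⟨ *-congʳ (+-cong (zeroˡ 0#) (zeroˡ 0#)) ⟩
        (0# + 0#) * (‖ 0ᴹ ‖ * ‖ 0ᴹ ‖)          ≈⟨ *-congʳ (+-identityˡ 0#) ⟩
        0# * (‖ 0ᴹ ‖ * ‖ 0ᴹ ‖)                 ≈⟨ zeroˡ _ ⟩
        0#                                     ≈⟨ zeroˡ 0# ⟨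
        0# * 0#                                ∎))
        where
        open SetoidReasoning setoid
        0ᶜ : C
        0ᶜ = 0# , 0#
        ‖0‖≈ : ‖ 0ᴹ ‖ ≈ ‖ 0ᶜ *ₗ 0ᴹ ‖
        ‖0‖≈ = ‖‖-cong (≈ᴹ-sym (*ₗ-zeroˡ 0ᴹ))

      ‖x⋆‖≤‖x‖ : ∀ x → ‖ x ⋆ ‖ ≤ ‖ x ‖
      ‖x⋆‖≤‖x‖ x = x*x≤y*x⇒x≤y (‖‖-nonneg (x ⋆)) (‖‖-nonneg x)
        (≤-trans (≤-reflexive (sym (C⋆-identity (x ⋆))))
        (≤-trans (‖‖-submultiplicative (x ⋆ ⋆) (x ⋆))
                 (≤-reflexive (*-congʳ (‖‖-cong (⋆-involutive x))))))

      ‖cx‖≤k‖x‖ : ∀ c k x → ∣ c ∣² ≤ fromℕ k * fromℕ k → ‖ c *ₗ x ‖ ≤ fromℕ k * ‖ x ‖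
      ‖cx‖≤k‖x‖ c k x p = x*x≤y*y⇒x≤y (*-nonneg (0≤fromℕ k) (‖‖-nonneg x))
        (≤-trans (≤-reflexive (‖‖-homogeneous c x))
        (≤-trans (*-monoʳ-≤ (*-nonneg (‖‖-nonneg x) (‖‖-nonneg x)) p)
                 (≤-reflexive (interchange _ _ _ _))))
        where open CommutativeSemigroupProperties *-commutativeSemigroup using (interchange)

    0ᴮ : ∀ {n} → Ball A n
    0ᴮ {n} = ball 0ᴹ (≤-trans ‖0‖≤0 (0≤fromℕ n))

    _+ᴮ_ : ∀ {m n} → Ball A m → Ball A n → Ball A (m ℕ.+ n)
    _+ᴮ_ {m} {n} (ball x ‖x‖≤m) (ball y ‖y‖≤n) = ball (x +ᴹ y)
      (≤-trans (‖‖-triangle x y)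
     (≤-trans (+-mono-≤ ‖x‖≤m ‖y‖≤n) (≤-reflexive (sym (fromℕ-+ m n)))))

    _∙ᴮ_ : ∀ {m n} → Ball A m → Ball A n → Ball A (m ℕ.* n)
    _∙ᴮ_ {m} {n} (ball x ‖x‖≤m) (ball y ‖y‖≤n) = ball (x ∙ y)
      (≤-trans (‖‖-submultiplicative x y)
     (≤-trans (*-mono-≤ (‖‖-nonneg y) (0≤fromℕ m) ‖x‖≤m ‖y‖≤n)
              (≤-reflexive (sym (fromℕ-* m n)))))

    _⋆ᴮ : ∀ {n} → Ball A n → Ball A n
    (ball x ‖x‖≤n) ⋆ᴮ = ball (x ⋆) (≤-trans (‖x⋆‖≤‖x‖ x) ‖x‖≤n)

    scaleᴮ : ∀ {n} c k → ∣ c ∣² ≤ fromℕ k * fromℕ k → Ball A n → Ball A (k ℕ.* n)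
    scaleᴮ {n} c k ∣c∣≤k (ball x ‖x‖≤n) = ball (c *ₗ x)
      (≤-trans (‖cx‖≤k‖x‖ c k x ∣c∣≤k)
     (≤-trans (*-mono-≤ (‖‖-nonneg x) (0≤fromℕ k) ≤-refl ‖x‖≤n)
              (≤-reflexive (sym (fromℕ-* k n)))))

    inclᴮ : ∀ {m n} → m ℕ.≤ n → Ball A m → Ball A n
    inclᴮ m≤n (ball x ‖x‖≤m) = ball x (≤-trans ‖x‖≤m (fromℕ-mono m≤n))

    distᴮ : ∀ {n} → Ball A n → Ball A n → R
    distᴮ x y = ‖ point x -ᴹ point y ‖

  module _ (A : CStarAlgebra ℝ) where
    open Balls A

    evalᵗ : ∀ {Γ n} → Term Γ n → Env A Γ → Ball A n
    evalᵗ (var i)             a = All.lookup a i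
    evalᵗ 0ᵗ                  a = 0ᴮ
    evalᵗ (s +ᵗ t)            a = evalᵗ s a +ᴮ evalᵗ t a
    evalᵗ (s ∙ᵗ t)            a = evalᵗ s a ∙ᴮ evalᵗ t a
    evalᵗ (t ⋆ᵗ)              a = evalᵗ t a ⋆ᴮ
    evalᵗ (scale c k ∣c∣≤k t) a = scaleᴮ c k ∣c∣≤k (evalᵗ t a)
    evalᵗ (incl m≤n t)        a = inclᴮ m≤n (evalᵗ t a)

    eval : ∀ {Γ} → Formula Γ → Env A Γ → R
    eval (dist s t)       a = distᴮ (evalᵗ s a) (evalᵗ t a)
    eval (connect f _ φs) a = f (λ i → eval (φs i) a)
    eval (sup n φ)        a = ⨆ (λ (x : Ball A n) → eval φ (x ∷ a))
    eval (inf n φ)        a = ⨅ (λ (x : Ball A n) → eval φ (x ∷ a))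

    Within : ∀ {Γ} → R → Env A Γ → Env A Γ → Set ℓ
    Within {Γ} ε a b = ∀ {n} (i : n ∈ Γ) → distᴮ (All.lookup a i) (All.lookup b i) ≤ ε

    IsClosed : ∀ {Γ} → Pred (Env A Γ) ℓ → Set ℓ
    IsClosed X = ∀ a → (∀ ε → 0# < ε → ∃[ b ] X b × Within ε a b) → X a

  record Embedding (A B : CStarAlgebra ℝ) : Set ℓ where
    private
      module A = CStarAlgebra A
      module B = CStarAlgebra B
    field
      map       : A.Carrier → B.Carrier
      map-cong  : ∀ {x y} → x A.≈ᴹ y → map x B.≈ᴹ map y
      homo-+    : ∀ x y → map (x A.+ᴹ y) B.≈ᴹ map x B.+ᴹ map y
      homo-∙    : ∀ x y → map (x A.∙ y) B.≈ᴹ map x B.∙ map y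
      homo-⋆    : ∀ x → map (x A.⋆) B.≈ᴹ map x B.⋆
      homo-*ₗ   : ∀ c x → map (c A.*ₗ x) B.≈ᴹ c B.*ₗ map x
      isometric : ∀ x → B.‖ map x ‖ ≈ A.‖ x ‖

    mapBall : ∀ {n} → Ball A n → Ball B n
    mapBall (ball x ‖x‖≤n) = ball (map x) (≤-trans (≤-reflexive (isometric x)) ‖x‖≤n)

    mapEnv : ∀ {Γ} → Env A Γ → Env B Γ
    mapEnv = All.map mapBall

  IsElementaryEmbedding : ∀ {A B} → Embedding A B → Set ℓ
  IsElementaryEmbedding {A} {B} h =
    ∀ {Γ} (φ : Formula Γ) a → eval B φ (Embedding.mapEnv h a) ≈ eval A φ a

  Class : Set (suc ℓ)
  Class = CStarAlgebra ℝ → Set ℓ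

  AllAlgebras : Class
  AllAlgebras _ = ⊤

  IsElementary : Class → Set (suc ℓ)
  IsElementary 𝒞 = Σ[ T ∈ Pred Sentence ℓ ] ∀ A → 𝒞 A ⇔ (∀ φ → T φ → eval A φ [] ≈ 0#)

  -- Only the values on members of the class 𝒞 matter in the definitions below.

  IsDefinablePredicate : Class → ∀ {Γ} → (∀ A → Env A Γ → R) → Set (suc ℓ)
  IsDefinablePredicate 𝒞 {Γ} P =
    Σ[ φ ∈ (ℕ → Formula Γ) ] ∀ ε → 0# < ε → ∃[ N ] ∀ n → N ℕ.≤ n →
      ∀ A → 𝒞 A → ∀ a → ∣ eval A (φ n) a - P A a ∣ ≤ ε

  -- The morphisms of the category of members of 𝒞 are the elementary
  -- embeddings.  These are isometric, so functoriality amounts to X being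
  -- preserved by them.
  record IsUniformAssignment (𝒞 : Class) {Γ} (X : ∀ A → Pred (Env A Γ) ℓ) : Set (suc ℓ) where
    field
      closed     : ∀ A → 𝒞 A → IsClosed A (X A)
      functorial : ∀ A B → 𝒞 A → 𝒞 B → (h : Embedding A B) → IsElementaryEmbedding h →
                   ∀ a → X A a → X B (Embedding.mapEnv h a)

  record IsDefinableSet (𝒞 : Class) {Γ} (X : ∀ A → Pred (Env A Γ) ℓ) : Set (suc ℓ) where
    field
      isUniformAssignment : IsUniformAssignment 𝒞 X
      sup-definable : ∀ {Δ} (ψ : Formula (Γ ++ Δ)) → IsDefinablePredicate 𝒞 {Δ}
        (λ A b → ⨆ (λ ((a , _) : ∃ (X A)) → eval A ψ (++⁺ a b)))
      inf-definable : ∀ {Δ} (ψ : Formula (Γ ++ Δ)) → IsDefinablePredicate 𝒞 {Δ}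
        (λ A b → ⨅ (λ ((a , _) : ∃ (X A)) → eval A ψ (++⁺ a b)))

  -- Projections have norm at most 1, so a set of projections is a subset of
  -- the sort 1.
  inUnitBall : (∀ A → Pred (CStarAlgebra.Carrier A) ℓ) → ∀ A → Pred (Env A (1 ∷ [])) ℓ
  inUnitBall P A (x ∷ []) = P A (point x)

  AbelianProjections FiniteProjections InfiniteProjections :
    ∀ A → Pred (Env A (1 ∷ [])) ℓ
  AbelianProjections  = inUnitBall IsAbelianProjection
  FiniteProjections   = inUnitBall IsFiniteProjection
  InfiniteProjections = inUnitBall IsInfiniteProjection

  HasAbelianProjection HasFiniteProjection HasInfiniteProjection : Class
  HasAbelianProjection A  = ∃ (IsAbelianProjection A)
  HasFiniteProjection A   = ∃ (IsFiniteProjection A)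
  HasInfiniteProjection A = ∃ (IsInfiniteProjection A)

{-# OPTIONS --safe #-}
-- Each of the three sets is the zero set, among projections, of a formula θ whose
-- values have a gap: on projections θ is 0 or bounded below.  An approximate
-- projection is close to a projection, and θ is uniformly continuous uniformly
-- over all C*-algebras, so that max(‖x² - x‖, ‖x* - x‖, θ(x)) controls the distance
-- of x to the set.  A supremum of ψ over the set is then the limit of suprema of
-- ψ - Kφ over the unit ball.
--
-- For abelian projections the gap holds since commutators of unitaries satisfy
-- [u², y] ≈ 2u[u, y], so that they cannot all be small unless they vanish.  A
-- projection p is infinite iff pAp contains a nonunitary isometry, and elements of
-- pAp that are almost nonunitary isometries are close to such.
--
-- Functional calculus is replaced by Newton iterations: a ↦ 3a² - 2a³ for
-- projections and w ↦ w(3 - w*w)/2 for isometries.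
module Submission where

open import Defs
open import Axiom.ExcludedMiddle using (ExcludedMiddle)
open import Data.Product.Base using (_×_)
open import Algebra.Bundles using (CommutativeRing; RingWithoutOne)
open import Data.Bool.Base using (Bool; true; false; not; _xor_)
open import Data.Fin.Base using (Fin; zero; suc)
open import Data.Fin.Patterns
open import Data.List.Base using (List; []; _∷_)
open import Data.List.Relation.Unary.All as All using (All; []; _∷_)
open import Data.List.Relation.Unary.All.Properties using (++⁺)
open import Data.List.Relation.Unary.Any using (here; there)
open import Data.Maybe.Base using (Maybe; just; nothing; maybe′; _>>=_)
open import Data.Nat.Base as ℕ using (ℕ)
open import Data.Product.Base using (Σ-syntax; ∃; ∃-syntax; _,_; proj₁; proj₂)
open import Data.Sum.Base using (inj₁; inj₂)
open import Data.Vec.Base as Vec using (Vec; []; _∷_)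
open import Data.Vec.Functional as Vector using (Vector)
open import Function.Bundles using (mk⇔)
open import Relation.Binary.Definitions using (DecidableEquality)
open import Relation.Binary.PropositionalEquality as ≡ using (_≡_)
open import Relation.Nullary.Decidable.Core using (yes; no; _×-dec_; map′)
open import Relation.Nullary.Negation.Core using (¬_; contradiction)
open import Relation.Unary using (Pred)
import Algebra.Construct.NaturalChoice.Max as Max
import Algebra.Construct.NaturalChoice.MaxOp as MaxOp
import Algebra.Properties.CommutativeSemigroup as CommutativeSemigroupProperties
import Algebra.Properties.Ring as RingProperties
import Algebra.Properties.RingWithoutOne as RingWithoutOneProperties
import Algebra.Solver.Ring.NaturalCoefficients.Default as SemiringSolver
import Data.Bool.Properties as Boolₚ
import Data.Fin.Properties as Finₚ
import Data.Nat.Properties as ℕₚ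
import Level
import Relation.Binary.Reasoning.Setoid as SetoidReasoning

module RealAnalysis {ℓ} (ℝ : CompleteOrderedField ℓ) (lem : ExcludedMiddle ℓ) where
  open CompleteOrderedField ℝ renaming (Carrier to R; zero to *-zero)
  open RingProperties ring using (-‿+-comm; -‿involutive; -0#≈0#)
  open SemiringSolver commutativeSemiring using (solve; _:=_; _:+_; _:*_)
  open MaxOp (Max.maxOperator totalOrder) using (x≤x⊔y; x≤y⊔x; ⊔-lub) public

  ≤-resp : ∀ {x x′ y y′} → x ≈ x′ → y ≈ y′ → x ≤ y → x′ ≤ y′
  ≤-resp e e′ p = ≤-trans (≤-reflexive (sym e)) (≤-trans p (≤-reflexive e′))

  +-monoʳ-≤ : ∀ x {y z} → y ≤ z → x + y ≤ x + z
  +-monoʳ-≤ x = +-mono-≤ ≤-refl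

  x+z-z≈x : ∀ x z → x + z - z ≈ x
  x+z-z≈x x z = trans (+-assoc x z (- z)) (trans (+-congˡ (-‿inverseʳ z)) (+-identityʳ x))

  +-cancelʳ-≤ : ∀ z {x y} → x + z ≤ y + z → x ≤ y
  +-cancelʳ-≤ z {x} {y} p = ≤-resp (x+z-z≈x x z) (x+z-z≈x y z) (+-monoˡ-≤ (- z) p)

  -- The inequality l ≤ r is certified by an inequality a ≤ b, a sum of
  -- hypotheses, with r - l ≈ b - a.
  ≤-by : ∀ {a b l r} → a ≤ b → l + b ≈ r + a → l ≤ r
  ≤-by {a} {b} {l} {r} a≤b e = +-cancelʳ-≤ a (≤-trans (+-monoʳ-≤ l a≤b) (≤-reflexive e))

  x-y+y≈x : ∀ x y → x - y + y ≈ x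
  x-y+y≈x x y = trans (+-assoc x (- y) y) (trans (+-congˡ (-‿inverseˡ y)) (+-identityʳ x))

  x+[y-x]≈y : ∀ x y → x + (y - x) ≈ y
  x+[y-x]≈y x y = trans (+-comm x (y - x)) (x-y+y≈x y x)

  -x+[x+y]≈y : ∀ x y → - x + (x + y) ≈ y
  -x+[x+y]≈y x y = trans (sym (+-assoc (- x) x y)) (trans (+-congʳ (-‿inverseˡ x)) (+-identityˡ y))

  -x+y+x≈y : ∀ x y → - x + y + x ≈ y
  -x+y+x≈y x y = trans (+-congʳ (+-comm (- x) y)) (x-y+y≈x y x)

  x+y≤z⇒x≤z-y : ∀ {x y z} → x + y ≤ z → x ≤ z - y
  x+y≤z⇒x≤z-y {x} {y} p = ≤-resp (x+z-z≈x x y) refl (+-monoˡ-≤ (- y) p)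

  x-y≤z⇒x≤y+z : ∀ {x y z} → x - y ≤ z → x ≤ y + z
  x-y≤z⇒x≤y+z {x} {y} {z} p = ≤-resp (x-y+y≈x x y) (+-comm z y) (+-monoˡ-≤ y p)

  x≤y+z⇒x-y≤z : ∀ {x y z} → x ≤ y + z → x - y ≤ z
  x≤y+z⇒x-y≤z {x} {y} {z} p =
    ≤-resp refl (trans (+-congʳ (+-comm y z)) (x+z-z≈x z y)) (+-monoˡ-≤ (- y) p)

  -‿anti-≤ : ∀ {x y} → x ≤ y → - y ≤ - x
  -‿anti-≤ {x} {y} x≤y = ≤-by x≤y (trans (-‿inverseˡ y) (sym (-‿inverseˡ x)))

  +-nonneg : ∀ {x y} → 0# ≤ x → 0# ≤ y → 0# ≤ x + y
  +-nonneg 0≤x 0≤y = ≤-resp (+-identityˡ 0#) refl (+-mono-≤ 0≤x 0≤y)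

  x≤x+y : ∀ {x y} → 0# ≤ y → x ≤ x + y
  x≤x+y {x} 0≤y = ≤-resp (+-identityʳ x) refl (+-monoʳ-≤ x 0≤y)

  <⇒≤ : ∀ {x y} → x < y → x ≤ y
  <⇒≤ = proj₁

  <⇒≰ : ∀ {x y} → x < y → ¬ y ≤ x
  <⇒≰ (x≤y , x≉y) y≤x = x≉y (≤-antisym x≤y y≤x)

  ≰⇒< : ∀ {x y} → ¬ y ≤ x → x < y
  ≰⇒< {x} {y} y≰x with ≤-total x y
  ... | inj₁ x≤y = x≤y , λ x≈y → y≰x (≤-reflexive (sym x≈y))
  ... | inj₂ y≤x = contradiction y≤x y≰x

  ≰⇒≥ : ∀ {x y} → ¬ y ≤ x → x ≤ y
  ≰⇒≥ y≰x = <⇒≤ (≰⇒< y≰x)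

  <-≤-trans : ∀ {x y z} → x < y → y ≤ z → x < z
  <-≤-trans x<y y≤z = ≰⇒< λ z≤x → <⇒≰ x<y (≤-trans y≤z z≤x)

  0<1 : 0# < 1#
  0<1 = 0≤1 , 0≉1

  quotient : ∀ x {y} → 0# < y → ∃[ z ] z * y ≈ x × (0# ≤ x → 0# ≤ z) × (0# < x → 0# < z)
  quotient x {y} (0≤y , 0≉y) = x * y⁻¹ , e , nonneg , λ (0≤x , 0≉x) →
    nonneg 0≤x , λ 0≈z → 0≉x (trans (sym (zeroˡ y)) (trans (*-congʳ 0≈z) e))
    where
    y≉0 : ¬ y ≈ 0#
    y≉0 y≈0 = 0≉y (sym y≈0)
    y⁻¹ = proj₁ (invertible y y≉0)
    e : x * y⁻¹ * y ≈ x
    e = trans (*-assoc _ _ _) (trans (*-congˡ (trans (*-comm _ _) (proj₂ (invertible y y≉0)))) (*-identityʳ x))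
    nonneg : 0# ≤ x → 0# ≤ x * y⁻¹
    nonneg 0≤x = *-cancelʳ-≤ 0≤y y≉0 (≤-resp (sym (zeroˡ y)) (sym e) 0≤x)

  1≤2 : 1# ≤ 1# + 1#
  1≤2 = x≤x+y 0≤1

  0<2 : 0# < 1# + 1#
  0<2 = <-≤-trans 0<1 1≤2

  ½ : R
  ½ = proj₁ (quotient 1# 0<2)

  0<½ : 0# < ½
  0<½ = proj₂ (proj₂ (proj₂ (quotient 1# 0<2))) 0<1

  ½+½≈1 : ½ + ½ ≈ 1#
  ½+½≈1 = trans (sym (trans (distribˡ ½ 1# 1#) (+-cong (*-identityʳ ½) (*-identityʳ ½))))
                (proj₁ (proj₂ (quotient 1# 0<2)))

  half : R → R
  half x = ½ * x

  half+half : ∀ x → half x + half x ≈ x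
  half+half x = trans (sym (distribʳ x ½ ½)) (trans (*-congʳ ½+½≈1) (*-identityˡ x))

  0≤half : ∀ {x} → 0# ≤ x → 0# ≤ half x
  0≤half = *-nonneg (<⇒≤ 0<½)

  0<half : ∀ {x} → 0# < x → 0# < half x
  0<half {x} (0≤x , 0≉x) = 0≤half 0≤x , λ 0≈h →
    0≉x (trans (sym (+-identityˡ 0#)) (trans (+-cong 0≈h 0≈h) (half+half x)))

  half≤ : ∀ {x} → 0# ≤ x → half x ≤ x
  half≤ {x} 0≤x = ≤-resp refl (half+half x) (x≤x+y (0≤half 0≤x))

  x+x≤y⇒x≤half : ∀ {x y} → x + x ≤ y → x ≤ half y
  x+x≤y⇒x≤half {x} {y} p with ≤-total x (half y)
  ... | inj₁ x≤h = x≤h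
  ... | inj₂ h≤x = ≤-by (≤-trans (≤-trans (+-monoˡ-≤ x h≤x) p) (≤-reflexive (sym (half+half y))))
    (solve 2 (λ x h → x :+ (h :+ h) := h :+ (h :+ x)) refl x (half y))

  2* 4* 8* 16* : R → R
  2* x  = x + x
  4* x  = 2* (2* x)
  8* x  = 2* (4* x)
  16* x = 2* (8* x)

  2*-mono : ∀ {x y} → x ≤ y → 2* x ≤ 2* y
  2*-mono p = +-mono-≤ p p

  16*-mono : ∀ {x y} → x ≤ y → 16* x ≤ 16* y
  16*-mono p = 2*-mono (2*-mono (2*-mono (2*-mono p)))

  0≤2* : ∀ {x} → 0# ≤ x → 0# ≤ 2* x
  0≤2* p = +-nonneg p p

  0≤8* : ∀ {x} → 0# ≤ x → 0# ≤ 8* x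
  0≤8* p = 0≤2* (0≤2* (0≤2* p))

  0≤16* : ∀ {x} → 0# ≤ x → 0# ≤ 16* x
  0≤16* p = 0≤2* (0≤8* p)

  x≤16x : ∀ {x} → 0# ≤ x → x ≤ 16* x
  x≤16x p = ≤-trans (x≤x+y p) (≤-trans (x≤x+y (0≤2* p)) (≤-trans (x≤x+y (0≤2* (0≤2* p))) (x≤x+y (0≤8* p))))

  private
    2*½*½ : ∀ x → 2* (2* (half (half x))) ≈ x
    2*½*½ x = trans (+-cong (half+half _) (half+half _)) (half+half x)

    2*-cong : ∀ {x y} → x ≈ y → 2* x ≈ 2* y
    2*-cong e = +-cong e e

  opaque
    sixteenth : R → R
    sixteenth x = half (half (half (half x)))

    0<sixteenth : ∀ {x} → 0# < x → 0# < sixteenth x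
    0<sixteenth 0<x = 0<half (0<half (0<half (0<half 0<x)))

    16*sixteenth : ∀ x → 16* (sixteenth x) ≈ x
    16*sixteenth x = trans (2*-cong (2*-cong (2*½*½ (half (half x))))) (2*½*½ x)

  ⅛ : R
  ⅛ = half (half ½)

  16*-cong : ∀ {x y} → x ≈ y → 16* x ≈ 16* y
  16*-cong e = 2*-cong (2*-cong (2*-cong (2*-cong e)))

  ≤-limit : ∀ {x y} → (∀ ε → 0# < ε → x ≤ y + ε) → x ≤ y
  ≤-limit {x} {y} p with lem {x ≤ y}
  ... | yes x≤y = x≤y
  ... | no  x≰y = contradiction h≤0 (<⇒≰ 0<h)
    where
    0<x-y : 0# < x - y
    0<x-y = ≰⇒< λ x-y≤0 → x≰y (≤-resp refl (+-identityʳ y) (x-y≤z⇒x≤y+z x-y≤0))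
    h = half (x - y)
    0<h = 0<half 0<x-y
    h≤0 : h ≤ 0#
    h≤0 = ≤-by (x≤y+z⇒x-y≤z (p h 0<h)) (trans (+-comm h h) (trans (half+half (x - y)) (sym (+-identityˡ _))))

  min₂ : ∀ {x y} → 0# < x → 0# < y → ∃[ z ] 0# < z × z ≤ x × z ≤ y
  min₂ {x} {y} 0<x 0<y with ≤-total x y
  ... | inj₁ x≤y = x , 0<x , ≤-refl , x≤y
  ... | inj₂ y≤x = y , 0<y , y≤x , ≤-refl

  max₂ : ∀ x y → ∃[ z ] x ≤ z × y ≤ z
  max₂ x y = x ⊔ y , x≤x⊔y x y , x≤y⊔x x y

  min-Fin : ∀ {p k} (P : Fin k → R → Set p) → (∀ i {δ δ′} → δ′ ≤ δ → P i δ → P i δ′) →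
            (∀ i → ∃[ δ ] 0# < δ × P i δ) → ∃[ δ ] 0# < δ × (∀ i → P i δ)
  min-Fin {k = ℕ.zero}  P mono p = 1# , 0<1 , λ ()
  min-Fin {k = ℕ.suc k} P mono p =
    let δ₀ , 0<δ₀ , p₀ = p zero
        δ₁ , 0<δ₁ , p₁ = min-Fin (λ i → P (suc i)) (λ i → mono (suc i)) (λ i → p (suc i))
        δ , 0<δ , δ≤δ₀ , δ≤δ₁ = min₂ 0<δ₀ 0<δ₁
    in δ , 0<δ , λ { zero → mono zero δ≤δ₀ p₀ ; (suc i) → mono (suc i) δ≤δ₁ (p₁ i) }

  max-Fin : ∀ {p k} (P : Fin k → R → Set p) → (∀ i {M M′} → M ≤ M′ → P i M → P i M′) →
            (∀ i → ∃[ M ] P i M) → ∃[ M ] 0# ≤ M × (∀ i → P i M)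
  max-Fin {k = ℕ.zero}  P mono p = 0# , ≤-refl , λ ()
  max-Fin {k = ℕ.suc k} P mono p =
    let M₀ , p₀ = p zero
        M₁ , 0≤M₁ , p₁ = max-Fin (λ i → P (suc i)) (λ i → mono (suc i)) (λ i → p (suc i))
        M , M₀≤M , M₁≤M = max₂ M₀ M₁
    in M , ≤-trans 0≤M₁ M₁≤M , λ { zero → mono zero M₀≤M p₀ ; (suc i) → mono (suc i) M₁≤M (p₁ i) }

  ∣∣≤ : ∀ {x y} → x ≤ y → - x ≤ y → ∣ x ∣ ≤ y
  ∣∣≤ = ⊔-lub

  x≤∣x∣ : ∀ x → x ≤ ∣ x ∣
  x≤∣x∣ x = x≤x⊔y x (- x)

  -x≤∣x∣ : ∀ x → - x ≤ ∣ x ∣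
  -x≤∣x∣ x = x≤y⊔x x (- x)

  -[x-y]≈y-x : ∀ x y → - (x - y) ≈ y - x
  -[x-y]≈y-x x y = trans (sym (-‿+-comm x (- y))) (trans (+-comm _ _) (+-congʳ (-‿involutive y)))

  ∣x-y∣≤ : ∀ {x y z} → x ≤ y + z → y ≤ x + z → ∣ x - y ∣ ≤ z
  ∣x-y∣≤ {x} {y} p q = ∣∣≤ (x≤y+z⇒x-y≤z p) (≤-resp (sym (-[x-y]≈y-x x y)) refl (x≤y+z⇒x-y≤z q))

  ∣x-y∣≤⇒x≤y+z : ∀ {x y z} → ∣ x - y ∣ ≤ z → x ≤ y + z
  ∣x-y∣≤⇒x≤y+z p = x-y≤z⇒x≤y+z (≤-trans (x≤∣x∣ _) p)

  ∣x-y∣≤⇒y≤x+z : ∀ {x y z} → ∣ x - y ∣ ≤ z → y ≤ x + z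
  ∣x-y∣≤⇒y≤x+z {x} {y} p = x-y≤z⇒x≤y+z (≤-trans (≤-resp (-[x-y]≈y-x x y) refl (-x≤∣x∣ _)) p)

  ∣x∣≤⇒-y≤x : ∀ {x y} → ∣ x ∣ ≤ y → - y ≤ x
  ∣x∣≤⇒-y≤x {x} p = ≤-resp refl (-‿involutive x) (-‿anti-≤ (≤-trans (-x≤∣x∣ x) p))

  ∣x-y∣-comm : ∀ {x y z} → ∣ x - y ∣ ≤ z → ∣ y - x ∣ ≤ z
  ∣x-y∣-comm p = ∣x-y∣≤ (∣x-y∣≤⇒y≤x+z p) (∣x-y∣≤⇒x≤y+z p)

  ∣∣-triangle : ∀ {x y z a b c} → ∣ x - y ∣ ≤ a → ∣ y - z ∣ ≤ b → a + b ≤ c → ∣ x - z ∣ ≤ c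
  ∣∣-triangle {x} {y} {z} {a} {b} {c} p q r = ∣x-y∣≤
    (≤-by (+-mono-≤ (+-mono-≤ (∣x-y∣≤⇒x≤y+z p) (∣x-y∣≤⇒x≤y+z q)) r)
      (solve 6 (λ x y z a b c → x :+ (((y :+ a) :+ (z :+ b)) :+ c) := (z :+ c) :+ ((x :+ y) :+ (a :+ b))) refl x y z a b c))
    (≤-by (+-mono-≤ (+-mono-≤ (∣x-y∣≤⇒y≤x+z p) (∣x-y∣≤⇒y≤x+z q)) r)
      (solve 6 (λ x y z a b c → z :+ (((x :+ a) :+ (y :+ b)) :+ c) := (x :+ c) :+ ((y :+ z) :+ (a :+ b))) refl x y z a b c))

  ∣x-x∣≤ : ∀ {x z} → 0# ≤ z → ∣ x - x ∣ ≤ z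
  ∣x-x∣≤ 0≤z = ∣x-y∣≤ (x≤x+y 0≤z) (x≤x+y 0≤z)

  0≤∣x∣ : ∀ x → 0# ≤ ∣ x ∣
  0≤∣x∣ x with ≤-total 0# x
  ... | inj₁ 0≤x = ≤-trans 0≤x (x≤∣x∣ x)
  ... | inj₂ x≤0 = ≤-trans (≤-resp -0#≈0# refl (-‿anti-≤ x≤0)) (-x≤∣x∣ x)

  ∣x∣≤∣y∣+z : ∀ {x y z} → ∣ x - y ∣ ≤ z → ∣ x ∣ ≤ ∣ y ∣ + z
  ∣x∣≤∣y∣+z {x} {y} {z} p = ∣∣≤
    (≤-trans (∣x-y∣≤⇒x≤y+z p) (+-monoˡ-≤ z (x≤∣x∣ y)))
    (≤-trans (≤-by (∣x-y∣≤⇒y≤x+z p) (trans (-x+[x+y]≈y x z) (sym (-x+y+x≈y y z)))) (+-monoˡ-≤ z (-x≤∣x∣ y)))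

  x*x≤y*y⇒x≤y : ∀ {x y} → 0# ≤ y → x * x ≤ y * y → x ≤ y
  x*x≤y*y⇒x≤y {x} {y} 0≤y p with ≤-total x y
  ... | inj₁ x≤y = x≤y
  ... | inj₂ y≤x with lem {x ≈ 0#}
  ... | yes x≈0 = ≤-trans (≤-reflexive x≈0) 0≤y
  ... | no  x≉0 = *-cancelʳ-≤ (≤-trans 0≤y y≤x) x≉0
          (≤-trans p (≤-trans (*-monoʳ-≤ 0≤y y≤x) (≤-reflexive (*-comm x y))))

  x*x≈y*y⇒x≈y : ∀ {x y} → 0# ≤ x → 0# ≤ y → x * x ≈ y * y → x ≈ y
  x*x≈y*y⇒x≈y 0≤x 0≤y e = ≤-antisym
    (x*x≤y*y⇒x≤y 0≤y (≤-reflexive e)) (x*x≤y*y⇒x≤y 0≤x (≤-reflexive (sym e)))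

  halving⇒vanishing : (a : ℕ → R) → (∀ n → 0# ≤ a n) → (∀ n → a (ℕ.suc n) + a (ℕ.suc n) ≤ a n) →
                      ∀ ε → 0# < ε → ∃[ N ] ∀ n → N ℕ.≤ n → a n ≤ ε
  halving⇒vanishing a 0≤a a-halves ε 0<ε with lem {∃[ N ] a N ≤ ε}
  ... | yes (N , aN≤ε) = N , λ n N≤n → ≤-trans (antitone N≤n) aN≤ε
    where
    step : ∀ n → a (ℕ.suc n) ≤ a n
    step n = ≤-trans (x≤x+y (0≤a (ℕ.suc n))) (a-halves n)
    antitone′ : ∀ k m → a (k ℕ.+ m) ≤ a m
    antitone′ ℕ.zero    m = ≤-refl
    antitone′ (ℕ.suc k) m = ≤-trans (step (k ℕ.+ m)) (antitone′ k m)
    antitone : ∀ {m n} → m ℕ.≤ n → a n ≤ a m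
    antitone {m} {n} m≤n = ≡.subst (λ i → a i ≤ a m) (ℕₚ.m∸n+n≡m m≤n) (antitone′ (n ℕ.∸ m) m)
  ... | no ¬small = contradiction (≤-trans ε≤s s≤0) (<⇒≰ 0<ε)
    where
    S : R → Set ℓ
    S x = ∀ n → x ≤ a n
    s-lub = complete S (0# , 0≤a) (a 0 , λ x x∈S → x∈S 0)
    s = proj₁ s-lub
    s∈S : S s
    s∈S n = proj₂ (proj₂ s-lub) (a n) (λ x x∈S → x∈S n)
    s≤0 : s ≤ 0#
    s≤0 = ≤-by (proj₁ (proj₂ s-lub) (s + s) λ n → ≤-trans (+-mono-≤ (s∈S (ℕ.suc n)) (s∈S (ℕ.suc n))) (a-halves n))
               (sym (+-identityˡ _))
    ε≤s : ε ≤ s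
    ε≤s = proj₁ (proj₂ s-lub) ε λ n → ≰⇒≥ λ an≤ε → ¬small (n , an≤ε)

  ½^_ : ℕ → R
  ½^ ℕ.zero  = 1#
  ½^ ℕ.suc n = half (½^ n)

  0<½^ : ∀ n → 0# < ½^ n
  0<½^ ℕ.zero    = 0<1
  0<½^ (ℕ.suc n) = 0<half (0<½^ n)

  ½^-vanishes : ∀ ε → 0# < ε → ∃[ N ] ∀ n → N ℕ.≤ n → ½^ n ≤ ε
  ½^-vanishes = halving⇒vanishing ½^_ (λ n → <⇒≤ (0<½^ n)) (λ n → ≤-reflexive (half+half (½^ n)))

  module _ (P : R → R → Set ℓ) (mono : ∀ x {δ δ′} → δ′ ≤ δ → P x δ → P x δ′)
           (local : ∀ y → ∃[ δ ] 0# < δ × (∀ x → ∣ x - y ∣ ≤ δ → P x δ)) where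

    interval-compact : ∀ {a b} → a ≤ b → ∃[ δ ] 0# < δ × (∀ x → a ≤ x → x ≤ b → P x δ)
    interval-compact {a} {b} a≤b = finish (≤-total (c + δ) b)
      where
      S : R → Set ℓ
      S s = s ≤ b × ∃[ δ ] 0# < δ × (∀ x → a ≤ x → x ≤ s → P x δ)
      a∈S : S a
      a∈S = let δ , 0<δ , p = local a in a≤b , δ , 0<δ , λ x a≤x x≤a →
        p x (∣x-y∣≤ (≤-trans x≤a (x≤x+y (<⇒≤ 0<δ))) (≤-trans a≤x (x≤x+y (<⇒≤ 0<δ))))
      c-lub = complete S (a , a∈S) (b , λ _ → proj₁)
      c = proj₁ c-lub
      δ   = proj₁ (local c)
      0<δ = proj₁ (proj₂ (local c))
      near-c : ∃[ s ] S s × c ≤ s + δ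
      near-c with lem {∃[ s ] S s × c ≤ s + δ}
      ... | yes p = p
      ... | no ¬p = contradiction
        (≤-by c≤c-δ (trans (x+[y-x]≈y δ c) (sym (+-identityˡ c)))) (<⇒≰ 0<δ)
        where
        c≤c-δ : c ≤ c - δ
        c≤c-δ = proj₂ (proj₂ c-lub) (c - δ) λ s s∈S →
          x+y≤z⇒x≤z-y (≰⇒≥ λ c≤s+δ → ¬p (s , s∈S , c≤s+δ))
      extend : ∀ {s} → s ≤ c + δ → ∃[ δ′ ] 0# < δ′ × (∀ x → a ≤ x → x ≤ s → P x δ′)
      extend {s} s≤c+δ = δ″ , 0<δ″ , covered
        where
        s₀ = proj₁ near-c
        s₀-cover = proj₂ (proj₁ (proj₂ near-c))
        δ₀ = proj₁ s₀-cover
        both = min₂ 0<δ (proj₁ (proj₂ s₀-cover))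
        δ″ = proj₁ both
        0<δ″ = proj₁ (proj₂ both)
        covered : ∀ x → a ≤ x → x ≤ s → P x δ″
        covered x a≤x x≤s with ≤-total x s₀
        ... | inj₁ x≤s₀ = mono x (proj₂ (proj₂ (proj₂ both))) (proj₂ (proj₂ s₀-cover) x a≤x x≤s₀)
        ... | inj₂ s₀≤x = mono x (proj₁ (proj₂ (proj₂ both))) (proj₂ (proj₂ (local c)) x
                (∣x-y∣≤ (≤-trans x≤s s≤c+δ) (≤-trans (proj₂ (proj₂ near-c)) (+-monoˡ-≤ δ s₀≤x))))
      finish : _ → ∃[ δ′ ] 0# < δ′ × (∀ x → a ≤ x → x ≤ b → P x δ′)
      finish (inj₂ b≤c+δ) = extend b≤c+δ
      finish (inj₁ c+δ≤b) = contradiction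
        (≤-by (proj₁ (proj₂ c-lub) (c + δ) (c+δ≤b , extend ≤-refl)) (trans (+-comm δ c) (sym (+-identityˡ _))))
        (<⇒≰ 0<δ)

  box-compact : ∀ k {M} → 0# ≤ M → (P : Vector R k → R → Set ℓ) →
    (∀ x {δ δ′} → δ′ ≤ δ → P x δ → P x δ′) →
    (∀ (y : Vector R k) → ∃[ δ ] 0# < δ × (∀ x → (∀ i → ∣ x i - y i ∣ ≤ δ) → P x δ)) →
    ∃[ δ ] 0# < δ × (∀ x → (∀ i → ∣ x i ∣ ≤ M) → P x δ)
  box-compact ℕ.zero 0≤M P mono local =
    let δ , 0<δ , p = local (λ ()) in δ , 0<δ , λ x _ → p x λ ()
  box-compact (ℕ.suc k) {M} 0≤M P mono local =
    let δ , 0<δ , p = interval-compact slab slab-mono slab-local -M≤M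
    in δ , 0<δ , λ x ∣x∣≤M → p (x zero) (∣x∣≤⇒-y≤x (∣x∣≤M zero))
         (≤-trans (x≤∣x∣ _) (∣x∣≤M zero)) x ≡.refl (λ i → ∣x∣≤M (suc i))
    where
    -M≤M : - M ≤ M
    -M≤M = ≤-trans (≤-resp refl -0#≈0# (-‿anti-≤ 0≤M)) 0≤M
    slab : R → R → Set ℓ
    slab t δ = ∀ x → x zero ≡ t → (∀ i → ∣ x (suc i) ∣ ≤ M) → P x δ
    slab-mono : ∀ t {δ δ′} → δ′ ≤ δ → slab t δ → slab t δ′
    slab-mono t δ′≤δ p x e x≤M = mono x δ′≤δ (p x e x≤M)
    slab-local : ∀ t → ∃[ δ ] 0# < δ × (∀ s → ∣ s - t ∣ ≤ δ → slab s δ)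
    slab-local t =
      let δ , 0<δ , p = box-compact k 0≤M fibre fibre-mono fibre-local
      in δ , 0<δ , λ { s ∣s-t∣≤δ x ≡.refl x≤M → p (λ i → x (suc i)) x≤M x ∣s-t∣≤δ (λ i → ≡.refl) }
      where
      fibre : Vector R k → R → Set ℓ
      fibre x′ δ = ∀ x → ∣ x zero - t ∣ ≤ δ → (∀ i → x (suc i) ≡ x′ i) → P x δ
      fibre-mono : ∀ x′ {δ δ′} → δ′ ≤ δ → fibre x′ δ → fibre x′ δ′
      fibre-mono x′ δ′≤δ p x q e = mono x δ′≤δ (p x (≤-trans q δ′≤δ) e)
      fibre-local : ∀ y′ → ∃[ δ ] 0# < δ × (∀ x′ → (∀ i → ∣ x′ i - y′ i ∣ ≤ δ) → fibre x′ δ)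
      fibre-local y′ =
        let δ , 0<δ , p = local (t Vector.∷ y′)
        in δ , 0<δ , λ x′ q x q₀ e → p x λ
             { zero → q₀
             ; (suc i) → ≡.subst (λ u → ∣ u - y′ i ∣ ≤ δ) (≡.sym (e i)) (q i) }

  module _ {k} (f : Vector R k → R) (f-cont : Continuous f) {M} (0≤M : 0# ≤ M) where

    uniformly-continuous-on-box : ∀ ε → 0# < ε → ∃[ δ ] 0# < δ ×
      (∀ x → (∀ i → ∣ x i ∣ ≤ M) → ∀ y → (∀ i → ∣ x i - y i ∣ ≤ δ) → ∣ f x - f y ∣ ≤ ε)
    uniformly-continuous-on-box ε 0<ε = box-compact k 0≤M
      (λ x δ → ∀ y → (∀ i → ∣ x i - y i ∣ ≤ δ) → ∣ f x - f y ∣ ≤ ε)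
      (λ x δ′≤δ p y q → p y (λ i → ≤-trans (q i) δ′≤δ))
      (λ z → let δ , 0<δ , p = f-cont z (half ε) (0<half 0<ε) in half δ , 0<half 0<δ , λ x x~z y x~y →
        ∣∣-triangle
          (∣x-y∣-comm (p x (λ i → ≤-trans (∣x-y∣-comm (x~z i)) (half≤ (<⇒≤ 0<δ)))))
          (p y (λ i → ∣∣-triangle (∣x-y∣-comm (x~z i)) (x~y i) (≤-reflexive (half+half δ))))
          (≤-reflexive (half+half ε)))

    bounded-on-box : ∃[ B ] (∀ x → (∀ i → ∣ x i ∣ ≤ M) → ∣ f x ∣ ≤ B)
    bounded-on-box =
      let δ , 0<δ , p = box-compact k 0≤M (λ x δ → δ * ∣ f x ∣ ≤ 1#)
            (λ x δ′≤δ → ≤-trans (*-monoʳ-≤ (0≤∣x∣ (f x)) δ′≤δ)) local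
          B , Bδ≈1 , _ = quotient 1# 0<δ
      in B , λ x q → *-cancelʳ-≤ (<⇒≤ 0<δ) (λ δ≈0 → proj₂ 0<δ (sym δ≈0))
           (≤-resp (*-comm _ _) (sym Bδ≈1) (p x q))
      where
      local : ∀ y → ∃[ δ ] 0# < δ × (∀ x → (∀ i → ∣ x i - y i ∣ ≤ δ) → δ * ∣ f x ∣ ≤ 1#)
      local y =
        let C = ∣ f y ∣ + 1#
            0<C = <-≤-trans 0<1 (≤-resp (+-identityˡ 1#) refl (+-monoˡ-≤ 1# (0≤∣x∣ (f y))))
            δ₁ , 0<δ₁ , p = f-cont y 1# 0<1
            δ₂ , δ₂C≈1 , _ , 0<δ₂ = quotient 1# 0<C
            δ , 0<δ , δ≤δ₁ , δ≤δ₂ = min₂ 0<δ₁ (0<δ₂ 0<1)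
        in δ , 0<δ , λ x x~y → ≤-trans
             (*-mono-≤ (0≤∣x∣ (f x)) (<⇒≤ (0<δ₂ 0<1)) δ≤δ₂
               (∣x∣≤∣y∣+z (∣x-y∣-comm (p x (λ i → ≤-trans (∣x-y∣-comm (x~y i)) δ≤δ₁)))))
             (≤-reflexive δ₂C≈1)

-- Polynomials in noncommuting variables, without constant term, are normalised
-- to lists of signed words.  The user may supply rules x y → z and x y → 0 for
-- words of two letters; these encode units, idempotents and orthogonality.
module NoncommutativeSolver {c ℓ} (𝑅 : RingWithoutOne c ℓ) where
  open RingWithoutOne 𝑅
  open RingWithoutOneProperties 𝑅
  open SetoidReasoning setoid

  infixl 6 _:+_ _:-_
  infixl 7 _:*_
  infix  8 :-_

  data Expr (n : ℕ) : Set where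
    var       : Fin n → Expr n
    _:+_ _:*_ : Expr n → Expr n → Expr n
    :-_       : Expr n → Expr n

  _:-_ : ∀ {n} → Expr n → Expr n → Expr n
  x :- y = x :+ (:- y)

  infixr 5 _∷ʷ_
  data Word (n : ℕ) : Set where
    [_]ʷ : Fin n → Word n
    _∷ʷ_ : Fin n → Word n → Word n

  _≟ʷ_ : ∀ {n} → DecidableEquality (Word n)
  [ i ]ʷ   ≟ʷ [ j ]ʷ   = map′ (≡.cong [_]ʷ) (λ { ≡.refl → ≡.refl }) (i Finₚ.≟ j)
  [ i ]ʷ   ≟ʷ (j ∷ʷ w) = no λ ()
  (i ∷ʷ v) ≟ʷ [ j ]ʷ   = no λ ()
  (i ∷ʷ v) ≟ʷ (j ∷ʷ w) = map′ (λ { (≡.refl , ≡.refl) → ≡.refl }) (λ { ≡.refl → ≡.refl , ≡.refl })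
                              (i Finₚ.≟ j ×-dec v ≟ʷ w)

  Poly : ℕ → Set
  Poly n = List (Bool × Word n)

  module _ {n} (ρ : Vec Carrier n) where

    ⟦_⟧ : Expr n → Carrier
    ⟦ var i ⟧  = Vec.lookup ρ i
    ⟦ x :+ y ⟧ = ⟦ x ⟧ + ⟦ y ⟧
    ⟦ x :* y ⟧ = ⟦ x ⟧ * ⟦ y ⟧
    ⟦ :- x ⟧   = - ⟦ x ⟧

    ⟦_⟧ʷ : Word n → Carrier
    ⟦ [ i ]ʷ ⟧ʷ = Vec.lookup ρ i
    ⟦ i ∷ʷ w ⟧ʷ = Vec.lookup ρ i * ⟦ w ⟧ʷ

    ⟦_⟧ᵐ : Maybe (Word n) → Carrier
    ⟦ w ⟧ᵐ = maybe′ ⟦_⟧ʷ 0# w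

    signed : Bool → Carrier → Carrier
    signed true  x = x
    signed false x = - x

    ⟦_⟧ᵖ : Poly n → Carrier
    ⟦ [] ⟧ᵖ          = 0#
    ⟦ (s , w) ∷ p ⟧ᵖ = signed s ⟦ w ⟧ʷ + ⟦ p ⟧ᵖ

    record Rule : Set ℓ where
      constructor rule
      field
        left right : Fin n
        result     : Maybe (Fin n)
        sound      : Vec.lookup ρ left * Vec.lookup ρ right ≈ maybe′ (Vec.lookup ρ) 0# result

    module _ (rules : List Rule) where

      Reduct : Fin n → Fin n → Set ℓ
      Reduct i j = Σ[ k ∈ Maybe (Fin n) ] Vec.lookup ρ i * Vec.lookup ρ j ≈ maybe′ (Vec.lookup ρ) 0# k

      reduct : ∀ i j → Maybe (Reduct i j)
      reduct i j = search rules
        where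
        search : List Rule → Maybe (Reduct i j)
        search [] = nothing
        search (rule l r k e ∷ rs) with l Finₚ.≟ i ×-dec r Finₚ.≟ j
        ... | yes (≡.refl , ≡.refl) = just (k , e)
        ... | no  _                 = search rs

      push : Fin n → Word n → Maybe (Word n)
      push i [ j ]ʷ with reduct i j
      ... | nothing            = just (i ∷ʷ [ j ]ʷ)
      ... | just (nothing , _) = nothing
      ... | just (just k  , _) = just [ k ]ʷ
      push i (j ∷ʷ w) with reduct i j
      ... | nothing            = just (i ∷ʷ j ∷ʷ w)
      ... | just (nothing , _) = nothing
      ... | just (just k  , _) = push k w

      push-sound : ∀ i w → ⟦ push i w ⟧ᵐ ≈ Vec.lookup ρ i * ⟦ w ⟧ʷ
      push-sound i [ j ]ʷ with reduct i j
      ... | nothing            = refl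
      ... | just (nothing , e) = sym e
      ... | just (just k  , e) = sym e
      push-sound i (j ∷ʷ w) with reduct i j
      ... | nothing            = refl
      ... | just (nothing , e) = sym (trans (sym (*-assoc _ _ _)) (trans (*-congʳ e) (zeroˡ _)))
      ... | just (just k  , e) = trans (push-sound k w) (trans (*-congʳ (sym e)) (*-assoc _ _ _))

      push-sound′ : ∀ i w → ⟦ w >>= push i ⟧ᵐ ≈ Vec.lookup ρ i * ⟦ w ⟧ᵐ
      push-sound′ i nothing  = sym (zeroʳ _)
      push-sound′ i (just w) = push-sound i w

      _·ʷ_ : Word n → Word n → Maybe (Word n)
      [ i ]ʷ   ·ʷ w = push i w
      (i ∷ʷ v) ·ʷ w = v ·ʷ w >>= push i

      ·ʷ-sound : ∀ v w → ⟦ v ·ʷ w ⟧ᵐ ≈ ⟦ v ⟧ʷ * ⟦ w ⟧ʷ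
      ·ʷ-sound [ i ]ʷ   w = push-sound i w
      ·ʷ-sound (i ∷ʷ v) w = trans (push-sound′ i (v ·ʷ w)) (trans (*-congˡ (·ʷ-sound v w)) (sym (*-assoc _ _ _)))

      insert : Bool → Word n → Poly n → Poly n
      insert s w [] = (s , w) ∷ []
      insert s w ((t , v) ∷ p) with t Boolₚ.≟ not s ×-dec v ≟ʷ w
      ... | yes _ = p
      ... | no  _ = (t , v) ∷ insert s w p

      signed-opposite : ∀ s x → signed s x + signed (not s) x ≈ 0#
      signed-opposite true  x = -‿inverseʳ x
      signed-opposite false x = -‿inverseˡ x

      swap : ∀ x y z → x + (y + z) ≈ y + (x + z)
      swap x y z = trans (sym (+-assoc x y z)) (trans (+-congʳ (+-comm x y)) (+-assoc y x z))

      insert-sound : ∀ s w p → ⟦ insert s w p ⟧ᵖ ≈ signed s ⟦ w ⟧ʷ + ⟦ p ⟧ᵖ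
      insert-sound s w [] = refl
      insert-sound s w ((t , v) ∷ p) with t Boolₚ.≟ not s ×-dec v ≟ʷ w
      ... | yes (≡.refl , ≡.refl) = sym (trans (sym (+-assoc _ _ _))
              (trans (+-congʳ (signed-opposite s ⟦ v ⟧ʷ)) (+-identityˡ _)))
      ... | no  _ = trans (+-congˡ (insert-sound s w p)) (swap _ _ _)

      insertᵐ : Bool → Maybe (Word n) → Poly n → Poly n
      insertᵐ s nothing  p = p
      insertᵐ s (just w) p = insert s w p

      signed-0 : ∀ s → signed s 0# ≈ 0#
      signed-0 true  = refl
      signed-0 false = -0#≈0#

      insertᵐ-sound : ∀ s w p → ⟦ insertᵐ s w p ⟧ᵖ ≈ signed s ⟦ w ⟧ᵐ + ⟦ p ⟧ᵖ
      insertᵐ-sound s nothing  p = sym (trans (+-congʳ (signed-0 s)) (+-identityˡ _))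
      insertᵐ-sound s (just w) p = insert-sound s w p

      -- The flag s is the sign with which p is added to q.
      add : Bool → Poly n → Poly n → Poly n
      add s []            q = q
      add s ((t , w) ∷ p) q = insert (s xor not t) w (add s p q)

      signed-+ : ∀ s x y → signed s (x + y) ≈ signed s x + signed s y
      signed-+ true  x y = refl
      signed-+ false x y = sym (-‿+-comm x y)

      signed-signed : ∀ s t x → signed s (signed t x) ≈ signed (s xor not t) x
      signed-signed true  true  x = refl
      signed-signed true  false x = refl
      signed-signed false true  x = refl
      signed-signed false false x = -‿involutive x

      signed-cong : ∀ s {x y} → x ≈ y → signed s x ≈ signed s y
      signed-cong true  e = e
      signed-cong false e = -‿cong e

      add-sound : ∀ s p q → ⟦ add s p q ⟧ᵖ ≈ signed s ⟦ p ⟧ᵖ + ⟦ q ⟧ᵖ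
      add-sound s [] q = sym (trans (+-congʳ (signed-0 s)) (+-identityˡ _))
      add-sound s ((t , w) ∷ p) q = begin
        ⟦ insert (s xor not t) w (add s p q) ⟧ᵖ
          ≈⟨ insert-sound (s xor not t) w (add s p q) ⟩
        signed (s xor not t) ⟦ w ⟧ʷ + ⟦ add s p q ⟧ᵖ
          ≈⟨ +-cong (sym (signed-signed s t _)) (add-sound s p q) ⟩
        signed s (signed t ⟦ w ⟧ʷ) + (signed s ⟦ p ⟧ᵖ + ⟦ q ⟧ᵖ)
          ≈⟨ +-assoc _ _ _ ⟨
        signed s (signed t ⟦ w ⟧ʷ) + signed s ⟦ p ⟧ᵖ + ⟦ q ⟧ᵖ
          ≈⟨ +-congʳ (signed-+ s _ _) ⟨
        signed s (signed t ⟦ w ⟧ʷ + ⟦ p ⟧ᵖ) + ⟦ q ⟧ᵖ ∎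

      scale : Bool → Word n → Poly n → Poly n
      scale s w []            = []
      scale s w ((t , v) ∷ p) = insertᵐ (s xor not t) (w ·ʷ v) (scale s w p)

      signed-*ˡ : ∀ s x y → signed s x * y ≈ signed s (x * y)
      signed-*ˡ true  x y = refl
      signed-*ˡ false x y = sym (-‿distribˡ-* x y)

      signed-*ʳ : ∀ s x y → x * signed s y ≈ signed s (x * y)
      signed-*ʳ true  x y = refl
      signed-*ʳ false x y = sym (-‿distribʳ-* x y)

      scale-sound : ∀ s w p → ⟦ scale s w p ⟧ᵖ ≈ signed s ⟦ w ⟧ʷ * ⟦ p ⟧ᵖ
      scale-sound s w [] = sym (zeroʳ _)
      scale-sound s w ((t , v) ∷ p) = begin
        ⟦ insertᵐ (s xor not t) (w ·ʷ v) (scale s w p) ⟧ᵖ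
          ≈⟨ insertᵐ-sound (s xor not t) (w ·ʷ v) _ ⟩
        signed (s xor not t) ⟦ w ·ʷ v ⟧ᵐ + ⟦ scale s w p ⟧ᵖ
          ≈⟨ +-cong (signed-cong (s xor not t) (·ʷ-sound w v)) (scale-sound s w p) ⟩
        signed (s xor not t) (⟦ w ⟧ʷ * ⟦ v ⟧ʷ) + signed s ⟦ w ⟧ʷ * ⟦ p ⟧ᵖ
          ≈⟨ +-congʳ (signed-signed s t _) ⟨
        signed s (signed t (⟦ w ⟧ʷ * ⟦ v ⟧ʷ)) + signed s ⟦ w ⟧ʷ * ⟦ p ⟧ᵖ
          ≈⟨ +-congʳ (signed-cong s (signed-*ʳ t _ _)) ⟨
        signed s (⟦ w ⟧ʷ * signed t ⟦ v ⟧ʷ) + signed s ⟦ w ⟧ʷ * ⟦ p ⟧ᵖ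
          ≈⟨ +-congʳ (signed-*ˡ s _ _) ⟨
        signed s ⟦ w ⟧ʷ * signed t ⟦ v ⟧ʷ + signed s ⟦ w ⟧ʷ * ⟦ p ⟧ᵖ
          ≈⟨ distribˡ _ _ _ ⟨
        signed s ⟦ w ⟧ʷ * (signed t ⟦ v ⟧ʷ + ⟦ p ⟧ᵖ) ∎

      mul : Poly n → Poly n → Poly n
      mul []            q = []
      mul ((s , w) ∷ p) q = add true (scale s w q) (mul p q)

      mul-sound : ∀ p q → ⟦ mul p q ⟧ᵖ ≈ ⟦ p ⟧ᵖ * ⟦ q ⟧ᵖ
      mul-sound []            q = sym (zeroˡ _)
      mul-sound ((s , w) ∷ p) q = trans (add-sound true (scale s w q) (mul p q))
        (trans (+-cong (scale-sound s w q) (mul-sound p q)) (sym (distribʳ _ _ _)))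

      normal : Expr n → Poly n
      normal (var i)  = (true , [ i ]ʷ) ∷ []
      normal (x :+ y) = add true (normal x) (normal y)
      normal (x :* y) = mul (normal x) (normal y)
      normal (:- x)   = add false (normal x) []

      normal-sound : ∀ x → ⟦ normal x ⟧ᵖ ≈ ⟦ x ⟧
      normal-sound (var i)  = +-identityʳ _
      normal-sound (x :+ y) = trans (add-sound true (normal x) (normal y)) (+-cong (normal-sound x) (normal-sound y))
      normal-sound (x :* y) = trans (mul-sound (normal x) (normal y)) (*-cong (normal-sound x) (normal-sound y))
      normal-sound (:- x)   = trans (add-sound false (normal x) []) (trans (+-identityʳ _) (-‿cong (normal-sound x)))

      solve : ∀ x y → normal (x :- y) ≡ [] → ⟦ x ⟧ ≈ ⟦ y ⟧
      solve x y e = x∙y⁻¹≈ε⇒x≈y _ _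
        (trans (sym (normal-sound (x :- y))) (≡.subst (λ p → ⟦ p ⟧ᵖ ≈ 0#) (≡.sym e) refl))

module CStarLemmas {ℓ} {ℝ : CompleteOrderedField ℓ} (lem : ExcludedMiddle ℓ) (A : CStarAlgebra ℝ) where
  open CompleteOrderedField ℝ hiding (isRingWithoutOne) renaming (Carrier to R; zero to *-zero)
  open RealAnalysis ℝ lem
  open CStarAlgebra A
  open ContinuousLogic ℝ lem using (module Balls)
  module ℝSolver = SemiringSolver commutativeSemiring

  ringWithoutOne : RingWithoutOne ℓ ℓ
  ringWithoutOne = record { isRingWithoutOne = isRingWithoutOne }

  open RingWithoutOne ringWithoutOne public using () renaming
    ( *-cong to ∙-cong; *-congˡ to ∙-congˡ; *-congʳ to ∙-congʳ; *-assoc to ∙-assoc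
    ; distribˡ to ∙-distribˡ; distribʳ to ∙-distribʳ; zeroˡ to ∙-zeroˡ; zeroʳ to ∙-zeroʳ )
  open RingWithoutOneProperties ringWithoutOne public using () renaming
    ( x∙y⁻¹≈ε⇒x≈y to x-y≈0⇒x≈y; x≈y⇒x∙y⁻¹≈ε to x≈y⇒x-y≈0; -‿involutive to -ᴹ‿involutive )
  open NoncommutativeSolver ringWithoutOne public using (var; _:+_; _:*_; :-_; _:-_; rule; solve)
  module ≈ᴹ-Reasoning = SetoidReasoning ≈ᴹ-setoid

  ‖‖≤-cong : ∀ {x y r} → x ≈ᴹ y → ‖ y ‖ ≤ r → ‖ x ‖ ≤ r
  ‖‖≤-cong e = ≤-trans (≤-reflexive (‖‖-cong e))

  ‖0‖≈0 : ‖ 0ᴹ ‖ ≈ 0#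
  ‖0‖≈0 = ≤-antisym (Ball.bound (Balls.0ᴮ A {0})) (‖‖-nonneg 0ᴹ)

  ‖‖≤0⇒≈0 : ∀ {x} → ‖ x ‖ ≤ 0# → x ≈ᴹ 0ᴹ
  ‖‖≤0⇒≈0 p = ‖‖-definite _ (≤-antisym p (‖‖-nonneg _))

  ‖x-y‖≤0⇒x≈y : ∀ {x y} → ‖ x -ᴹ y ‖ ≤ 0# → x ≈ᴹ y
  ‖x-y‖≤0⇒x≈y p = x-y≈0⇒x≈y _ _ (‖‖≤0⇒≈0 p)

  x≈y⇒‖x-y‖≤ : ∀ {x y r} → 0# ≤ r → x ≈ᴹ y → ‖ x -ᴹ y ‖ ≤ r
  x≈y⇒‖x-y‖≤ 0≤r e = ‖‖≤-cong (x≈y⇒x-y≈0 e) (≤-trans (≤-reflexive ‖0‖≈0) 0≤r)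

  ‖‖-+ : ∀ {x y r s} → ‖ x ‖ ≤ r → ‖ y ‖ ≤ s → ‖ x +ᴹ y ‖ ≤ r + s
  ‖‖-+ p q = ≤-trans (‖‖-triangle _ _) (+-mono-≤ p q)

  ‖‖-∙ : ∀ {x y r s} → ‖ x ‖ ≤ r → ‖ y ‖ ≤ s → ‖ x ∙ y ‖ ≤ r * s
  ‖‖-∙ p q = ≤-trans (‖‖-submultiplicative _ _) (*-mono-≤ (‖‖-nonneg _) (≤-trans (‖‖-nonneg _) p) p q)

  0⋆≈0 : 0ᴹ ⋆ ≈ᴹ 0ᴹ
  0⋆≈0 = RingWithoutOneProperties.x+x≈x⇒x≈0 ringWithoutOne _
    (≈ᴹ-trans (≈ᴹ-sym (⋆-homo-+ 0ᴹ 0ᴹ)) (⋆-cong (+ᴹ-identityˡ 0ᴹ)))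

  ⋆-homo-- : ∀ x → (-ᴹ x) ⋆ ≈ᴹ -ᴹ (x ⋆)
  ⋆-homo-- x = uniqueʳ‿-ᴹ _ _
    (≈ᴹ-trans (≈ᴹ-sym (⋆-homo-+ x (-ᴹ x))) (≈ᴹ-trans (⋆-cong (-ᴹ‿inverseʳ x)) 0⋆≈0))

  ⋆-homo-∸ : ∀ x y → (x -ᴹ y) ⋆ ≈ᴹ x ⋆ -ᴹ y ⋆
  ⋆-homo-∸ x y = ≈ᴹ-trans (⋆-homo-+ x (-ᴹ y)) (+ᴹ-congˡ (⋆-homo-- y))

  ‖-x‖≈‖x‖ : ∀ x → ‖ -ᴹ x ‖ ≈ ‖ x ‖
  ‖-x‖≈‖x‖ x = x*x≈y*y⇒x≈y (‖‖-nonneg _) (‖‖-nonneg _)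
    (trans (sym (C⋆-identity (-ᴹ x))) (trans (‖‖-cong (≈ᴹ-trans (∙-congʳ (⋆-homo-- x)) e)) (C⋆-identity x)))
    where
    e : (-ᴹ (x ⋆)) ∙ (-ᴹ x) ≈ᴹ x ⋆ ∙ x
    e = let a = var 0F ; b = var 1F in solve (x ⋆ ∷ x ∷ []) [] ((:- a) :* (:- b)) (a :* b) ≡.refl

  ‖x-y‖≈‖y-x‖ : ∀ x y → ‖ x -ᴹ y ‖ ≈ ‖ y -ᴹ x ‖
  ‖x-y‖≈‖y-x‖ x y = trans (sym (‖-x‖≈‖x‖ (x -ᴹ y)))
    (‖‖-cong (let a = var 0F ; b = var 1F in solve (x ∷ y ∷ []) [] (:- (a :- b)) (b :- a) ≡.refl))

  ‖x-y‖-comm : ∀ {x y r} → ‖ x -ᴹ y ‖ ≤ r → ‖ y -ᴹ x ‖ ≤ r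
  ‖x-y‖-comm = ≤-trans (≤-reflexive (‖x-y‖≈‖y-x‖ _ _))

  ‖x⋆‖≤‖x‖ : ∀ x → ‖ x ⋆ ‖ ≤ ‖ x ‖
  ‖x⋆‖≤‖x‖ x with lem {‖ x ⋆ ‖ ≈ 0#}
  ... | yes e = ≤-trans (≤-reflexive e) (‖‖-nonneg x)
  ... | no  e = *-cancelʳ-≤ (‖‖-nonneg _) e (≤-trans (≤-reflexive (sym (C⋆-identity (x ⋆))))
      (≤-trans (‖‖-submultiplicative (x ⋆ ⋆) (x ⋆)) (≤-reflexive (*-congʳ (‖‖-cong (⋆-involutive x))))))

  ‖‖-⋆ : ∀ {x r} → ‖ x ‖ ≤ r → ‖ x ⋆ ‖ ≤ r
  ‖‖-⋆ = ≤-trans (‖x⋆‖≤‖x‖ _)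

  ‖⋆-⋆‖ : ∀ {x y r} → ‖ x -ᴹ y ‖ ≤ r → ‖ x ⋆ -ᴹ y ⋆ ‖ ≤ r
  ‖⋆-⋆‖ p = ‖‖≤-cong (≈ᴹ-sym (⋆-homo-∸ _ _)) (‖‖-⋆ p)

  ‖‖-via : ∀ {x y z r s} → ‖ x -ᴹ y ‖ ≤ r → ‖ y -ᴹ z ‖ ≤ s → ‖ x -ᴹ z ‖ ≤ r + s
  ‖‖-via {x} {y} {z} p q = ‖‖≤-cong
    (let a = var 0F ; b = var 1F ; c = var 2F in
      solve (x ∷ y ∷ z ∷ []) [] (a :- c) ((a :- b) :+ (b :- c)) ≡.refl)
    (‖‖-+ p q)

  ‖+-+‖ : ∀ {x y u v r s} → ‖ x -ᴹ y ‖ ≤ r → ‖ u -ᴹ v ‖ ≤ s → ‖ (x +ᴹ u) -ᴹ (y +ᴹ v) ‖ ≤ r + s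
  ‖+-+‖ {x} {y} {u} {v} p q = ‖‖≤-cong
    (let a = var 0F ; b = var 1F ; c = var 2F ; d = var 3F in
      solve (x ∷ y ∷ u ∷ v ∷ []) [] ((a :+ c) :- (b :+ d)) ((a :- b) :+ (c :- d)) ≡.refl)
    (‖‖-+ p q)

  ‖∙-∙‖ : ∀ {x y u v r s m n} → ‖ x -ᴹ y ‖ ≤ r → ‖ u -ᴹ v ‖ ≤ s → ‖ y ‖ ≤ m → ‖ u ‖ ≤ n →
          ‖ x ∙ u -ᴹ y ∙ v ‖ ≤ r * n + m * s
  ‖∙-∙‖ {x} {y} {u} {v} p q ‖y‖≤m ‖u‖≤n = ‖‖≤-cong
    (let a = var 0F ; b = var 1F ; c = var 2F ; d = var 3F in
      solve (x ∷ y ∷ u ∷ v ∷ []) [] (a :* c :- b :* d) ((a :- b) :* c :+ b :* (c :- d)) ≡.refl)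
    (‖‖-+ (‖‖-∙ p ‖u‖≤n) (‖‖-∙ ‖y‖≤m q))

  ‖x‖≤‖y‖+r : ∀ {x y r} → ‖ x -ᴹ y ‖ ≤ r → ‖ x ‖ ≤ ‖ y ‖ + r
  ‖x‖≤‖y‖+r {x} {y} p = ‖‖≤-cong
    (let a = var 0F ; b = var 1F in solve (x ∷ y ∷ []) [] a (b :+ (a :- b)) ≡.refl)
    (‖‖-+ ≤-refl p)

  *ₗ--ᴹ : ∀ c x → c *ₗ (-ᴹ x) ≈ᴹ -ᴹ (c *ₗ x)
  *ₗ--ᴹ c x = uniqueʳ‿-ᴹ _ _
    (≈ᴹ-trans (≈ᴹ-sym (*ₗ-distribˡ c x (-ᴹ x))) (≈ᴹ-trans (*ₗ-congˡ (-ᴹ‿inverseʳ x)) (*ₗ-zeroʳ c)))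

  ‖cx‖≤k‖x‖ : ∀ c {k} x → 0# ≤ k → Complex.∣_∣² ℝ c ≤ k * k → ‖ c *ₗ x ‖ ≤ k * ‖ x ‖
  ‖cx‖≤k‖x‖ c x 0≤k p = x*x≤y*y⇒x≤y (*-nonneg 0≤k (‖‖-nonneg x))
    (≤-trans (≤-reflexive (‖‖-homogeneous c x))
    (≤-trans (*-monoʳ-≤ (*-nonneg (‖‖-nonneg x) (‖‖-nonneg x)) p)
             (≤-reflexive (CommutativeSemigroupProperties.interchange *-commutativeSemigroup _ _ _ _))))

  infixr 7 _·_
  _·_ : R → Carrier → Carrier
  r · x = (r , 0#) *ₗ x

  ‖·‖ : ∀ {r} x → 0# ≤ r → ‖ r · x ‖ ≈ r * ‖ x ‖
  ‖·‖ {r} x 0≤r = x*x≈y*y⇒x≈y (‖‖-nonneg _) (*-nonneg 0≤r (‖‖-nonneg x))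
    (trans (‖‖-homogeneous (r , 0#) x) (trans
      (*-congʳ (trans (+-congˡ (zeroˡ 0#)) (+-identityʳ _)))
      (CommutativeSemigroupProperties.interchange *-commutativeSemigroup _ _ _ _)))

  half+halfᴹ : ∀ x → ½ · x +ᴹ ½ · x ≈ᴹ x
  half+halfᴹ x = ≈ᴹ-trans (≈ᴹ-sym (*ₗ-distribʳ x _ _))
    (≈ᴹ-trans (*ₗ-congʳ (½+½≈1 , +-identityˡ 0#)) (*ₗ-identityˡ x))

  ‖x+x‖≈ : ∀ x → ‖ x +ᴹ x ‖ ≈ ‖ x ‖ + ‖ x ‖
  ‖x+x‖≈ x = trans (‖‖-cong (≈ᴹ-sym (≈ᴹ-trans (*ₗ-congʳ (refl , sym (+-identityˡ 0#)))
                     (≈ᴹ-trans (*ₗ-distribʳ x _ _) (+ᴹ-cong (*ₗ-identityˡ x) (*ₗ-identityˡ x))))))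
           (trans (‖·‖ {1# + 1#} x (+-nonneg 0≤1 0≤1))
           (trans (distribʳ _ _ _) (+-cong (*-identityˡ _) (*-identityˡ _))))

  x+x≈y+y⇒x≈y : ∀ {x y} → x +ᴹ x ≈ᴹ y +ᴹ y → x ≈ᴹ y
  x+x≈y+y⇒x≈y {x} {y} e = ‖x-y‖≤0⇒x≈y (≤-trans (x≤x+y (‖‖-nonneg _)) (≤-trans
    (≤-reflexive (trans (sym (‖x+x‖≈ (x -ᴹ y))) (‖‖-cong
      (let a = var 0F ; b = var 1F in
        solve (x ∷ y ∷ []) [] ((a :- b) :+ (a :- b)) ((a :+ a) :- (b :+ b)) ≡.refl))))
    (x≈y⇒‖x-y‖≤ ≤-refl e)))

  ‖projection‖≤1 : ∀ {p} → IsProjection p → ‖ p ‖ ≤ 1#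
  ‖projection‖≤1 {p} (pp≈p , p⋆≈p) = x*x≈x⇒x≤1
    (trans (sym (C⋆-identity p)) (‖‖-cong (≈ᴹ-trans (∙-congʳ p⋆≈p) pp≈p)))

  1≤‖projection‖ : ∀ {p} → IsProjection p → ¬ p ≈ᴹ 0ᴹ → 1# ≤ ‖ p ‖
  1≤‖projection‖ {p} (pp≈p , p⋆≈p) p≉0 = *-cancelʳ-≤ (‖‖-nonneg p) (λ e → p≉0 (‖‖-definite p e))
    (≤-reflexive (trans (*-identityˡ _)
      (sym (trans (sym (C⋆-identity p)) (‖‖-cong (≈ᴹ-trans (∙-congʳ p⋆≈p) pp≈p))))))

  module Iteration {S : Set ℓ} (pt : S → Carrier) (r : S → R) (step : S → S)
    (0≤r : ∀ s → 0# ≤ r s) (r-halves : ∀ s → r (step s) + r (step s) ≤ r s)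
    (pt-step : ∀ s → ‖ pt (step s) -ᴹ pt s ‖ ≤ r s) where

    iterate : S → ℕ → S
    iterate s ℕ.zero    = s
    iterate s (ℕ.suc n) = step (iterate s n)

    private
      telescope : ∀ s k n → ‖ pt (iterate s (k ℕ.+ n)) -ᴹ pt (iterate s n) ‖
        + (r (iterate s (k ℕ.+ n)) + r (iterate s (k ℕ.+ n))) ≤ r (iterate s n) + r (iterate s n)
      telescope s ℕ.zero    n = ≤-resp (+-comm _ _) (+-identityʳ _) (+-monoʳ-≤ _ (x≈y⇒‖x-y‖≤ ≤-refl ≈ᴹ-refl))
      telescope s (ℕ.suc k) n = let t = iterate s (k ℕ.+ n) in
        ≤-by (+-mono-≤ (‖‖-via {z = pt (iterate s n)} (pt-step t) ≤-refl) (+-mono-≤ (r-halves t) (telescope s k n)))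
          (ℝSolver.solve 5 (λ a r r′ b c → (a :+ˢ (r′ :+ˢ r′)) :+ˢ ((r :+ˢ b) :+ˢ (r :+ˢ (c :+ˢ c))) ℝSolver.:=
            (c :+ˢ c) :+ˢ (a :+ˢ ((r′ :+ˢ r′) :+ˢ (b :+ˢ (r :+ˢ r))))) refl _ (r t) _ _ _)
        where _:+ˢ_ = ℝSolver._:+_

      close : ∀ s {m n} → m ℕ.≤ n → ‖ pt (iterate s n) -ᴹ pt (iterate s m) ‖ ≤ r (iterate s m) + r (iterate s m)
      close s {m} {n} m≤n = ≡.subst (λ i → ‖ pt (iterate s i) -ᴹ pt (iterate s m) ‖ ≤ r (iterate s m) + r (iterate s m))
        (ℕₚ.m∸n+n≡m m≤n) (≤-trans (x≤x+y (+-nonneg (0≤r _) (0≤r _))) (telescope s (n ℕ.∸ m) m))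

      vanishes : ∀ s ε → 0# < ε → ∃[ N ] ∀ n → N ℕ.≤ n → r (iterate s n) ≤ ε
      vanishes s = halving⇒vanishing (λ n → r (iterate s n)) (λ n → 0≤r _) (λ n → r-halves _)

      cauchy : ∀ s → Cauchy (λ n → pt (iterate s n))
      cauchy s ε 0<ε = let N , small = vanishes s (half (half ε)) (0<half (0<half 0<ε)) in
        N , λ m n N≤m N≤n →
          let b : ∀ {n} → N ℕ.≤ n → ‖ pt (iterate s n) -ᴹ pt (iterate s N) ‖ ≤ half ε
              b N≤n = ≤-trans (close s N≤n) (≤-trans (+-mono-≤ (small N ℕₚ.≤-refl) (small N ℕₚ.≤-refl))
                        (≤-reflexive (half+half (half ε))))
          in ≤-trans (‖‖-via (b N≤m) (‖x-y‖-comm (b N≤n))) (≤-reflexive (half+half ε))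

    limit : ∀ s → ∃[ x ] ‖ x -ᴹ pt s ‖ ≤ r s + r s × (∀ ε → 0# < ε → ∃[ t ] ‖ x -ᴹ pt t ‖ ≤ ε × r t ≤ ε)
    limit s =
      let x , u⟶x = norm-complete (λ n → pt (iterate s n)) (cauchy s)
      in x ,
         ≤-limit (λ ε 0<ε → let N , near = u⟶x ε 0<ε in
           ≤-trans (‖‖-via (‖x-y‖-comm (near N ℕₚ.≤-refl)) (close s {n = N} ℕ.z≤n)) (≤-reflexive (+-comm _ _))) ,
         λ ε 0<ε →
           let M , near  = u⟶x ε 0<ε
               N , small = vanishes s ε 0<ε
           in iterate s (M ℕ.+ N) , ‖x-y‖-comm (near (M ℕ.+ N) (ℕₚ.m≤m+n M N)) , small (M ℕ.+ N) (ℕₚ.m≤n+m N M)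

module NearProjections {ℓ} {ℝ : CompleteOrderedField ℓ} (lem : ExcludedMiddle ℓ) (A : CStarAlgebra ℝ) where
  open CompleteOrderedField ℝ hiding (isRingWithoutOne) renaming (Carrier to R; zero to *-zero)
  open RealAnalysis ℝ lem
  open CStarAlgebra A
  open CStarLemmas lem A
  open SemiringSolver commutativeSemiring using (_:=_; con)
    renaming (solve to solveᴿ; _:+_ to _⊕_; _:*_ to _⊗_; Polynomial to Poly)

  IsSelfAdjoint : Carrier → Set ℓ
  IsSelfAdjoint a = a ⋆ ≈ᴹ a

  selfAdjoint-x⋆x : ∀ x → IsSelfAdjoint (x ⋆ ∙ x)
  selfAdjoint-x⋆x x = ≈ᴹ-trans (⋆-anti-homo-∙ _ _) (∙-congˡ (⋆-involutive x))

  selfAdjoint-+ : ∀ {x y} → IsSelfAdjoint x → IsSelfAdjoint y → IsSelfAdjoint (x +ᴹ y)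
  selfAdjoint-+ p q = ≈ᴹ-trans (⋆-homo-+ _ _) (+ᴹ-cong p q)

  selfAdjoint-∸ : ∀ {x y} → IsSelfAdjoint x → IsSelfAdjoint y → IsSelfAdjoint (x -ᴹ y)
  selfAdjoint-∸ p q = ≈ᴹ-trans (⋆-homo-∸ _ _) (+ᴹ-cong p (-ᴹ‿cong q))

  selfAdjoint-square : ∀ {x} → IsSelfAdjoint x → IsSelfAdjoint (x ∙ x)
  selfAdjoint-square p = ≈ᴹ-trans (⋆-anti-homo-∙ _ _) (∙-cong p p)

  selfAdjoint-cube : ∀ {x} → IsSelfAdjoint x → IsSelfAdjoint (x ∙ x ∙ x)
  selfAdjoint-cube {x} p = ≈ᴹ-trans (⋆-anti-homo-∙ _ _)
    (≈ᴹ-trans (∙-cong p (selfAdjoint-square p)) (≈ᴹ-sym (∙-assoc x x x)))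

  private
    2ᵖ 4ᵖ 8ᵖ 16ᵖ : ∀ {n} → Poly n → Poly n
    2ᵖ x  = x ⊕ x
    4ᵖ x  = 2ᵖ (2ᵖ x)
    8ᵖ x  = 2ᵖ (4ᵖ x)
    16ᵖ x = 2ᵖ (8ᵖ x)

  vanishes : ∀ {t} C → 0# ≤ C → (∀ ε → 0# < ε → ε ≤ 1# → t ≤ C * ε) → t ≤ 0#
  vanishes {t} C 0≤C p = ≤-limit λ ε 0<ε →
    let C′ = C + 1#
        C≤C′ = x≤x+y 0≤1
        δ₀ , δ₀C′≈ε , _ , 0<δ₀ = quotient ε {C′}
          (<-≤-trans 0<1 (≤-resp (+-identityˡ 1#) refl (+-monoˡ-≤ 1# 0≤C)))
        δ , 0<δ , δ≤δ₀ , δ≤1 = min₂ (0<δ₀ 0<ε) 0<1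
    in ≤-trans (p δ 0<δ δ≤1) (≤-trans (*-mono-≤ (<⇒≤ 0<δ) (≤-trans 0≤C C≤C′) C≤C′ δ≤δ₀)
         (≤-reflexive (trans (*-comm _ _) (trans δ₀C′≈ε (sym (+-identityˡ ε))))))

  defect : Carrier → Carrier
  defect a = a ∙ a -ᴹ a

  -- 3a² - 2a³
  newton : Carrier → Carrier
  newton a = a ∙ a +ᴹ a ∙ a +ᴹ a ∙ a -ᴹ (a ∙ a ∙ a +ᴹ a ∙ a ∙ a)

  newton-defect : ∀ a → let e = defect a in defect (newton a) ≈ᴹ
    (e ∙ e ∙ e +ᴹ e ∙ e ∙ e +ᴹ (e ∙ e ∙ e +ᴹ e ∙ e ∙ e)) -ᴹ (e ∙ e +ᴹ e ∙ e +ᴹ e ∙ e)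
  newton-defect a = solve (a ∷ []) [] (n :* n :- n)
      ((e :* e :* e :+ e :* e :* e :+ (e :* e :* e :+ e :* e :* e)) :- (e :* e :+ e :* e :+ e :* e)) ≡.refl
    where
    x = var 0F
    e = x :* x :- x
    n = x :* x :+ x :* x :+ x :* x :- (x :* x :* x :+ x :* x :* x)

  newton-step : ∀ a → newton a -ᴹ a ≈ᴹ defect a -ᴹ (a ∙ defect a +ᴹ a ∙ defect a)
  newton-step a = let x = var 0F ; e = x :* x :- x in solve (a ∷ []) []
    (x :* x :+ x :* x :+ x :* x :- (x :* x :* x :+ x :* x :* x) :- x) (e :- (x :* e :+ x :* e)) ≡.refl

  ‖‖-∸ : ∀ {x y r s} → ‖ x ‖ ≤ r → ‖ y ‖ ≤ s → ‖ x -ᴹ y ‖ ≤ r + s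
  ‖‖-∸ p q = ‖‖-+ p (≤-trans (≤-reflexive (‖-x‖≈‖x‖ _)) q)

  newton-halves : ∀ a → 16* ‖ defect a ‖ ≤ 1# → 2* ‖ defect (newton a) ‖ ≤ ‖ defect a ‖
  newton-halves a 16n≤1 = ≤-by
    (+-mono-≤ (+-mono-≤ (+-mono-≤ d d) (+-mono-≤ 16c≤q 16q≤n)) (+-mono-≤ 0≤8c 0≤9q))
    (solveᴿ 4 (λ d n q c → let b = 4ᵖ c ⊕ (q ⊕ q ⊕ q) in
       2ᵖ d ⊕ (((b ⊕ b) ⊕ (q ⊕ n)) ⊕ (8ᵖ c ⊕ (8ᵖ q ⊕ q))) :=
       n ⊕ (((d ⊕ d) ⊕ (16ᵖ c ⊕ 16ᵖ q)) ⊕ (con 0 ⊕ con 0))) refl _ n q c)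
    where
    n = ‖ defect a ‖
    q = n * n
    c = q * n
    0≤n = ‖‖-nonneg (defect a)
    0≤q = *-nonneg 0≤n 0≤n
    16q≤n : 16* q ≤ n
    16q≤n = ≤-resp (solveᴿ 1 (λ n → 16ᵖ n ⊗ n := 16ᵖ (n ⊗ n)) refl n) (*-identityˡ n) (*-monoʳ-≤ 0≤n 16n≤1)
    16c≤q : 16* c ≤ q
    16c≤q = ≤-resp (solveᴿ 1 (λ n → 16ᵖ (n ⊗ n) ⊗ n := 16ᵖ (n ⊗ n ⊗ n)) refl n) refl (*-monoʳ-≤ 0≤n 16q≤n)
    0≤c  = *-nonneg 0≤q 0≤n
    0≤8c = 0≤8* 0≤c
    0≤9q = +-nonneg (0≤8* 0≤q) 0≤q
    d : ‖ defect (newton a) ‖ ≤ ((c + c) + (c + c)) + (q + q + q)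
    d = ‖‖≤-cong (newton-defect a) (‖‖-∸ (‖‖-+ (‖‖-+ eee eee) (‖‖-+ eee eee)) (‖‖-+ (‖‖-+ ee ee) ee))
      where
      ee  = ‖‖-∙ ≤-refl ≤-refl
      eee = ‖‖-∙ ee ≤-refl

  ‖selfAdjoint‖≤2 : ∀ {a} → IsSelfAdjoint a → ‖ defect a ‖ ≤ 1# → ‖ a ‖ ≤ 1# + 1#
  ‖selfAdjoint‖≤2 {a} a⋆≈a ‖e‖≤1 with ≤-total ‖ a ‖ (1# + 1#)
  ... | inj₁ t≤2 = t≤2
  ... | inj₂ 2≤t = ≤-trans t≤1 1≤2
    where
    t = ‖ a ‖
    tt≤t+1 : t * t ≤ t + 1#
    tt≤t+1 = ≤-trans (≤-reflexive (trans (sym (C⋆-identity a)) (‖‖-cong (∙-congʳ a⋆≈a)))) (‖x‖≤‖y‖+r ‖e‖≤1)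
    t≤1 : t ≤ 1#
    t≤1 = ≤-by (≤-trans (≤-resp (trans (distribʳ t 1# 1#) (+-cong (*-identityˡ t) (*-identityˡ t))) refl
                          (*-monoʳ-≤ (‖‖-nonneg a) 2≤t)) tt≤t+1)
      (solveᴿ 2 (λ t u → t ⊕ (t ⊕ u) := u ⊕ (t ⊕ t)) refl t 1#)

  newton-limit : ∀ a → IsSelfAdjoint a → 16* ‖ defect a ‖ ≤ 1# →
    ∃[ p ] IsProjection p × ‖ p -ᴹ a ‖ ≤ 16* ‖ defect a ‖
  newton-limit a a⋆≈a small =
    let p , near , approx = limit (a , a⋆≈a , small)
    in p , (idempotent p approx , selfAdjoint p approx) , ≤-trans near (10n≤16n (‖‖-nonneg (defect a)))
    where
    State : Set ℓ
    State = Σ[ a ∈ Carrier ] IsSelfAdjoint a × 16* ‖ defect a ‖ ≤ 1#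
    5* : R → R
    5* x = 4* x + x
    x≤5x : ∀ {x} → 0# ≤ x → x ≤ 5* x
    x≤5x p = ≤-resp refl (+-comm _ _) (x≤x+y (0≤2* (0≤2* p)))
    10n≤16n : ∀ {n} → 0# ≤ n → 2* (5* n) ≤ 16* n
    10n≤16n {n} p = ≤-by (0≤2* (+-nonneg (0≤2* p) p))
      (solveᴿ 1 (λ n → 2ᵖ (4ᵖ n ⊕ n) ⊕ 2ᵖ (2ᵖ n ⊕ n) := 16ᵖ n ⊕ con 0) refl n)
    err : State → R
    err (a , _) = 5* ‖ defect a ‖
    halves : ∀ a → 16* ‖ defect a ‖ ≤ 1# → 2* (5* ‖ defect (newton a) ‖) ≤ 5* ‖ defect a ‖
    halves a small = ≤-resp (solveᴿ 1 (λ x → 4ᵖ (2ᵖ x) ⊕ 2ᵖ x := 2ᵖ (4ᵖ x ⊕ x)) refl _) refl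
      (+-mono-≤ (2*-mono (2*-mono h)) h)
      where h = newton-halves a small
    step : State → State
    step (a , a⋆≈a , small) = newton a ,
      selfAdjoint-∸ (selfAdjoint-+ (selfAdjoint-+ aa aa) aa) (selfAdjoint-+ aaa aaa) ,
      ≤-trans (16*-mono (≤-trans (x≤x+y (‖‖-nonneg _)) (newton-halves a small))) small
      where
      aa  = selfAdjoint-square a⋆≈a
      aaa = selfAdjoint-cube a⋆≈a
    ‖e‖≤1 : ((a , _) : State) → ‖ defect a ‖ ≤ 1#
    ‖e‖≤1 (a , _ , small) = ≤-trans (x≤16x (‖‖-nonneg _)) small
    pt-step : (s : State) → ‖ newton (proj₁ s) -ᴹ proj₁ s ‖ ≤ err s
    pt-step s@(a , a⋆≈a , small) = ‖‖≤-cong (newton-step a)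
      (≤-trans (‖‖-∸ ≤-refl (‖‖-+ ae ae))
               (≤-reflexive (trans (solveᴿ 2 (λ n u → n ⊕ ((u ⊕ u) ⊗ n ⊕ (u ⊕ u) ⊗ n) := n ⊕ u ⊗ 4ᵖ n) refl _ 1#)
                              (trans (+-congˡ (*-identityˡ _)) (+-comm _ _)))))
      where
      ae : ‖ a ∙ defect a ‖ ≤ (1# + 1#) * ‖ defect a ‖
      ae = ‖‖-∙ (‖selfAdjoint‖≤2 a⋆≈a (‖e‖≤1 s)) ≤-refl
    open Iteration proj₁ err step (λ s → +-nonneg (0≤2* (0≤2* (‖‖-nonneg _))) (‖‖-nonneg _))
      (λ (a , _ , small) → halves a small) pt-step

    Approximable : Carrier → Set ℓ
    Approximable p = ∀ ε → 0# < ε → ∃[ s ] ‖ p -ᴹ proj₁ s ‖ ≤ ε × err s ≤ ε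
    selfAdjoint : ∀ p → Approximable p → IsSelfAdjoint p
    selfAdjoint p approx = ‖x-y‖≤0⇒x≈y (vanishes (1# + 1#) (+-nonneg 0≤1 0≤1) λ ε 0<ε _ →
      let (a , a⋆≈a , _) , p~a , _ = approx ε 0<ε
      in ≤-trans (‖‖-via (‖‖≤-cong (+ᴹ-congˡ (-ᴹ‿cong (≈ᴹ-sym a⋆≈a))) (‖⋆-⋆‖ p~a)) (‖x-y‖-comm p~a))
                 (≤-reflexive (sym (trans (distribʳ ε 1# 1#) (+-cong (*-identityˡ ε) (*-identityˡ ε))))))
    idempotent : ∀ p → Approximable p → p ∙ p ≈ᴹ p
    idempotent p approx = ‖x-y‖≤0⇒x≈y (vanishes (‖ p ‖ + 4* 1#) (+-nonneg (‖‖-nonneg p) (0≤2* (0≤2* 0≤1))) λ ε 0<ε _ →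
      let s@(a , a⋆≈a , _) , p~a , err≤ε = approx ε 0<ε
      in ≤-trans (‖‖-via (‖‖-via (‖∙-∙‖ p~a p~a (‖selfAdjoint‖≤2 a⋆≈a (‖e‖≤1 s)) ≤-refl)
                                 (≤-trans (x≤5x (‖‖-nonneg (defect a))) err≤ε))
                         (‖x-y‖-comm p~a))
           (≤-reflexive (trans (+-cong (+-congˡ (sym (*-identityˡ ε))) (sym (*-identityˡ ε)))
             (solveᴿ 3 (λ ε P u → ε ⊗ P ⊕ (u ⊕ u) ⊗ ε ⊕ u ⊗ ε ⊕ u ⊗ ε := (P ⊕ 4ᵖ u) ⊗ ε) refl ε ‖ p ‖ 1#))))

  near-projection : ∀ {κ x} → 0# ≤ κ → ‖ x ‖ ≤ 1# → ‖ x ∙ x -ᴹ x ‖ ≤ κ → ‖ x ⋆ -ᴹ x ‖ ≤ κ →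
    16* (16* κ) ≤ 1# → ∃[ p ] IsProjection p × ‖ p -ᴹ x ‖ ≤ 16* (16* κ)
  near-projection {κ} {x} 0≤κ ‖x‖≤1 xx~x x⋆~x small =
    let p , proj , p~a = newton-limit (x ⋆ ∙ x) (selfAdjoint-x⋆x x) (≤-trans 16n (≤-trans (x≤x+y (0≤16* (0≤8* 0≤κ))) small))
    in p , proj , ‖‖-via (≤-trans p~a 16n) (≤-trans a~x (≤-trans (x≤16x (0≤2* 0≤κ))
         (16*-mono (≤-trans (x≤x+y (0≤2* 0≤κ)) (x≤x+y (0≤2* (0≤2* 0≤κ)))))))
    where
    a = x ⋆ ∙ x
    a~x : ‖ a -ᴹ x ‖ ≤ κ + κ
    a~x = ‖‖-via (≤-trans (‖∙-∙‖ x⋆~x (x≈y⇒‖x-y‖≤ ≤-refl ≈ᴹ-refl) ‖x‖≤1 ‖x‖≤1)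
            (≤-reflexive (trans (+-cong (*-identityʳ κ) (*-identityˡ 0#)) (+-identityʳ κ)))) xx~x
    ‖a‖≤1 : ‖ a ‖ ≤ 1#
    ‖a‖≤1 = ≤-trans (‖‖-∙ (‖‖-⋆ ‖x‖≤1) ‖x‖≤1) (≤-reflexive (*-identityˡ 1#))
    e≤7κ : ‖ defect a ‖ ≤ (2* κ + 2* κ) + κ + 2* κ
    e≤7κ = ‖‖-via (‖‖-via (≤-trans (‖∙-∙‖ a~x a~x ‖x‖≤1 ‖a‖≤1)
      (≤-reflexive (+-cong (*-identityʳ _) (*-identityˡ _)))) xx~x) (‖x-y‖-comm a~x)
    e≤8κ : ‖ defect a ‖ ≤ 8* κ
    e≤8κ = ≤-by (+-mono-≤ e≤7κ 0≤κ) (solveᴿ 2 (λ n κ → n ⊕ ((4ᵖ κ ⊕ κ ⊕ 2ᵖ κ) ⊕ κ) := 8ᵖ κ ⊕ (n ⊕ con 0)) refl _ κ)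
    16n : 16* ‖ defect a ‖ ≤ 16* (8* κ)
    16n = 16*-mono e≤8κ

module UnitalAlgebra {ℓ} {ℝ : CompleteOrderedField ℓ} (lem : ExcludedMiddle ℓ) (B : CStarAlgebra ℝ)
  (e : CStarAlgebra.Carrier B)
  (identityˡ : ∀ x → CStarAlgebra._≈ᴹ_ B (CStarAlgebra._∙_ B e x) x)
  (identityʳ : ∀ x → CStarAlgebra._≈ᴹ_ B (CStarAlgebra._∙_ B x e) x) where
  open CompleteOrderedField ℝ hiding (isRingWithoutOne) renaming (Carrier to R; zero to *-zero)
  open RealAnalysis ℝ lem
  open CStarAlgebra B
  open CStarLemmas lem B
  open NearProjections lem B
  open SemiringSolver commutativeSemiring using (_:=_; con)
    renaming (solve to solveᴿ; _:+_ to _⊕_; _:*_ to _⊗_)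
  open ≈ᴹ-Reasoning
  open RingProperties ring using (-0#≈0#; -‿involutive)
  open Complex ℝ using (ℂ)

  e⋆≈e : e ⋆ ≈ᴹ e
  e⋆≈e = begin
    e ⋆              ≈⟨ identityˡ (e ⋆) ⟨
    e ∙ e ⋆          ≈⟨ ∙-congʳ (⋆-involutive e) ⟨
    e ⋆ ⋆ ∙ e ⋆      ≈⟨ ⋆-anti-homo-∙ e (e ⋆) ⟨
    (e ∙ e ⋆) ⋆      ≈⟨ ⋆-cong (identityˡ (e ⋆)) ⟩
    e ⋆ ⋆            ≈⟨ ⋆-involutive e ⟩
    e                ∎

  e-projection : IsProjection e
  e-projection = identityˡ e , e⋆≈e

  ‖e‖≤1 : ‖ e ‖ ≤ 1#
  ‖e‖≤1 = ‖projection‖≤1 e-projection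

  IsIsometry : Carrier → Set ℓ
  IsIsometry u = u ⋆ ∙ u ≈ᴹ e

  ‖isometry‖≤1 : ∀ {u} → IsIsometry u → ‖ u ‖ ≤ 1#
  ‖isometry‖≤1 {u} u⋆u≈e = x*x≤y*y⇒x≤y 0≤1 (≤-trans (≤-reflexive (trans (sym (C⋆-identity u)) (‖‖-cong u⋆u≈e)))
    (≤-resp refl (sym (*-identityˡ 1#)) ‖e‖≤1))

  isometry-∙ : ∀ {u v} → IsIsometry u → IsIsometry v → IsIsometry (u ∙ v)
  isometry-∙ {u} {v} p q = begin
    (u ∙ v) ⋆ ∙ (u ∙ v)    ≈⟨ ∙-congʳ (⋆-anti-homo-∙ u v) ⟩
    v ⋆ ∙ u ⋆ ∙ (u ∙ v)    ≈⟨ ∙-assoc _ _ _ ⟩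
    v ⋆ ∙ (u ⋆ ∙ (u ∙ v))  ≈⟨ ∙-congˡ (≈ᴹ-trans (≈ᴹ-sym (∙-assoc _ _ _)) (≈ᴹ-trans (∙-congʳ p) (identityˡ v))) ⟩
    v ⋆ ∙ v                ≈⟨ q ⟩
    e                      ∎

  x≤1⇒x*y≤y : ∀ {x y} → x ≤ 1# → 0# ≤ y → x * y ≤ y
  x≤1⇒x*y≤y p 0≤s = ≤-trans (*-monoʳ-≤ 0≤s p) (≤-reflexive (*-identityˡ _))

  ½≤1 : ½ ≤ 1#
  ½≤1 = ≤-resp (*-identityʳ ½) refl (half≤ 0≤1)

  neumann : ∀ {j} → ‖ j ‖ ≤ ½ → ∃[ g ] e +ᴹ j ∙ g ≈ᴹ g
  neumann {j} ‖j‖≤½ =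
    let g , _ , approx = limit 0ᴹ
    in g , ‖x-y‖≤0⇒x≈y (vanishes (1# + 1# + 1#) (+-nonneg (+-nonneg 0≤1 0≤1) 0≤1) λ ε 0<ε _ →
      let h , g~h , r≤ε = approx ε 0<ε
      in ≤-trans (‖‖-via (‖‖-via (‖‖≤-cong (step-step g h)
             (≤-trans (‖‖-∙ ‖j‖≤½ g~h) (x≤1⇒x*y≤y ½≤1 (<⇒≤ 0<ε)))) r≤ε) (‖x-y‖-comm g~h))
           (≤-reflexive (trans (+-cong (+-cong (sym (*-identityˡ ε)) (sym (*-identityˡ ε))) (sym (*-identityˡ ε)))
             (solveᴿ 2 (λ u ε → (u ⊗ ε ⊕ u ⊗ ε) ⊕ u ⊗ ε := ((u ⊕ u) ⊕ u) ⊗ ε) refl 1# ε))))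
    where
    step : Carrier → Carrier
    step g = e +ᴹ j ∙ g
    step-step : ∀ g h → step g -ᴹ step h ≈ᴹ j ∙ (g -ᴹ h)
    step-step g h = let e′ = var 0F ; j′ = var 1F ; g′ = var 2F ; h′ = var 3F in
      solve (e ∷ j ∷ g ∷ h ∷ []) [] ((e′ :+ j′ :* g′) :- (e′ :+ j′ :* h′)) (j′ :* (g′ :- h′)) ≡.refl
    err : Carrier → R
    err g = ‖ step g -ᴹ g ‖
    halves : ∀ g → err (step g) + err (step g) ≤ err g
    halves g = ≤-trans (+-mono-≤ h h) (≤-reflexive (half+half _))
      where h = ‖‖≤-cong (step-step (step g) g) (‖‖-∙ ‖j‖≤½ ≤-refl)
    open Iteration (λ g → g) err step (λ g → ‖‖-nonneg _) halves (λ g → ≤-refl)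

  -- For skew-adjoint j, 2(e - j)⁻¹ - e is the Cayley transform of j.
  module Cayley {j} (j⋆≈-j : j ⋆ ≈ᴹ -ᴹ j) (‖j‖≤½ : ‖ j ‖ ≤ ½) where

    g : Carrier
    g = proj₁ (neumann ‖j‖≤½)

    k : Carrier
    k = e -ᴹ j

    kg≈e : k ∙ g ≈ᴹ e
    kg≈e = begin
      (e -ᴹ j) ∙ g              ≈⟨ solve (e ∷ j ∷ g ∷ []) (rule 0F 2F (just 2F) (identityˡ g) ∷ [])
                                     ((e′ :- j′) :* g′) (g′ :- j′ :* g′) ≡.refl ⟩
      g -ᴹ j ∙ g                ≈⟨ +ᴹ-congʳ (proj₂ (neumann ‖j‖≤½)) ⟨
      (e +ᴹ j ∙ g) -ᴹ j ∙ g     ≈⟨ solve (e ∷ j ∷ g ∷ []) [] ((e′ :+ j′ :* g′) :- j′ :* g′) e′ ≡.refl ⟩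
      e                         ∎
      where e′ = var 0F ; j′ = var 1F ; g′ = var 2F

    h : Carrier
    h = g ⋆

    private
      j⋆′ : (-ᴹ j) ⋆ ≈ᴹ j
      j⋆′ = ≈ᴹ-trans (⋆-homo-- j) (≈ᴹ-trans (-ᴹ‿cong j⋆≈-j) (-ᴹ‿involutive j))

    h+hj≈e : h +ᴹ h ∙ j ≈ᴹ e
    h+hj≈e = begin
      h +ᴹ h ∙ j       ≈⟨ +ᴹ-congʳ (identityʳ h) ⟨
      h ∙ e +ᴹ h ∙ j   ≈⟨ ∙-distribˡ h e j ⟨
      h ∙ (e +ᴹ j)     ≈⟨ ∙-congˡ (+ᴹ-cong e⋆≈e j⋆′) ⟨
      h ∙ (e ⋆ +ᴹ (-ᴹ j) ⋆) ≈⟨ ∙-congˡ (⋆-homo-+ e (-ᴹ j)) ⟨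
      h ∙ k ⋆          ≈⟨ ⋆-anti-homo-∙ k g ⟨
      (k ∙ g) ⋆        ≈⟨ ⋆-cong kg≈e ⟩
      e ⋆              ≈⟨ e⋆≈e ⟩
      e                ∎

    hg+hg≈h+g : h ∙ g +ᴹ h ∙ g ≈ᴹ h +ᴹ g
    hg+hg≈h+g = begin
      h ∙ g +ᴹ h ∙ g
        ≈⟨ +ᴹ-congʳ (∙-congˡ (proj₂ (neumann ‖j‖≤½))) ⟨
      h ∙ (e +ᴹ j ∙ g) +ᴹ h ∙ g
        ≈⟨ solve (e ∷ j ∷ g ∷ h ∷ []) (rule 3F 0F (just 3F) (identityʳ h) ∷ [])
             (h′ :* (e′ :+ j′ :* g′) :+ h′ :* g′) (h′ :+ (h′ :+ h′ :* j′) :* g′) ≡.refl ⟩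
      h +ᴹ (h +ᴹ h ∙ j) ∙ g
        ≈⟨ +ᴹ-congˡ (≈ᴹ-trans (∙-congʳ h+hj≈e) (identityˡ g)) ⟩
      h +ᴹ g ∎
      where e′ = var 0F ; j′ = var 1F ; g′ = var 2F ; h′ = var 3F

    u : Carrier
    u = g +ᴹ g -ᴹ e

    u-isometry : IsIsometry u
    u-isometry = begin
      u ⋆ ∙ u
        ≈⟨ ∙-congʳ (≈ᴹ-trans (⋆-homo-∸ _ _) (+ᴹ-cong (⋆-homo-+ g g) (-ᴹ‿cong e⋆≈e))) ⟩
      (h +ᴹ h -ᴹ e) ∙ (g +ᴹ g -ᴹ e)
        ≈⟨ solve (e ∷ g ∷ h ∷ []) (rule 0F 0F (just 0F) (identityˡ e) ∷ rule 2F 0F (just 2F) (identityʳ h) ∷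
                                   rule 0F 1F (just 1F) (identityˡ g) ∷ [])
             ((h′ :+ h′ :- e′) :* (g′ :+ g′ :- e′))
             ((hg :+ hg) :+ (hg :+ hg) :- (h′ :+ g′) :- (h′ :+ g′) :+ e′) ≡.refl ⟩
      ((h ∙ g +ᴹ h ∙ g) +ᴹ (h ∙ g +ᴹ h ∙ g)) -ᴹ (h +ᴹ g) -ᴹ (h +ᴹ g) +ᴹ e
        ≈⟨ +ᴹ-congʳ (+ᴹ-congʳ (+ᴹ-congʳ (+ᴹ-cong hg+hg≈h+g hg+hg≈h+g))) ⟩
      ((h +ᴹ g) +ᴹ (h +ᴹ g)) -ᴹ (h +ᴹ g) -ᴹ (h +ᴹ g) +ᴹ e
        ≈⟨ solve (e ∷ g ∷ h ∷ []) []
             (((h′ :+ g′) :+ (h′ :+ g′)) :- (h′ :+ g′) :- (h′ :+ g′) :+ e′) e′ ≡.refl ⟩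
      e ∎
      where
      e′ = var 0F ; g′ = var 1F ; h′ = var 2F
      hg = h′ :* g′

    gk≈e : g ∙ k ≈ᴹ e
    gk≈e = ≈ᴹ-trans (∙-congʳ g≈g₂⋆) g₂⋆k≈e
      where
      neumann₂ = neumann { -ᴹ j} (≤-trans (≤-reflexive (‖-x‖≈‖x‖ j)) ‖j‖≤½)
      g₂ = proj₁ neumann₂
      e′ = var 0F ; j′ = var 1F ; g′ = var 2F
      g₂⋆k≈e : g₂ ⋆ ∙ k ≈ᴹ e
      g₂⋆k≈e = begin
        g₂ ⋆ ∙ (e -ᴹ j)
          ≈⟨ solve (e ∷ j ∷ g₂ ⋆ ∷ []) (rule 2F 0F (just 2F) (identityʳ _) ∷ [])
               (g′ :* (e′ :- j′)) (g′ :- g′ :* j′) ≡.refl ⟩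
        g₂ ⋆ -ᴹ g₂ ⋆ ∙ j
          ≈⟨ +ᴹ-congʳ (⋆-cong (proj₂ neumann₂)) ⟨
        (e +ᴹ (-ᴹ j) ∙ g₂) ⋆ -ᴹ g₂ ⋆ ∙ j
          ≈⟨ +ᴹ-congʳ (≈ᴹ-trans (⋆-homo-+ _ _) (+ᴹ-cong e⋆≈e (≈ᴹ-trans (⋆-anti-homo-∙ _ _) (∙-congˡ j⋆′)))) ⟩
        (e +ᴹ g₂ ⋆ ∙ j) -ᴹ g₂ ⋆ ∙ j
          ≈⟨ solve (e ∷ j ∷ g₂ ⋆ ∷ []) [] ((e′ :+ g′ :* j′) :- g′ :* j′) e′ ≡.refl ⟩
        e ∎
      g≈g₂⋆ : g ≈ᴹ g₂ ⋆
      g≈g₂⋆ = begin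
        g               ≈⟨ identityˡ g ⟨
        e ∙ g           ≈⟨ ∙-congʳ g₂⋆k≈e ⟨
        g₂ ⋆ ∙ k ∙ g    ≈⟨ ∙-assoc _ _ _ ⟩
        g₂ ⋆ ∙ (k ∙ g)  ≈⟨ ∙-congˡ kg≈e ⟩
        g₂ ⋆ ∙ e        ≈⟨ identityʳ _ ⟩
        g₂ ⋆            ∎

    commutes : ∀ y → u ∙ y ≈ᴹ y ∙ u → j ∙ y ≈ᴹ y ∙ j
    commutes y uy≈yu = begin
      j ∙ y       ≈⟨ solve (e ∷ j ∷ y ∷ []) (rule 0F 2F (just 2F) (identityˡ y) ∷ [])
                       (j′ :* y′) (y′ :- (e′ :- j′) :* y′) ≡.refl ⟩
      y -ᴹ k ∙ y  ≈⟨ +ᴹ-congˡ (-ᴹ‿cong ky≈yk) ⟩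
      y -ᴹ y ∙ k  ≈⟨ solve (e ∷ j ∷ y ∷ []) (rule 2F 0F (just 2F) (identityʳ y) ∷ [])
                       (y′ :- y′ :* (e′ :- j′)) (y′ :* j′) ≡.refl ⟩
      y ∙ j       ∎
      where
      e′ = var 0F ; j′ = var 1F ; y′ = var 2F
      gy≈yg : g ∙ y ≈ᴹ y ∙ g
      gy≈yg = x+x≈y+y⇒x≈y (begin
        g ∙ y +ᴹ g ∙ y
          ≈⟨ solve (e ∷ g ∷ y ∷ []) (rule 0F 2F (just 2F) (identityˡ y) ∷ [])
               (j′ :* y′ :+ j′ :* y′) ((j′ :+ j′ :- e′) :* y′ :+ y′) ≡.refl ⟩
        u ∙ y +ᴹ y
          ≈⟨ +ᴹ-congʳ uy≈yu ⟩
        y ∙ u +ᴹ y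
          ≈⟨ solve (e ∷ g ∷ y ∷ []) (rule 2F 0F (just 2F) (identityʳ y) ∷ [])
               (y′ :* (j′ :+ j′ :- e′) :+ y′) (y′ :* j′ :+ y′ :* j′) ≡.refl ⟩
        y ∙ g +ᴹ y ∙ g ∎)
      ky≈yk : k ∙ y ≈ᴹ y ∙ k
      ky≈yk = begin
        k ∙ y              ≈⟨ ∙-congˡ (≈ᴹ-trans (∙-congˡ gk≈e) (identityʳ y)) ⟨
        k ∙ (y ∙ (g ∙ k))  ≈⟨ solve (k ∷ y ∷ g ∷ []) []
                                (var 0F :* (var 1F :* (var 2F :* var 0F))) (var 0F :* (var 1F :* var 2F) :* var 0F) ≡.refl ⟩
        k ∙ (y ∙ g) ∙ k    ≈⟨ ∙-congʳ (∙-congˡ gy≈yg) ⟨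
        k ∙ (g ∙ y) ∙ k    ≈⟨ ∙-congʳ (≈ᴹ-trans (≈ᴹ-sym (∙-assoc k g y)) (≈ᴹ-trans (∙-congʳ kg≈e) (identityˡ y))) ⟩
        y ∙ k              ∎

  commute-unscale : ∀ {c c′ x y} → CommutativeRing._≈_ ℂ (CommutativeRing._*_ ℂ c′ c) (CommutativeRing.1# ℂ) →
    (c *ₗ x) ∙ y ≈ᴹ y ∙ (c *ₗ x) → x ∙ y ≈ᴹ y ∙ x
  commute-unscale {c} {c′} {x} {y} c′c≈1 p = begin
    x ∙ y                    ≈⟨ unscale (x ∙ y) ⟨
    c′ *ₗ (c *ₗ (x ∙ y))     ≈⟨ *ₗ-congˡ (*ₗ-∙-assoc c x y) ⟨
    c′ *ₗ ((c *ₗ x) ∙ y)     ≈⟨ *ₗ-congˡ p ⟩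
    c′ *ₗ (y ∙ (c *ₗ x))     ≈⟨ *ₗ-congˡ (*ₗ-∙-comm c y x) ⟩
    c′ *ₗ (c *ₗ (y ∙ x))     ≈⟨ unscale (y ∙ x) ⟩
    y ∙ x                    ∎
    where
    unscale : ∀ z → c′ *ₗ (c *ₗ z) ≈ᴹ z
    unscale z = ≈ᴹ-trans (≈ᴹ-sym (*ₗ-assoc c′ c z)) (≈ᴹ-trans (*ₗ-congʳ c′c≈1) (*ₗ-identityˡ z))

  shrink : ∀ x → ∃[ r ] ∃[ r′ ] r′ * r ≈ 1# × ‖ r · x ‖ ≤ ½
  shrink x =
    let 0<n = <-≤-trans 0<1 (≤-resp (+-identityˡ 1#) refl (+-monoˡ-≤ 1# (‖‖-nonneg x)))
        r , rn≈½ , _ , pos = quotient ½ {‖ x ‖ + 1#} 0<n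
        0<r = pos 0<½
        r′ , r′r≈1 , _ = quotient 1# 0<r
    in r , r′ , r′r≈1 , ≤-trans (≤-reflexive (‖·‖ x (<⇒≤ 0<r)))
         (≤-trans (*-mono-≤ (‖‖-nonneg x) (<⇒≤ 0<r) ≤-refl (x≤x+y 0≤1)) (≤-reflexive rn≈½))

  real-unit : ∀ {r r′} → r′ * r ≈ 1# →
    CommutativeRing._≈_ ℂ (CommutativeRing._*_ ℂ (r′ , 0#) (r , 0#)) (CommutativeRing.1# ℂ)
  real-unit {r} {r′} e₁ = trans (+-congˡ (trans (-‿cong (zeroˡ 0#)) -0#≈0#)) (trans (+-identityʳ _) e₁) ,
    trans (+-cong (zeroʳ r′) (zeroˡ r)) (+-identityʳ 0#)

  -- With d = [u, y] one has 4ud = 2[u², y] + [u, 2d], so that the supremum s of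
  -- ‖[u, y]‖ over isometries u and contractions y satisfies 4s ≤ 3s as soon as
  -- every 2d is a contraction.
  module _ (almost-commutes : ∀ x y → ‖ x ‖ ≤ 1# → ‖ y ‖ ≤ 1# → ‖ x ∙ y -ᴹ y ∙ x ‖ ≤ ½) where

    isometries-central : ∀ u y → IsIsometry u → ‖ y ‖ ≤ 1# → u ∙ y ≈ᴹ y ∙ u
    isometries-central u y iso ‖y‖≤1 = ‖x-y‖≤0⇒x≈y (≤-trans (s-bound u y iso ‖y‖≤1) s≤0)
      where
      Norms : R → Set ℓ
      Norms r = ∃[ u ] ∃[ y ] IsIsometry u × ‖ y ‖ ≤ 1# × r ≈ ‖ u ∙ y -ᴹ y ∙ u ‖
      bound : ∀ r → Norms r → r ≤ ½
      bound r (u , y , iso , ‖y‖≤1 , r≈) =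
        ≤-trans (≤-reflexive r≈) (almost-commutes u y (‖isometry‖≤1 iso) ‖y‖≤1)
      lub = complete Norms (_ , u , y , iso , ‖y‖≤1 , refl) (½ , bound)
      s = proj₁ lub
      s-bound : ∀ u y → IsIsometry u → ‖ y ‖ ≤ 1# → ‖ u ∙ y -ᴹ y ∙ u ‖ ≤ s
      s-bound u y iso ‖y‖≤1 = proj₁ (proj₂ lub) _ (u , y , iso , ‖y‖≤1 , refl)
      improve : ∀ u y → IsIsometry u → ‖ y ‖ ≤ 1# → 4* ‖ u ∙ y -ᴹ y ∙ u ‖ ≤ (s + s) + s
      improve u y iso ‖y‖≤1 =
        ≤-trans (≤-reflexive (sym (trans (‖x+x‖≈ (d +ᴹ d)) (+-cong (‖x+x‖≈ d) (‖x+x‖≈ d)))))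
       (≤-trans (‖‖≤-cong 4d≈ (≤-trans (‖‖-∙ (‖‖-⋆ (‖isometry‖≤1 iso)) ≤-refl) (≤-reflexive (*-identityˡ _))))
                (‖‖≤-cong 4ud≈ (‖‖-+ (‖‖-+ uuy uuy) (s-bound u (d +ᴹ d) iso ‖d+d‖≤1))))
        where
        d = u ∙ y -ᴹ y ∙ u
        4d = d +ᴹ d +ᴹ (d +ᴹ d)
        uuy = s-bound (u ∙ u) y (isometry-∙ iso iso) ‖y‖≤1
        ‖d+d‖≤1 : ‖ d +ᴹ d ‖ ≤ 1#
        ‖d+d‖≤1 = ≤-trans (‖‖-+ b b) (≤-reflexive ½+½≈1)
          where b = almost-commutes u y (‖isometry‖≤1 iso) ‖y‖≤1
        4d≈ : 4d ≈ᴹ u ⋆ ∙ (u ∙ 4d)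
        4d≈ = ≈ᴹ-sym (≈ᴹ-trans (≈ᴹ-sym (∙-assoc _ _ _)) (≈ᴹ-trans (∙-congʳ iso) (identityˡ 4d)))
        4ud≈ : u ∙ 4d ≈ᴹ (u ∙ u ∙ y -ᴹ y ∙ (u ∙ u)) +ᴹ (u ∙ u ∙ y -ᴹ y ∙ (u ∙ u)) +ᴹ (u ∙ (d +ᴹ d) -ᴹ (d +ᴹ d) ∙ u)
        4ud≈ = let a = var 0F ; b = var 1F ; c = a :* b :- b :* a ; q = a :* a :* b :- b :* (a :* a) in
          solve (u ∷ y ∷ []) [] (a :* (c :+ c :+ (c :+ c))) (q :+ q :+ (a :* (c :+ c) :- (c :+ c) :* a)) ≡.refl
      s≤0 : s ≤ 0#
      s≤0 = ≤-by (+-mono-≤ (+-mono-≤ (+-mono-≤ s≤t s≤t) (+-mono-≤ s≤t s≤t)) (≤-reflexive 4t≈3s))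
                 (solveᴿ 2 (λ s t → s ⊕ (((t ⊕ t) ⊕ (t ⊕ t)) ⊕ (s ⊕ s ⊕ s)) :=
                                    con 0 ⊕ (((s ⊕ s) ⊕ (s ⊕ s)) ⊕ ((t ⊕ t) ⊕ (t ⊕ t)))) refl s t)
        where
        t = half (half (s + s + s))
        4t≈3s : (t + t) + (t + t) ≈ s + s + s
        4t≈3s = trans (+-cong (half+half _) (half+half _)) (half+half _)
        s≤t : s ≤ t
        s≤t = proj₂ (proj₂ lub) t λ { r (u , y , iso , ‖y‖≤1 , r≈) → ≤-trans (≤-reflexive r≈)
          (x+x≤y⇒x≤half (x+x≤y⇒x≤half (improve u y iso ‖y‖≤1))) }

    skewAdjoint-central : ∀ j y → j ⋆ ≈ᴹ -ᴹ j → j ∙ y ≈ᴹ y ∙ j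
    skewAdjoint-central j y j⋆≈-j =
      let r , r′ , r′r≈1 , small = shrink j
          s , s′ , s′s≈1 , ‖sy‖≤½ = shrink y
          open Cayley {r · j} (rj⋆ r) small
      in commute-unscale (real-unit r′r≈1) (≈ᴹ-sym (commute-unscale (real-unit s′s≈1) (≈ᴹ-sym
           (commutes (s · y) (isometries-central u (s · y) u-isometry (≤-trans ‖sy‖≤½ ½≤1))))))
      where
      rj⋆ : ∀ r → (r · j) ⋆ ≈ᴹ -ᴹ (r · j)
      rj⋆ r = begin
        (r · j) ⋆            ≈⟨ ⋆-homo-*ₗ _ j ⟩
        (r , - 0#) *ₗ j ⋆    ≈⟨ *ₗ-cong (refl , -0#≈0#) j⋆≈-j ⟩
        r · (-ᴹ j)           ≈⟨ *ₗ--ᴹ (r , 0#) j ⟩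
        -ᴹ (r · j)           ∎

    commutative : IsAbelian
    commutative x y = x+x≈y+y⇒x≈y (begin
      x ∙ y +ᴹ x ∙ y
        ≈⟨ solve (x ∷ x ⋆ ∷ y ∷ []) [] (x′ :* y′ :+ x′ :* y′) ((x′ :- s′) :* y′ :+ (x′ :+ s′) :* y′) ≡.refl ⟩
      (x -ᴹ x ⋆) ∙ y +ᴹ (x +ᴹ x ⋆) ∙ y
        ≈⟨ +ᴹ-cong (skewAdjoint-central _ y skew)
             (commute-unscale {i} {(0# , - 1#)} unit (skewAdjoint-central _ y iskew)) ⟩
      y ∙ (x -ᴹ x ⋆) +ᴹ y ∙ (x +ᴹ x ⋆)
        ≈⟨ solve (x ∷ x ⋆ ∷ y ∷ []) [] (y′ :* (x′ :- s′) :+ y′ :* (x′ :+ s′)) (y′ :* x′ :+ y′ :* x′) ≡.refl ⟩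
      y ∙ x +ᴹ y ∙ x              ∎)
      where
      x′ = var 0F ; s′ = var 1F ; y′ = var 2F
      i = 0# , 1#
      unit : _
      unit = trans (+-cong (zeroˡ 0#) (trans (-‿cong (*-identityʳ _)) (-‿involutive 1#))) (+-identityˡ 1#) ,
             trans (+-cong (zeroˡ 1#) (zeroʳ _)) (+-identityˡ 0#)
      skew : (x -ᴹ x ⋆) ⋆ ≈ᴹ -ᴹ (x -ᴹ x ⋆)
      skew = begin
        (x -ᴹ x ⋆) ⋆    ≈⟨ ⋆-homo-∸ x (x ⋆) ⟩
        x ⋆ -ᴹ x ⋆ ⋆    ≈⟨ +ᴹ-congˡ (-ᴹ‿cong (⋆-involutive x)) ⟩
        x ⋆ -ᴹ x        ≈⟨ solve (x ∷ x ⋆ ∷ []) [] (var 1F :- var 0F) (:- (var 0F :- var 1F)) ≡.refl ⟩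
        -ᴹ (x -ᴹ x ⋆)   ∎
      iskew : (i *ₗ (x +ᴹ x ⋆)) ⋆ ≈ᴹ -ᴹ (i *ₗ (x +ᴹ x ⋆))
      iskew = begin
        (i *ₗ (x +ᴹ x ⋆)) ⋆
          ≈⟨ ⋆-homo-*ₗ i _ ⟩
        (0# , - 1#) *ₗ (x +ᴹ x ⋆) ⋆
          ≈⟨ *ₗ-cong (sym -0#≈0# , refl)
               (≈ᴹ-trans (⋆-homo-+ _ _) (≈ᴹ-trans (+ᴹ-congˡ (⋆-involutive x)) (+ᴹ-comm _ _))) ⟩
        (- 0# , - 1#) *ₗ (x +ᴹ x ⋆)
          ≈⟨ uniqueʳ‿-ᴹ _ _ (≈ᴹ-trans (≈ᴹ-sym (*ₗ-distribʳ _ i _))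
               (≈ᴹ-trans (*ₗ-congʳ (-‿inverseʳ 0# , -‿inverseʳ 1#)) (*ₗ-zeroˡ _))) ⟩
        -ᴹ (i *ₗ (x +ᴹ x ⋆))            ∎

  -- The Newton step w ↦ w + ½wt, t = e - w⋆w, for the polar decomposition
  -- changes the error t = 2u to 3u² + 2u³.
  module Polar where

    deficit : Carrier → Carrier
    deficit w = e -ᴹ w ⋆ ∙ w

    half-deficit : Carrier → Carrier
    half-deficit w = ½ · deficit w

    polar-step : Carrier → Carrier
    polar-step w = w +ᴹ w ∙ half-deficit w

    selfAdjoint-half : ∀ {t} → IsSelfAdjoint t → IsSelfAdjoint (½ · t)
    selfAdjoint-half p = ≈ᴹ-trans (⋆-homo-*ₗ _ _) (*ₗ-cong (refl , -0#≈0#) p)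

    deficit-step : ∀ w → let u = half-deficit w in
      deficit (polar-step w) ≈ᴹ u ∙ u +ᴹ u ∙ u +ᴹ u ∙ u +ᴹ (u ∙ u ∙ u +ᴹ u ∙ u ∙ u)
    deficit-step w = begin
      e -ᴹ (w +ᴹ w ∙ u) ⋆ ∙ (w +ᴹ w ∙ u)
        ≈⟨ +ᴹ-congˡ (-ᴹ‿cong (∙-congʳ (≈ᴹ-trans (⋆-homo-+ _ _) (+ᴹ-congˡ (≈ᴹ-trans (⋆-anti-homo-∙ _ _) (∙-congʳ u⋆≈u)))))) ⟩
      e -ᴹ (w ⋆ +ᴹ u ∙ w ⋆) ∙ (w +ᴹ w ∙ u)
        ≈⟨ solve (e ∷ u ∷ w ∷ w ⋆ ∷ []) []
             (let e′ = var 0F ; u′ = var 1F ; w′ = var 2F ; v′ = var 3F in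
               e′ :- (v′ :+ u′ :* v′) :* (w′ :+ w′ :* u′))
             (let e′ = var 0F ; u′ = var 1F ; w′ = var 2F ; v′ = var 3F in
               e′ :- (v′ :* w′ :+ v′ :* w′ :* u′ :+ u′ :* (v′ :* w′) :+ u′ :* (v′ :* w′) :* u′)) ≡.refl ⟩
      e -ᴹ (w⋆w +ᴹ w⋆w ∙ u +ᴹ u ∙ w⋆w +ᴹ u ∙ w⋆w ∙ u)
        ≈⟨ +ᴹ-congˡ (-ᴹ‿cong (+ᴹ-cong (+ᴹ-cong (+ᴹ-cong h (∙-congʳ h)) (∙-congˡ h)) (∙-congʳ (∙-congˡ h)))) ⟩
      e -ᴹ (r +ᴹ r ∙ u +ᴹ u ∙ r +ᴹ u ∙ r ∙ u)
        ≈⟨ solve (e ∷ u ∷ []) (rule 0F 1F (just 1F) (identityˡ u) ∷ rule 1F 0F (just 1F) (identityʳ u) ∷ [])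
             (let e′ = var 0F ; u′ = var 1F ; r′ = e′ :- (u′ :+ u′) in
               e′ :- (r′ :+ r′ :* u′ :+ u′ :* r′ :+ u′ :* r′ :* u′))
             (let u′ = var 1F in u′ :* u′ :+ u′ :* u′ :+ u′ :* u′ :+ (u′ :* u′ :* u′ :+ u′ :* u′ :* u′)) ≡.refl ⟩
      u ∙ u +ᴹ u ∙ u +ᴹ u ∙ u +ᴹ (u ∙ u ∙ u +ᴹ u ∙ u ∙ u) ∎
      where
      u = half-deficit w
      w⋆w = w ⋆ ∙ w
      r = e -ᴹ (u +ᴹ u)
      u⋆≈u : IsSelfAdjoint u
      u⋆≈u = selfAdjoint-half (selfAdjoint-∸ e⋆≈e (selfAdjoint-x⋆x w))
      h : w⋆w ≈ᴹ r
      h = begin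
        w⋆w                  ≈⟨ solve (e ∷ w⋆w ∷ []) [] (var 1F) (var 0F :- (var 0F :- var 1F)) ≡.refl ⟩
        e -ᴹ deficit w       ≈⟨ +ᴹ-congˡ (-ᴹ‿cong (half+halfᴹ (deficit w))) ⟨
        e -ᴹ (u +ᴹ u)        ∎

    ‖half-deficit‖ : ∀ w → 2* ‖ half-deficit w ‖ ≈ ‖ deficit w ‖
    ‖half-deficit‖ w = trans (sym (‖x+x‖≈ (half-deficit w))) (‖‖-cong (half+halfᴹ (deficit w)))

    deficit-halves : ∀ w → 2* ‖ deficit w ‖ ≤ 1# → 2* ‖ deficit (polar-step w) ‖ ≤ ‖ deficit w ‖
    deficit-halves w 2n≤1 = ≤-resp refl (‖half-deficit‖ w) (2*-mono (≤-by
      (+-mono-≤ (+-mono-≤ d (+-mono-≤ 4q≤m 4c≤q)) (+-nonneg 0≤c 0≤c))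
      (solveᴿ 4 (λ d m q c →
        d ⊕ ((((q ⊕ q ⊕ q) ⊕ (c ⊕ c)) ⊕ (m ⊕ q)) ⊕ (c ⊕ c)) :=
        m ⊕ ((d ⊕ (((q ⊕ q) ⊕ (q ⊕ q)) ⊕ ((c ⊕ c) ⊕ (c ⊕ c)))) ⊕ con 0)) refl _ m q c)))
      where
      m = ‖ half-deficit w ‖
      q = m * m
      c = q * m
      0≤m = ‖‖-nonneg (half-deficit w)
      0≤q = *-nonneg 0≤m 0≤m
      0≤c = *-nonneg 0≤q 0≤m
      4m≤1 : 4* m ≤ 1#
      4m≤1 = ≤-trans (2*-mono (≤-reflexive (‖half-deficit‖ w))) 2n≤1
      4q≤m : 4* q ≤ m
      4q≤m = ≤-resp (solveᴿ 1 (λ m → ((m ⊕ m) ⊕ (m ⊕ m)) ⊗ m := (m ⊗ m ⊕ m ⊗ m) ⊕ (m ⊗ m ⊕ m ⊗ m)) refl m)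
                    (*-identityˡ m) (*-monoʳ-≤ 0≤m 4m≤1)
      4c≤q : 4* c ≤ q
      4c≤q = ≤-resp (solveᴿ 2 (λ m q → ((q ⊕ q) ⊕ (q ⊕ q)) ⊗ m := (q ⊗ m ⊕ q ⊗ m) ⊕ (q ⊗ m ⊕ q ⊗ m)) refl m q)
                    refl (*-monoʳ-≤ 0≤m 4q≤m)
      d : ‖ deficit (polar-step w) ‖ ≤ (q + q + q) + (c + c)
      d = ‖‖≤-cong (deficit-step w) (‖‖-+ (‖‖-+ (‖‖-+ uu uu) uu) (‖‖-+ uuu uuu))
        where
        uu  = ‖‖-∙ ≤-refl ≤-refl
        uuu = ‖‖-∙ uu ≤-refl

    ‖‖≤2 : ∀ {w} → ‖ deficit w ‖ ≤ 1# → ‖ w ‖ ≤ 1# + 1#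
    ‖‖≤2 {w} t≤1 = x*x≤y*y⇒x≤y (+-nonneg 0≤1 0≤1) (≤-trans (≤-reflexive (sym (C⋆-identity w)))
      (≤-trans (≤-trans (‖x‖≤‖y‖+r (‖x-y‖-comm t≤1)) (+-monoˡ-≤ 1# ‖e‖≤1))
      (≤-resp (*-identityʳ _) refl (*-mono-≤ 0≤1 (+-nonneg 0≤1 0≤1) ≤-refl 1≤2))))

    polar : ∀ w → 2* ‖ deficit w ‖ ≤ 1# → ∃[ v ] IsIsometry v × ‖ v -ᴹ w ‖ ≤ 2* ‖ deficit w ‖
    polar w small = let v , near , approx = limit (w , small) in v , isometry v approx , near
      where
      State : Set ℓ
      State = Σ[ w ∈ Carrier ] 2* ‖ deficit w ‖ ≤ 1#
      err : State → R
      err (w , _) = ‖ deficit w ‖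
      err≤1 : ∀ s → err s ≤ 1#
      err≤1 (w , small) = ≤-trans (x≤x+y (‖‖-nonneg _)) small
      step : State → State
      step s@(w , small) = polar-step w , ≤-trans (deficit-halves w small) (err≤1 s)
      pt-step : ∀ s → ‖ proj₁ (step s) -ᴹ proj₁ s ‖ ≤ err s
      pt-step s@(w , small) = ‖‖≤-cong
        (let a = var 0F ; b = var 1F in solve (w ∷ half-deficit w ∷ []) [] (a :+ a :* b :- a) (a :* b) ≡.refl)
        (≤-trans (‖‖-∙ (‖‖≤2 (err≤1 s)) ≤-refl)
          (≤-reflexive (trans (trans (distribʳ _ _ _) (+-cong (*-identityˡ _) (*-identityˡ _))) (‖half-deficit‖ w))))
      open Iteration proj₁ err step (λ s → ‖‖-nonneg _) (λ (w , small) → deficit-halves w small) pt-step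
      isometry : ∀ v → (∀ ε → 0# < ε → ∃[ s ] ‖ v -ᴹ proj₁ s ‖ ≤ ε × err s ≤ ε) → IsIsometry v
      isometry v approx = ≈ᴹ-sym (‖x-y‖≤0⇒x≈y (vanishes (1# + 1# + 1# + ‖ v ⋆ ‖)
        (+-nonneg (+-nonneg (+-nonneg 0≤1 0≤1) 0≤1) (‖‖-nonneg _)) λ ε 0<ε _ →
          let s@(w , small) , v~w , err≤ε = approx ε 0<ε
              w~v = ‖x-y‖-comm v~w
          in ≤-trans (‖‖-via err≤ε (‖∙-∙‖ (‖⋆-⋆‖ w~v) w~v ≤-refl (‖‖≤2 (err≤1 s))))
               (≤-reflexive (trans (+-congʳ (sym (*-identityˡ ε))) (solveᴿ 3 (λ u ε V →
                 u ⊗ ε ⊕ (ε ⊗ (u ⊕ u) ⊕ V ⊗ ε) := (u ⊕ u ⊕ u ⊕ V) ⊗ ε) refl 1# ε _)))))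

  nonunitary-isometry⇒infinite : ∀ {v} → IsIsometry v → ¬ v ∙ v ⋆ ≈ᴹ e → IsInfinite
  nonunitary-isometry⇒infinite {v} v⋆v≈e vv⋆≉e =
    v ∙ v ⋆ , e -ᴹ v ∙ v ⋆ , (pp≈p , p⋆≈p) , (qq≈q , selfAdjoint-∸ e⋆≈e p⋆≈p) , p≉0 ,
    (λ q≈0 → vv⋆≉e (≈ᴹ-sym (x-y≈0⇒x≈y _ _ q≈0))) , pq≈0 ,
    v , ≈ᴹ-trans v⋆v≈e (solve ρ [] e′ (p′ :+ (e′ :- p′)) ≡.refl) , ≈ᴹ-refl
    where
    ρ = e ∷ v ∷ v ⋆ ∷ []
    e′ = var 0F ; p′ = var 1F :* var 2F
    rules = rule 0F 0F (just 0F) (identityˡ e) ∷ rule 0F 1F (just 1F) (identityˡ v) ∷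
            rule 2F 0F (just 2F) (identityʳ (v ⋆)) ∷ rule 1F 0F (just 1F) (identityʳ v) ∷
            rule 2F 1F (just 0F) v⋆v≈e ∷ []
    pp≈p = solve ρ rules (p′ :* p′) p′ ≡.refl
    qq≈q = solve ρ rules ((e′ :- p′) :* (e′ :- p′)) (e′ :- p′) ≡.refl
    pq≈0 = ≈ᴹ-trans (solve ρ rules (p′ :* (e′ :- p′)) (e′ :- e′) ≡.refl) (-ᴹ‿inverseʳ e)
    p⋆≈p : IsSelfAdjoint (v ∙ v ⋆)
    p⋆≈p = ≈ᴹ-trans (⋆-anti-homo-∙ v (v ⋆)) (∙-congʳ (⋆-involutive v))
    p≉0 : ¬ v ∙ v ⋆ ≈ᴹ 0ᴹ
    p≉0 p≈0 = vv⋆≉e (≈ᴹ-trans p≈0 (≈ᴹ-sym (begin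
      e                      ≈⟨ solve ρ rules e′ (var 2F :* p′ :* var 1F) ≡.refl ⟩
      v ⋆ ∙ (v ∙ v ⋆) ∙ v    ≈⟨ ∙-congʳ (∙-congˡ p≈0) ⟩
      v ⋆ ∙ 0ᴹ ∙ v           ≈⟨ ≈ᴹ-trans (∙-congʳ (∙-zeroʳ _)) (∙-zeroˡ v) ⟩
      0ᴹ                     ∎)))

  infinite⇒nonunitary-isometry : IsInfinite → ∃[ v ] IsIsometry v × 1# ≤ ‖ e -ᴹ v ∙ v ⋆ ‖
  infinite⇒nonunitary-isometry (r , s , (rr≈r , r⋆≈r) , (ss≈s , s⋆≈s) , _ , s≉0 , rs≈0 , v , v⋆v≈r+s , vv⋆≈r) =
    w , w⋆w≈e , ≤-trans (1≤‖projection‖ (ss≈s , s⋆≈s) s≉0) (≤-reflexive (‖‖-cong (≈ᴹ-sym e-ww⋆≈s)))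
    where
    w = r ∙ v +ᴹ (e -ᴹ (r +ᴹ s))
    sr≈0 : s ∙ r ≈ᴹ 0ᴹ
    sr≈0 = ≈ᴹ-trans (≈ᴹ-sym (≈ᴹ-trans (⋆-anti-homo-∙ r s) (∙-cong s⋆≈s r⋆≈r))) (≈ᴹ-trans (⋆-cong rs≈0) 0⋆≈0)
    w⋆≈ : w ⋆ ≈ᴹ v ⋆ ∙ r +ᴹ (e -ᴹ (r +ᴹ s))
    w⋆≈ = ≈ᴹ-trans (⋆-homo-+ _ _) (+ᴹ-cong (≈ᴹ-trans (⋆-anti-homo-∙ r v) (∙-congˡ r⋆≈r))
      (selfAdjoint-∸ e⋆≈e (selfAdjoint-+ r⋆≈r s⋆≈s)))
    ρ = e ∷ r ∷ s ∷ v ∷ v ⋆ ∷ []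
    e′ = var 0F ; r′ = var 1F ; s′ = var 2F ; v′ = var 3F ; v⋆′ = var 4F
    f′ = e′ :- (r′ :+ s′)
    rules = rule 0F 0F (just 0F) (identityˡ e) ∷ rule 0F 1F (just 1F) (identityˡ r) ∷
            rule 0F 2F (just 2F) (identityˡ s) ∷ rule 0F 3F (just 3F) (identityˡ v) ∷
            rule 0F 4F (just 4F) (identityˡ (v ⋆)) ∷
            rule 1F 0F (just 1F) (identityʳ r) ∷ rule 2F 0F (just 2F) (identityʳ s) ∷
            rule 3F 0F (just 3F) (identityʳ v) ∷ rule 4F 0F (just 4F) (identityʳ (v ⋆)) ∷
            rule 1F 1F (just 1F) rr≈r ∷ rule 2F 2F (just 2F) ss≈s ∷
            rule 1F 2F nothing rs≈0 ∷ rule 2F 1F nothing sr≈0 ∷ []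
    w⋆w≈e : IsIsometry w
    w⋆w≈e = begin
      w ⋆ ∙ w
        ≈⟨ ∙-congʳ w⋆≈ ⟩
      (v ⋆ ∙ r +ᴹ (e -ᴹ (r +ᴹ s))) ∙ (r ∙ v +ᴹ (e -ᴹ (r +ᴹ s)))
        ≈⟨ solve ρ rules ((v⋆′ :* r′ :+ f′) :* (r′ :* v′ :+ f′)) (v⋆′ :* r′ :* v′ :+ f′) ≡.refl ⟩
      v ⋆ ∙ r ∙ v +ᴹ (e -ᴹ (r +ᴹ s))
        ≈⟨ +ᴹ-congʳ (∙-congʳ (∙-congˡ vv⋆≈r)) ⟨
      v ⋆ ∙ (v ∙ v ⋆) ∙ v +ᴹ (e -ᴹ (r +ᴹ s))
        ≈⟨ solve ρ [] (v⋆′ :* (v′ :* v⋆′) :* v′ :+ f′) ((v⋆′ :* v′) :* (v⋆′ :* v′) :+ f′) ≡.refl ⟩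
      (v ⋆ ∙ v) ∙ (v ⋆ ∙ v) +ᴹ (e -ᴹ (r +ᴹ s))
        ≈⟨ +ᴹ-congʳ (∙-cong v⋆v≈r+s v⋆v≈r+s) ⟩
      (r +ᴹ s) ∙ (r +ᴹ s) +ᴹ (e -ᴹ (r +ᴹ s))
        ≈⟨ solve ρ rules ((r′ :+ s′) :* (r′ :+ s′) :+ f′) e′ ≡.refl ⟩
      e ∎
    e-ww⋆≈s : e -ᴹ w ∙ w ⋆ ≈ᴹ s
    e-ww⋆≈s = begin
      e -ᴹ w ∙ w ⋆
        ≈⟨ +ᴹ-congˡ (-ᴹ‿cong (∙-congˡ w⋆≈)) ⟩
      e -ᴹ (r ∙ v +ᴹ (e -ᴹ (r +ᴹ s))) ∙ (v ⋆ ∙ r +ᴹ (e -ᴹ (r +ᴹ s)))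
        ≈⟨ +ᴹ-congˡ (-ᴹ‿cong (∙-cong (+ᴹ-congʳ rv≈vq) (+ᴹ-congʳ v⋆r≈qv⋆))) ⟩
      e -ᴹ (v ∙ (r +ᴹ s) +ᴹ (e -ᴹ (r +ᴹ s))) ∙ ((r +ᴹ s) ∙ v ⋆ +ᴹ (e -ᴹ (r +ᴹ s)))
        ≈⟨ solve ρ rules (e′ :- (v′ :* (r′ :+ s′) :+ f′) :* ((r′ :+ s′) :* v⋆′ :+ f′))
                          (e′ :- (v′ :* (r′ :+ s′) :* v⋆′ :+ f′)) ≡.refl ⟩
      e -ᴹ (v ∙ (r +ᴹ s) ∙ v ⋆ +ᴹ (e -ᴹ (r +ᴹ s)))
        ≈⟨ +ᴹ-congˡ (-ᴹ‿cong (+ᴹ-congʳ (≈ᴹ-trans (∙-congʳ (≈ᴹ-sym rv≈vq)) (≈ᴹ-trans (∙-assoc r v (v ⋆)) (∙-congˡ vv⋆≈r))))) ⟩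
      e -ᴹ (r ∙ r +ᴹ (e -ᴹ (r +ᴹ s)))
        ≈⟨ solve ρ rules (e′ :- (r′ :* r′ :+ f′)) s′ ≡.refl ⟩
      s ∎
      where
      rv≈vq : r ∙ v ≈ᴹ v ∙ (r +ᴹ s)
      rv≈vq = ≈ᴹ-trans (∙-congʳ (≈ᴹ-sym vv⋆≈r)) (≈ᴹ-trans (∙-assoc v (v ⋆) v) (∙-congˡ v⋆v≈r+s))
      v⋆r≈qv⋆ : v ⋆ ∙ r ≈ᴹ (r +ᴹ s) ∙ v ⋆
      v⋆r≈qv⋆ = ≈ᴹ-trans (∙-congˡ (≈ᴹ-sym vv⋆≈r)) (≈ᴹ-trans (≈ᴹ-sym (∙-assoc (v ⋆) v (v ⋆))) (∙-congʳ v⋆v≈r+s))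

  near-infinite : ∀ w → ‖ w ‖ ≤ 1# → ‖ w ⋆ ∙ w -ᴹ e ‖ ≤ ⅛ → 1# ≤ ‖ e -ᴹ w ∙ w ⋆ ‖ + ⅛ → IsInfinite
  near-infinite w ‖w‖≤1 w⋆w~e e≁ww⋆ =
    let v , iso , v~w = Polar.polar w 2t≤1
    in nonunitary-isometry⇒infinite iso λ vv⋆≈e → <⇒≰ (0<half (0<half 0<½)) (⅛≤0 v iso v~w vv⋆≈e)
    where
    2t≤1 : 2* ‖ e -ᴹ w ⋆ ∙ w ‖ ≤ 1#
    2t≤1 = ≤-trans (2*-mono (‖x-y‖-comm w⋆w~e)) (≤-trans (≤-reflexive (half+half _)) (≤-trans (half≤ (<⇒≤ 0<½)) ½≤1))
    ⅛≤0 : ∀ v → IsIsometry v → ‖ v -ᴹ w ‖ ≤ 2* ‖ e -ᴹ w ⋆ ∙ w ‖ → v ∙ v ⋆ ≈ᴹ e → ⅛ ≤ 0#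
    ⅛≤0 v iso v~w vv⋆≈e = ≤-by
      (+-mono-≤ (≤-trans e≁ww⋆ (+-monoˡ-≤ ⅛ dist)) (+-mono-≤ (+-nonneg 0≤⅛ 0≤⅛) (≤-reflexive 8⅛≈1)))
      (solveᴿ 2 (λ u d → d ⊕ ((((d ⊕ d) ⊕ (d ⊕ d)) ⊕ d) ⊕ ((d ⊕ d) ⊕ u)) :=
        con 0 ⊕ (u ⊕ (con 0 ⊕ ((d ⊕ d ⊕ (d ⊕ d)) ⊕ (d ⊕ d ⊕ (d ⊕ d)))))) refl 1# ⅛)
      where
      0≤⅛ : 0# ≤ ⅛
      0≤⅛ = 0≤half (0≤half (<⇒≤ 0<½))
      8⅛≈1 : 8* ⅛ ≈ 1#
      8⅛≈1 = trans (+-cong 4⅛≈½ 4⅛≈½) ½+½≈1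
        where
        4⅛≈½ = trans (+-cong (half+half _) (half+half _)) (half+half ½)
      dist : ‖ e -ᴹ w ∙ w ⋆ ‖ ≤ (⅛ + ⅛) + (⅛ + ⅛)
      dist = ‖‖≤-cong (+ᴹ-congʳ (≈ᴹ-sym vv⋆≈e))
        (≤-trans (‖∙-∙‖ v~w′ (‖⋆-⋆‖ v~w′) ‖w‖≤1 (‖‖-⋆ (‖isometry‖≤1 iso)))
                 (≤-reflexive (+-cong (*-identityʳ _) (*-identityˡ _))))
        where v~w′ = ≤-trans v~w (2*-mono (‖x-y‖-comm w⋆w~e))

module Formulas {ℓ} (ℝ : CompleteOrderedField ℓ) (lem : ExcludedMiddle ℓ) where
  open CompleteOrderedField ℝ hiding (isRingWithoutOne) renaming (Carrier to R; zero to *-zero)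
  open RealAnalysis ℝ lem
  open ContinuousLogic ℝ lem
  open SemiringSolver commutativeSemiring using (_:=_)
    renaming (solve to solveᴿ; _:+_ to _⊕_; _:*_ to _⊗_)
  open RingProperties ring using (-0#≈0#; -‿involutive)

  ⨆-upper : ∀ {I : Set ℓ} (f : I → R) {b} → (∀ i → f i ≤ b) → ∀ i → f i ≤ ⨆ f
  ⨆-upper {I} f {b} f≤b i with lem {I × ∃[ b ] (∀ i → f i ≤ b)}
  ... | yes (i₀ , b₀ , f≤b₀) = proj₁ (proj₂ (complete _ _ _)) (f i) (i , refl)
  ... | no ¬p = contradiction (i , b , f≤b) ¬p

  ⨆-least : ∀ {I : Set ℓ} (f : I → R) {b} → I → (∀ i → f i ≤ b) → ⨆ f ≤ b
  ⨆-least {I} f {b} i f≤b with lem {I × ∃[ b ] (∀ i → f i ≤ b)}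
  ... | yes (i₀ , b₀ , f≤b₀) = proj₂ (proj₂ (complete _ _ _)) b λ { _ (j , r≈) → ≤-trans (≤-reflexive r≈) (f≤b j) }
  ... | no ¬p = contradiction (i , b , f≤b) ¬p

  ⨆-empty : ∀ {I : Set ℓ} (f : I → R) → ¬ I → ⨆ f ≈ 0#
  ⨆-empty {I} f ¬i with lem {I × ∃[ b ] (∀ i → f i ≤ b)}
  ... | yes (i , _) = contradiction i ¬i
  ... | no _ = refl

  ⨅-lower : ∀ {I : Set ℓ} (f : I → R) {b} → (∀ i → - f i ≤ b) → ∀ i → ⨅ f ≤ f i
  ⨅-lower f -f≤b i = ≤-resp refl (-‿involutive (f i)) (-‿anti-≤ (⨆-upper (λ i → - f i) -f≤b i))

  ⨅-greatest : ∀ {I : Set ℓ} (f : I → R) {b} → I → (∀ i → b ≤ f i) → b ≤ ⨅ f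
  ⨅-greatest f {b} i b≤f = ≤-resp (-‿involutive b) refl
    (-‿anti-≤ (⨆-least (λ i → - f i) i (λ i → -‿anti-≤ (b≤f i))))

  ⨅-witness : ∀ {I : Set ℓ} (f : I → R) {b ε} → I → ⨅ f ≤ b → 0# < ε → ∃[ i ] f i ≤ b + ε
  ⨅-witness f {b} {ε} i ⨅≤b 0<ε with lem {∃[ i ] f i ≤ b + ε}
  ... | yes p = p
  ... | no ¬p = contradiction
    (≤-by (≤-trans (⨅-greatest f i (λ i → ≰⇒≥ λ fi≤ → ¬p (i , fi≤))) ⨅≤b)
          (trans (+-comm ε b) (sym (+-identityˡ _)))) (<⇒≰ 0<ε)

  ⨆-close : ∀ {I : Set ℓ} (f g : I → R) {ε b c} → I → (∀ i → f i ≤ b) → (∀ i → g i ≤ c) →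
            (∀ i → ∣ f i - g i ∣ ≤ ε) → ∣ ⨆ f - ⨆ g ∣ ≤ ε
  ⨆-close f g {ε} i f≤b g≤c f~g = ∣x-y∣≤
    (⨆-least f i λ i → ≤-trans (∣x-y∣≤⇒x≤y+z (f~g i)) (+-monoˡ-≤ ε (⨆-upper g g≤c i)))
    (⨆-least g i λ i → ≤-trans (∣x-y∣≤⇒y≤x+z (f~g i)) (+-monoˡ-≤ ε (⨆-upper f f≤b i)))

  ∣⨆∣≤ : ∀ {I : Set ℓ} (f : I → R) {M} → I → (∀ i → ∣ f i ∣ ≤ M) → ∣ ⨆ f ∣ ≤ M
  ∣⨆∣≤ f i ∣f∣≤M = ∣∣≤ (⨆-least f i f≤M)
    (≤-trans (-‿anti-≤ (⨆-upper f f≤M i)) (≤-trans (-x≤∣x∣ _) (∣f∣≤M i)))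
    where f≤M = λ i → ≤-trans (x≤∣x∣ _) (∣f∣≤M i)

  ∣-x∣≤ : ∀ {x b} → ∣ x ∣ ≤ b → ∣ - x ∣ ≤ b
  ∣-x∣≤ {x} p = ∣∣≤ (≤-trans (-x≤∣x∣ x) p) (≤-trans (≤-reflexive (-‿involutive x)) (≤-trans (x≤∣x∣ x) p))

  ∣-x--y∣≤ : ∀ {x y b} → ∣ x - y ∣ ≤ b → ∣ - x - - y ∣ ≤ b
  ∣-x--y∣≤ {x} {y} p = ≤-trans (≤-reflexive (⊔-congᴿ (RingProperties.-‿+-comm ring x (- y)))) (∣-x∣≤ p)
    where
    ⊔-congᴿ : ∀ {x y} → x ≈ y → ∣ x ∣ ≈ ∣ y ∣
    ⊔-congᴿ {x} {y} e = ≤-antisym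
      (∣∣≤ (≤-trans (≤-reflexive e) (x≤∣x∣ y)) (≤-trans (≤-reflexive (-‿cong e)) (-x≤∣x∣ y)))
      (∣∣≤ (≤-trans (≤-reflexive (sym e)) (x≤∣x∣ x)) (≤-trans (≤-reflexive (-‿cong (sym e))) (-x≤∣x∣ x)))

  scaled : ∀ {L ε} → 0# ≤ L → 0# < ε → ∃[ δ ] 0# < δ × L * δ ≤ ε
  scaled {L} {ε} 0≤L 0<ε =
    let δ , δ[L+1]≈ε , _ , pos = quotient ε {L + 1#}
          (<-≤-trans 0<1 (≤-resp (+-identityˡ 1#) refl (+-monoˡ-≤ 1# 0≤L)))
    in δ , pos 0<ε , ≤-trans (*-monoʳ-≤ (<⇒≤ (pos 0<ε)) (x≤x+y 0≤1))
                             (≤-reflexive (trans (*-comm _ _) δ[L+1]≈ε))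

  bounded : ∀ {Γ} (φ : Formula Γ) → ∃[ M ] 0# ≤ M × (∀ A a → ∣ eval A φ a ∣ ≤ M)
  bounded (dist {n} s t) = fromℕ n + fromℕ n , +-nonneg (0≤fromℕ n) (0≤fromℕ n) , λ A a →
    let module A = CStarAlgebra A
        open CStarLemmas lem A
        p : A.‖ Ball.point (evalᵗ A s a) A.-ᴹ Ball.point (evalᵗ A t a) ‖ ≤ fromℕ n + fromℕ n
        p = ‖‖-+ (Ball.bound (evalᵗ A s a)) (≤-trans (≤-reflexive (‖-x‖≈‖x‖ _)) (Ball.bound (evalᵗ A t a)))
    in ∣∣≤ p (≤-trans (≤-resp refl -0#≈0# (-‿anti-≤ (A.‖‖-nonneg _))) (+-nonneg (0≤fromℕ n) (0≤fromℕ n)))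
  bounded (connect {k} f f-cont φs) =
    let M , 0≤M , p = max-Fin (λ i M → ∀ A a → ∣ eval A (φs i) a ∣ ≤ M) (λ i M≤M′ q A a → ≤-trans (q A a) M≤M′)
                        (λ i → let M , _ , p = bounded (φs i) in M , p)
        B , q = bounded-on-box f f-cont 0≤M
        B′ , 0≤B′ , B≤B′ = max₂ 0# B
    in B′ , 0≤B′ , λ A a → ≤-trans (q _ (λ i → p i A a)) B≤B′
  bounded (sup n φ) =
    let M , 0≤M , p = bounded φ
    in M , 0≤M , λ A a → ∣⨆∣≤ (λ (x : Ball A n) → eval A φ (x ∷ a)) (Balls.0ᴮ A) (λ x → p A (x ∷ a))
  bounded (inf n φ) =
    let M , 0≤M , p = bounded φ
    in M , 0≤M , λ A a → ∣-x∣≤ (∣⨆∣≤ (λ (x : Ball A n) → - eval A φ (x ∷ a)) (Balls.0ᴮ A) (λ x → ∣-x∣≤ (p A (x ∷ a))))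

  lipschitz : ∀ {Γ n} (t : Term Γ n) → ∃[ L ] 0# ≤ L × (∀ A a b ε → 0# ≤ ε → Within A ε a b →
    Balls.distᴮ A (evalᵗ A t a) (evalᵗ A t b) ≤ L * ε)
  lipschitz (var i) = 1# , 0≤1 , λ A a b ε 0≤ε a~b → ≤-resp refl (sym (*-identityˡ ε)) (a~b i)
  lipschitz 0ᵗ = 0# , ≤-refl , λ A a b ε 0≤ε a~b → let open CStarLemmas lem A in
    x≈y⇒‖x-y‖≤ (≤-reflexive (sym (zeroˡ ε))) (CStarAlgebra.≈ᴹ-refl A)
  lipschitz (s +ᵗ t) =
    let L , 0≤L , p = lipschitz s
        M , 0≤M , q = lipschitz t
    in L + M , +-nonneg 0≤L 0≤M , λ A a b ε 0≤ε a~b → let open CStarLemmas lem A in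
       ≤-trans (‖+-+‖ (p A a b ε 0≤ε a~b) (q A a b ε 0≤ε a~b)) (≤-reflexive (sym (distribʳ ε L M)))
  lipschitz (_∙ᵗ_ {m} {n} s t) =
    let L , 0≤L , p = lipschitz s
        M , 0≤M , q = lipschitz t
    in L * fromℕ n + fromℕ m * M , +-nonneg (*-nonneg 0≤L (0≤fromℕ n)) (*-nonneg (0≤fromℕ m) 0≤M) ,
       λ A a b ε 0≤ε a~b → let open CStarLemmas lem A in
       ≤-trans (‖∙-∙‖ (p A a b ε 0≤ε a~b) (q A a b ε 0≤ε a~b) (Ball.bound (evalᵗ A s b)) (Ball.bound (evalᵗ A t a)))
         (≤-reflexive (solveᴿ 5 (λ L M m n ε → L ⊗ ε ⊗ n ⊕ m ⊗ (M ⊗ ε) := (L ⊗ n ⊕ m ⊗ M) ⊗ ε)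
           refl L M (fromℕ m) (fromℕ n) ε))
  lipschitz (t ⋆ᵗ) =
    let L , 0≤L , p = lipschitz t
    in L , 0≤L , λ A a b ε 0≤ε a~b → CStarLemmas.‖⋆-⋆‖ lem A (p A a b ε 0≤ε a~b)
  lipschitz (scale c k ∣c∣≤k t) =
    let L , 0≤L , p = lipschitz t
    in fromℕ k * L , *-nonneg (0≤fromℕ k) 0≤L , λ A a b ε 0≤ε a~b →
       let open CStarAlgebra A
           open CStarLemmas lem A
           x = Ball.point (evalᵗ A t a)
           y = Ball.point (evalᵗ A t b)
       in ≤-trans (‖‖≤-cong (c[x-y]≈ A c x y) (‖cx‖≤k‖x‖ c (x -ᴹ y) (0≤fromℕ k) ∣c∣≤k))
         (≤-trans (*-mono-≤ (‖‖-nonneg _) (0≤fromℕ k) ≤-refl (p A a b ε 0≤ε a~b)) (≤-reflexive (sym (*-assoc _ _ _))))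
    where
    c[x-y]≈ : ∀ A c x y → let open CStarAlgebra A in c *ₗ x -ᴹ c *ₗ y ≈ᴹ c *ₗ (x -ᴹ y)
    c[x-y]≈ A c x y = let open CStarAlgebra A in ≈ᴹ-sym (≈ᴹ-trans (*ₗ-distribˡ c x (-ᴹ y))
      (+ᴹ-congˡ (CStarLemmas.*ₗ--ᴹ lem A c y)))
  lipschitz (incl m≤n t) = lipschitz t

  Within-∷ : ∀ A {Γ n δ} (x y : Ball A n) (a b : Env A Γ) →
             Balls.distᴮ A x y ≤ δ → Within A δ a b → Within A δ (x ∷ a) (y ∷ b)
  Within-∷ A x y a b p q (here ≡.refl) = p
  Within-∷ A x y a b p q (there i)     = q i

  dist-refl : ∀ A {n δ} (x : Ball A n) → 0# ≤ δ → Balls.distᴮ A x x ≤ δ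
  dist-refl A x 0≤δ = CStarLemmas.x≈y⇒‖x-y‖≤ lem A 0≤δ (CStarAlgebra.≈ᴹ-refl A)

  Within-refl : ∀ A {Γ δ} (a : Env A Γ) → 0# ≤ δ → Within A δ a a
  Within-refl A a 0≤δ i = dist-refl A (All.lookup a i) 0≤δ

  uniformly-continuous : ∀ {Γ} (φ : Formula Γ) ε → 0# < ε → ∃[ δ ] 0# < δ ×
    (∀ A a b → Within A δ a b → ∣ eval A φ a - eval A φ b ∣ ≤ ε)
  uniformly-continuous (dist s t) ε 0<ε =
    let L , 0≤L , p = lipschitz s
        M , 0≤M , q = lipschitz t
        δ , 0<δ , small = scaled (+-nonneg 0≤L 0≤M) 0<ε
    in δ , 0<δ , λ A a b a~b →
       let open CStarAlgebra A
           open CStarLemmas lem A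
           u = p A a b δ (<⇒≤ 0<δ) a~b
           v = q A a b δ (<⇒≤ 0<δ) a~b
           Lδ+Mδ≤ε = ≤-trans (≤-reflexive (sym (distribʳ δ L M))) small
           half-bound : ∀ {x y x′ y′ r r′} → ‖ x -ᴹ x′ ‖ ≤ r → ‖ y -ᴹ y′ ‖ ≤ r′ → ‖ x -ᴹ y ‖ ≤ ‖ x′ -ᴹ y′ ‖ + (r + r′)
           half-bound = λ p q → ≤-trans (‖‖-via p (‖‖-via ≤-refl (‖x-y‖-comm q)))
             (≤-reflexive (solveᴿ 3 (λ r n r′ → r ⊕ (n ⊕ r′) := n ⊕ (r ⊕ r′)) refl _ _ _))
       in ∣x-y∣≤ (≤-trans (half-bound u v) (+-monoʳ-≤ _ Lδ+Mδ≤ε))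
                 (≤-trans (half-bound (‖x-y‖-comm u) (‖x-y‖-comm v)) (+-monoʳ-≤ _ Lδ+Mδ≤ε))
  uniformly-continuous (connect f f-cont φs) ε 0<ε =
    let M , 0≤M , bound = max-Fin (λ i M → ∀ A a → ∣ eval A (φs i) a ∣ ≤ M) (λ i M≤M′ q A a → ≤-trans (q A a) M≤M′)
                            (λ i → let M , _ , p = bounded (φs i) in M , p)
        η , 0<η , f-uc = uniformly-continuous-on-box f f-cont 0≤M ε 0<ε
        δ , 0<δ , close = min-Fin (λ i δ → ∀ A a b → Within A δ a b → ∣ eval A (φs i) a - eval A (φs i) b ∣ ≤ η)
                            (λ i δ′≤δ p A a b a~b → p A a b (λ j → ≤-trans (a~b j) δ′≤δ))
                            (λ i → uniformly-continuous (φs i) η 0<η)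
    in δ , 0<δ , λ A a b a~b → f-uc _ (λ i → bound i A a) _ (λ i → close i A a b a~b)
  uniformly-continuous (sup n φ) ε 0<ε =
    let δ , 0<δ , p = uniformly-continuous φ ε 0<ε
        M , _ , bound = bounded φ
    in δ , 0<δ , λ A a b a~b → ⨆-close (λ (x : Ball A n) → eval A φ (x ∷ a)) (λ x → eval A φ (x ∷ b)) (Balls.0ᴮ A)
         (λ x → ≤-trans (x≤∣x∣ _) (bound A (x ∷ a))) (λ x → ≤-trans (x≤∣x∣ _) (bound A (x ∷ b)))
         (λ x → p A (x ∷ a) (x ∷ b) (Within-∷ A x x a b (dist-refl A x (<⇒≤ 0<δ)) a~b))
  uniformly-continuous (inf n φ) ε 0<ε =
    let δ , 0<δ , p = uniformly-continuous φ ε 0<ε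
        M , _ , bound = bounded φ
    in δ , 0<δ , λ A a b a~b → ∣-x--y∣≤ (⨆-close (λ (x : Ball A n) → - eval A φ (x ∷ a)) (λ x → - eval A φ (x ∷ b)) (Balls.0ᴮ A)
         (λ x → ≤-trans (-x≤∣x∣ _) (bound A (x ∷ a))) (λ x → ≤-trans (-x≤∣x∣ _) (bound A (x ∷ b)))
         (λ x → ∣-x--y∣≤ (p A (x ∷ a) (x ∷ b) (Within-∷ A x x a b (dist-refl A x (<⇒≤ 0<δ)) a~b))))

  eval-sup-upper : ∀ A {Γ n} (φ : Formula (n ∷ Γ)) a (x : Ball A n) → eval A φ (x ∷ a) ≤ eval A (sup n φ) a
  eval-sup-upper A φ a = let M , _ , bound = bounded φ in
    ⨆-upper (λ x → eval A φ (x ∷ a)) (λ x → ≤-trans (x≤∣x∣ _) (bound A (x ∷ a)))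

  eval-sup-least : ∀ A {Γ n} (φ : Formula (n ∷ Γ)) a {r} → (∀ (x : Ball A n) → eval A φ (x ∷ a) ≤ r) →
                   eval A (sup n φ) a ≤ r
  eval-sup-least A φ a = ⨆-least (λ x → eval A φ (x ∷ a)) (Balls.0ᴮ A)

  eval-inf-lower : ∀ A {Γ n} (φ : Formula (n ∷ Γ)) a (x : Ball A n) → eval A (inf n φ) a ≤ eval A φ (x ∷ a)
  eval-inf-lower A φ a = let M , _ , bound = bounded φ in
    ⨅-lower (λ x → eval A φ (x ∷ a)) (λ x → ≤-trans (-x≤∣x∣ _) (bound A (x ∷ a)))

  eval-inf-greatest : ∀ A {Γ n} (φ : Formula (n ∷ Γ)) a {r} → (∀ (x : Ball A n) → r ≤ eval A φ (x ∷ a)) →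
                      r ≤ eval A (inf n φ) a
  eval-inf-greatest A φ a = ⨅-greatest (λ x → eval A φ (x ∷ a)) (Balls.0ᴮ A)

  eval-inf-witness : ∀ A {Γ n} (φ : Formula (n ∷ Γ)) a {r ε} → eval A (inf n φ) a ≤ r → 0# < ε →
                     ∃[ x ] eval A φ (x ∷ a) ≤ r + ε
  eval-inf-witness A φ a = ⨅-witness (λ x → eval A φ (x ∷ a)) (Balls.0ᴮ A)

  infixl 6 _-ᶠ_
  infixl 7 _·ᶠ_
  infixl 5 _⊔ᶠ_
  infix  8 -ᶠ_

  ∸-close : ∀ {a a′ b b′ ε} → a ≤ a′ + half ε → b′ ≤ b + half ε → a - b ≤ a′ - b′ + ε
  ∸-close {a} {a′} {b} {b′} {ε} p q = x≤y+z⇒x-y≤z (≤-by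
    (+-mono-≤ (≤-trans p (≤-reflexive (+-congʳ (sym (x-y+y≈x a′ b′))))) q)
    (trans (solveᴿ 5 (λ a b b′ c d → a ⊕ (((c ⊕ b′) ⊕ d) ⊕ (b ⊕ d)) 
               := (b ⊕ (c ⊕ (d ⊕ d))) ⊕ (a ⊕ b′)) refl a b b′ (a′ - b′) (half ε))
           (+-congʳ (+-congˡ (+-congˡ (half+half ε))))))

  *-close : ∀ {K x y δ ε} → 0# ≤ K → x ≤ y + δ → K * δ ≤ ε → K * x ≤ K * y + ε
  *-close {K} 0≤K p small = ≤-trans (≤-resp (*-comm _ _) (trans (*-comm _ _) (distribˡ _ _ _)) (*-monoʳ-≤ 0≤K p))
                              (+-monoʳ-≤ _ small)

  constᶠ : ∀ {Γ} → R → Formula Γ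
  constᶠ r = connect {k = 0} (λ _ → r) (λ _ ε 0<ε → 1# , 0<1 , λ _ _ → ∣x-x∣≤ (<⇒≤ 0<ε)) λ ()

  -ᶠ_ : ∀ {Γ} → Formula Γ → Formula Γ
  -ᶠ φ = connect {k = 1} (λ v → - v 0F) (λ _ ε 0<ε → ε , 0<ε , λ _ p → ∣-x--y∣≤ (p 0F)) λ _ → φ

  _⊔ᶠ_ _-ᶠ_ : ∀ {Γ} → Formula Γ → Formula Γ → Formula Γ
  φ ⊔ᶠ ψ = connect {k = 2} (λ v → v 0F ⊔ v 1F)
    (λ x ε 0<ε → ε , 0<ε , λ y p → ∣x-y∣≤
      (⊔-lub (≤-trans (∣x-y∣≤⇒x≤y+z (p 0F)) (+-monoˡ-≤ ε (x≤x⊔y _ _)))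
             (≤-trans (∣x-y∣≤⇒x≤y+z (p 1F)) (+-monoˡ-≤ ε (x≤y⊔x _ _))))
      (⊔-lub (≤-trans (∣x-y∣≤⇒y≤x+z (p 0F)) (+-monoˡ-≤ ε (x≤x⊔y _ _)))
             (≤-trans (∣x-y∣≤⇒y≤x+z (p 1F)) (+-monoˡ-≤ ε (x≤y⊔x _ _)))))
    (φ Vector.∷ ψ Vector.∷ Vector.[])
  φ -ᶠ ψ = connect {k = 2} (λ v → v 0F - v 1F)
    (λ x ε 0<ε → half ε , 0<half 0<ε , λ y p → ∣x-y∣≤
      (∸-close (∣x-y∣≤⇒x≤y+z (p 0F)) (∣x-y∣≤⇒y≤x+z (p 1F)))
      (∸-close (∣x-y∣≤⇒y≤x+z (p 0F)) (∣x-y∣≤⇒x≤y+z (p 1F))))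
    (φ Vector.∷ ψ Vector.∷ Vector.[])

  _·ᶠ_ : ∀ {Γ} (K : Σ[ K ∈ R ] 0# ≤ K) → Formula Γ → Formula Γ
  (K , 0≤K) ·ᶠ φ = connect {k = 1} (λ v → K * v 0F)
    (λ x ε 0<ε → let δ , 0<δ , small = scaled 0≤K 0<ε in δ , 0<δ , λ y p → ∣x-y∣≤
      (*-close 0≤K (∣x-y∣≤⇒x≤y+z (p 0F)) small) (*-close 0≤K (∣x-y∣≤⇒y≤x+z (p 0F)) small)) λ _ → φ

module Definability {ℓ} (ℝ : CompleteOrderedField ℓ) (lem : ExcludedMiddle ℓ) where
  open CompleteOrderedField ℝ hiding (isRingWithoutOne) renaming (Carrier to R; zero to *-zero)
  open RealAnalysis ℝ lem
  open ContinuousLogic ℝ lem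
  open Formulas ℝ lem
  open RingProperties ring using (-0#≈0#; -‿involutive)

  clamp : R → R → R
  clamp l s = - l ⊔ - (- l ⊔ - s)

  clampᶠ : ∀ {Γ} → Formula Γ → Formula Γ → Formula Γ
  clampᶠ λᶠ σ = -ᶠ λᶠ ⊔ᶠ -ᶠ (-ᶠ λᶠ ⊔ᶠ -ᶠ σ)

  clamp-id : ∀ {l s} → - l ≤ s → s ≤ l → clamp l s ≈ s
  clamp-id {l} {s} -l≤s s≤l = ≤-antisym
    (⊔-lub -l≤s (≤-resp refl (-‿involutive s) (-‿anti-≤ (x≤y⊔x (- l) (- s)))))
    (≤-trans (≤-resp (-‿involutive s) refl (-‿anti-≤ (⊔-lub (-‿anti-≤ s≤l) ≤-refl))) (x≤y⊔x (- l) _))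

  clamp-0 : ∀ {l s} → l ≈ 0# → clamp l s ≈ 0#
  clamp-0 {l} {s} l≈0 = ≤-antisym
    (⊔-lub (≤-reflexive -l≈0) (≤-trans (-‿anti-≤ (x≤x⊔y (- l) (- s))) (≤-reflexive (trans (-‿involutive l) l≈0))))
    (≤-trans (≤-reflexive (sym -l≈0)) (x≤x⊔y (- l) _))
    where -l≈0 = trans (-‿cong l≈0) -0#≈0#

  -- φ plays the role of the distance to X.
  record IsZeroSet {n} (X : ∀ A → Pred (Env A (n ∷ [])) ℓ) (φ : ∀ Δ → Formula (n ∷ Δ)) : Set (Level.suc ℓ) where
    field
      nonneg   : ∀ Δ A x b → 0# ≤ eval A (φ Δ) (x ∷ b)
      vanishes : ∀ Δ A x b → X A (x ∷ []) → eval A (φ Δ) (x ∷ b) ≤ 0#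
      zero-set : ∀ A x → eval A (φ []) (x ∷ []) ≤ 0# → X A (x ∷ [])
      near     : ∀ Δ δ → 0# < δ → ∃[ η ] 0# < η × (∀ A x b → eval A (φ Δ) (x ∷ b) ≤ η →
                   ∃[ y ] X A (y ∷ []) × Balls.distᴮ A x y ≤ δ)

  module _ {n} {X : ∀ A → Pred (Env A (n ∷ [])) ℓ} {φ : ∀ Δ → Formula (n ∷ Δ)} (X-φ : IsZeroSet X φ) where
    open IsZeroSet X-φ

    module _ {Δ} (ψ : Formula (n ∷ Δ)) where

      values : ∀ A (b : Env A Δ) → ∃ (X A) → R
      values A b (a , _) = eval A ψ (++⁺ a b)

      -- For large K, the supremum of ψ - Kφ over the whole sort is close to that
      -- of ψ over X, unless X is empty; but then φ is bounded away from 0, and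
      -- the clamping replaces the value by 0.
      sup-approximation : ∀ ε → 0# < ε → ∃[ χ ] ∀ A b → ∣ eval A χ b - ⨆ (values A b) ∣ ≤ ε
      sup-approximation ε 0<ε = clampᶠ radius penalised , approximates
        where
        M    = proj₁ (bounded ψ)
        0≤M  = proj₁ (proj₂ (bounded ψ))
        ∣ψ∣≤M = proj₂ (proj₂ (bounded ψ))
        δ    = proj₁ (uniformly-continuous ψ ε 0<ε)
        0<δ  = proj₁ (proj₂ (uniformly-continuous ψ ε 0<ε))
        ψ-uc = proj₂ (proj₂ (uniformly-continuous ψ ε 0<ε))
        η    = proj₁ (near Δ δ 0<δ)
        0<η  = proj₁ (proj₂ (near Δ δ 0<δ))
        φ-near = proj₂ (proj₂ (near Δ δ 0<δ))
        slope = quotient (M + M) 0<η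
        K    = proj₁ slope
        Kη≈2M = proj₁ (proj₂ slope)
        0≤K  = proj₁ (proj₂ (proj₂ slope)) (+-nonneg 0≤M 0≤M)
        penalty : Formula (n ∷ Δ)
        penalty = ψ -ᶠ (K , 0≤K) ·ᶠ φ Δ
        penalised radius : Formula Δ
        penalised = sup n penalty
        radius    = constᶠ 0# ⊔ᶠ (constᶠ M -ᶠ (K , 0≤K) ·ᶠ inf n (φ Δ))

        K*-mono : ∀ {x y} → x ≤ y → K * x ≤ K * y
        K*-mono p = ≤-resp (*-comm _ _) (*-comm _ _) (*-monoʳ-≤ 0≤K p)
        Kφ≥0 : ∀ {x} → 0# ≤ x → 0# ≤ K * x
        Kφ≥0 = *-nonneg 0≤K
        x-y≤x : ∀ {x y} → 0# ≤ y → x - y ≤ x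
        x-y≤x {x} {y} 0≤y = ≤-resp refl (+-identityʳ x) (+-monoʳ-≤ x (≤-resp refl -0#≈0# (-‿anti-≤ 0≤y)))
        x≤x-y : ∀ {x y} → y ≤ 0# → x ≤ x - y
        x≤x-y {x} {y} y≤0 = ≤-resp (+-identityʳ x) refl (+-monoʳ-≤ x (≤-resp -0#≈0# refl (-‿anti-≤ y≤0)))
        K*≤0 : ∀ {x} → x ≤ 0# → K * x ≤ 0#
        K*≤0 p = ≤-trans (K*-mono p) (≤-reflexive (zeroʳ K))
        M-K≤-M : ∀ {x y} → x ≤ M → η ≤ y → x - K * y ≤ - M
        M-K≤-M x≤M η≤y = x≤y+z⇒x-y≤z (≤-trans x≤M (≤-trans
          (≤-reflexive (sym (x+z-z≈x M M))) (+-monoˡ-≤ (- M) (≤-trans (≤-reflexive (sym Kη≈2M)) (K*-mono η≤y)))))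

        module _ (A : CStarAlgebra ℝ) (b : Env A Δ) where
          f = values A b
          φ≥0 = λ x → nonneg Δ A x b
          f≤M : ∀ z → f z ≤ M
          f≤M (x ∷ [] , _) = ≤-trans (x≤∣x∣ _) (∣ψ∣≤M A (x ∷ b))
          s t : R
          s = eval A penalised b
          t = eval A (inf n (φ Δ)) b

          nonempty : ∃ (X A) → ∣ eval A (clampᶠ radius penalised) b - ⨆ f ∣ ≤ ε
          nonempty z₀@(x₀ ∷ [] , x₀∈X) = ∣x-y∣≤
            (≤-trans (≤-reflexive s≈) (eval-sup-least A penalty b λ x → bound x (≤-total (eval A (φ Δ) (x ∷ b)) η)))
            (≤-trans (⨆-least f z₀ f≤s) (≤-trans (≤-reflexive (sym s≈)) (x≤x+y (<⇒≤ 0<ε))))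
            where
            f≤s : ∀ z → f z ≤ s
            f≤s (x ∷ [] , x∈X) = ≤-trans (x≤x-y (K*≤0 (vanishes Δ A x b x∈X))) (eval-sup-upper A penalty b x)
            t≤0 : t ≤ 0#
            t≤0 = ≤-trans (eval-inf-lower A (φ Δ) b x₀) (vanishes Δ A x₀ b x₀∈X)
            M≤radius : M ≤ eval A radius b
            M≤radius = ≤-trans (x≤x-y (K*≤0 t≤0)) (x≤y⊔x 0# _)
            s≤M : s ≤ M
            s≤M = eval-sup-least A penalty b λ x →
              ≤-trans (x-y≤x (Kφ≥0 (φ≥0 x))) (≤-trans (x≤∣x∣ _) (∣ψ∣≤M A (x ∷ b)))
            s≈ : eval A (clampᶠ radius penalised) b ≈ s
            s≈ = clamp-id (≤-trans (-‿anti-≤ M≤radius) (≤-trans (∣x∣≤⇒-y≤x (∣ψ∣≤M A (x₀ ∷ b))) (f≤s z₀)))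
                          (≤-trans s≤M M≤radius)
            bound : ∀ x → _ → eval A penalty (x ∷ b) ≤ ⨆ f + ε
            bound x (inj₁ φ≤η) =
              let y , y∈X , x~y = φ-near A x b φ≤η
              in ≤-trans (x-y≤x (Kφ≥0 (φ≥0 x)))
                (≤-trans (∣x-y∣≤⇒x≤y+z (ψ-uc A (x ∷ b) (y ∷ b) (Within-∷ A x y b b x~y (Within-refl A b (<⇒≤ 0<δ)))))
                         (+-monoˡ-≤ ε (⨆-upper f f≤M (y ∷ [] , y∈X))))
            bound x (inj₂ η≤φ) = ≤-trans (M-K≤-M (≤-trans (x≤∣x∣ _) (∣ψ∣≤M A (x ∷ b))) η≤φ)
              (≤-trans (∣x∣≤⇒-y≤x (∣ψ∣≤M A (x₀ ∷ b))) (≤-trans (⨆-upper f f≤M z₀) (x≤x+y (<⇒≤ 0<ε))))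

          empty : ¬ ∃ (X A) → ∣ eval A (clampᶠ radius penalised) b - ⨆ f ∣ ≤ ε
          empty X-empty = ∣x-y∣≤
            (≤-trans (≤-reflexive e) (x≤x+y (<⇒≤ 0<ε)))
            (≤-trans (≤-reflexive (sym e)) (x≤x+y (<⇒≤ 0<ε)))
            where
            η≤t : η ≤ t
            η≤t = eval-inf-greatest A (φ Δ) b λ x → ≰⇒≥ λ φ≤η →
              let y , y∈X , _ = φ-near A x b φ≤η in X-empty (y ∷ [] , y∈X)
            e : eval A (clampᶠ radius penalised) b ≈ ⨆ f
            e = trans (clamp-0 {s = s} (≤-antisym
                  (⊔-lub ≤-refl (≤-trans (M-K≤-M ≤-refl η≤t) (≤-resp refl -0#≈0# (-‿anti-≤ 0≤M)))) (x≤x⊔y 0# _)))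
                (sym (⨆-empty f X-empty))

          approximates : ∣ eval A (clampᶠ radius penalised) b - ⨆ f ∣ ≤ ε
          approximates with lem {∃ (X A)}
          ... | yes z = nonempty z
          ... | no ¬z = empty ¬z

    sup-definable : ∀ {Δ} (ψ : Formula (n ∷ Δ)) → IsDefinablePredicate AllAlgebras {Δ} (λ A b → ⨆ (values ψ A b))
    sup-definable ψ = (λ k → proj₁ (sup-approximation ψ (½^ k) (0<½^ k))) , λ ε 0<ε →
      let N , small = ½^-vanishes ε 0<ε
      in N , λ k N≤k A _ b → ≤-trans (proj₂ (sup-approximation ψ (½^ k) (0<½^ k)) A b) (small k N≤k)

    inf-definable : ∀ {Δ} (ψ : Formula (n ∷ Δ)) → IsDefinablePredicate AllAlgebras {Δ} (λ A b → ⨅ (values ψ A b))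
    inf-definable ψ = let χ , approx = sup-definable (-ᶠ ψ) in
      (λ k → -ᶠ χ k) , λ ε 0<ε → let N , close = approx ε 0<ε in
        N , λ k N≤k A c b → ∣-x--y∣≤ (close k N≤k A c b)

    zeroSet-definable : IsDefinableSet AllAlgebras X
    zeroSet-definable = record
      { isUniformAssignment = record
        { closed     = λ { A _ (x ∷ []) limit → zero-set A x (≤-limit λ ε 0<ε →
            let δ , 0<δ , φ-uc = uniformly-continuous (φ []) ε 0<ε
                y , y∈X , x~y = limit δ 0<δ
            in closeness A x y (φ-uc A (x ∷ []) y x~y) y∈X) }
        ; functorial = λ { A B _ _ h elementary (x ∷ []) x∈X → zero-set B _
            (≤-trans (≤-reflexive (elementary (φ []) (x ∷ []))) (vanishes [] A x [] x∈X)) }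
        }
      ; sup-definable = sup-definable
      ; inf-definable = inf-definable
      }
      where
      closeness : ∀ A x y {ε} → ∣ eval A (φ []) (x ∷ []) - eval A (φ []) y ∣ ≤ ε → X A y →
                  eval A (φ []) (x ∷ []) ≤ 0# + ε
      closeness A x (y ∷ []) {ε} p y∈X = ≤-trans (∣x-y∣≤⇒x≤y+z p) (+-monoˡ-≤ ε (vanishes [] A y [] y∈X))

    nonempty-elementary : ∀ {𝒞 : Class} → (∀ A → 𝒞 A → ∃[ x ] X A (x ∷ [])) → (∀ A x → X A (x ∷ []) → 𝒞 A) →
                          IsElementary 𝒞
    nonempty-elementary to from = (_≡ inf n (φ [])) , λ A → mk⇔
      (λ A∈𝒞 → λ { _ ≡.refl → let x , x∈X = to A A∈𝒞 in ≤-antisym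
        (≤-trans (eval-inf-lower A (φ []) [] x) (vanishes [] A x [] x∈X))
        (eval-inf-greatest A (φ []) [] (λ x → nonneg [] A x [])) })
      (λ models →
        let η , 0<η , φ-near = near [] 1# 0<1
            x , φx≤η = eval-inf-witness A (φ []) [] (≤-reflexive (models _ ≡.refl)) 0<η
            y , y∈X , _ = φ-near A x [] (≤-trans φx≤η (≤-reflexive (+-identityˡ η)))
        in from A y y∈X)

  self : ∀ {Δ} → Term (1 ∷ Δ) 1
  self = var (here ≡.refl)

  projectionᶠ : ∀ Δ → Formula (1 ∷ Δ)
  projectionᶠ Δ = dist (self ∙ᵗ self) self ⊔ᶠ dist (self ⋆ᵗ) self

  module _ (P : ∀ A → Pred (CStarAlgebra.Carrier A) ℓ)
    (P⇒projection : ∀ A p → P A p → CStarAlgebra.IsProjection A p)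
    (θ : ∀ Δ → Formula (1 ∷ Δ)) {c} (0<c : 0# < c)
    (θ-vanishes : ∀ Δ A p b → P A (Ball.point p) → eval A (θ Δ) (p ∷ b) ≤ 0#)
    (θ-gap : ∀ Δ A p b → CStarAlgebra.IsProjection A (Ball.point p) →
             eval A (θ Δ) (p ∷ b) ≤ c → P A (Ball.point p))
    where

    projections-zeroSet : IsZeroSet (inUnitBall P) (λ Δ → projectionᶠ Δ ⊔ᶠ θ Δ)
    projections-zeroSet = record
      { nonneg = λ Δ A x b → ≤-trans (CStarAlgebra.‖‖-nonneg A _) (≤-trans (x≤x⊔y _ _) (x≤x⊔y _ _))
      ; vanishes = λ Δ A x b Px →
          let open CStarLemmas lem A
              xx≈x , x⋆≈x = P⇒projection A (Ball.point x) Px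
          in ⊔-lub (⊔-lub (x≈y⇒‖x-y‖≤ ≤-refl xx≈x) (x≈y⇒‖x-y‖≤ ≤-refl x⋆≈x)) (θ-vanishes Δ A x b Px)
      ; zero-set = λ A x φ≤0 →
          let open CStarLemmas lem A
              π≤0 = ≤-trans (x≤x⊔y _ _) φ≤0
          in θ-gap [] A x [] (‖x-y‖≤0⇒x≈y (≤-trans (x≤x⊔y _ _) π≤0) , ‖x-y‖≤0⇒x≈y (≤-trans (x≤y⊔x _ _) π≤0))
               (≤-trans (≤-trans (x≤y⊔x _ _) φ≤0) (<⇒≤ 0<c))
      ; near = near
      }
      where
      module _ (Δ : Context) (δ : R) (0<δ : 0# < δ) where
        θ-uc = uniformly-continuous (θ Δ) (half c) (0<half 0<c)
        δ₁   = proj₁ θ-uc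
        0<δ₁ = proj₁ (proj₂ θ-uc)
        δ₂   = min₂ 0<δ 0<δ₁
        m    = min₂ (proj₁ (proj₂ δ₂)) 0<1
        κ    = sixteenth (sixteenth (proj₁ m))
        0<κ : 0# < κ
        0<κ = 0<sixteenth (0<sixteenth (proj₁ (proj₂ m)))
        256κ≈m : 16* (16* κ) ≈ proj₁ m
        256κ≈m = trans (16*-cong (16*sixteenth _)) (16*sixteenth _)
        η    = min₂ 0<κ (0<half 0<c)

        near-member : ∀ A x b → eval A (projectionᶠ Δ ⊔ᶠ θ Δ) (x ∷ b) ≤ proj₁ η →
                      ∃[ y ] P A (Ball.point y) × Balls.distᴮ A x y ≤ δ
        near-member A x b φ≤η = y , θ-gap Δ A y b (proj₁ (proj₂ p)) θy≤c , ≤-trans x~y (proj₁ (proj₂ (proj₂ δ₂)))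
          where
          open CStarLemmas lem A
          open NearProjections lem A
          φ≤κ : eval A (projectionᶠ Δ ⊔ᶠ θ Δ) (x ∷ b) ≤ κ
          φ≤κ = ≤-trans φ≤η (proj₁ (proj₂ (proj₂ η)))
          p = near-projection (<⇒≤ 0<κ) (≤-trans (Ball.bound x) (≤-reflexive (+-identityʳ 1#)))
            (≤-trans (x≤x⊔y _ _) (≤-trans (x≤x⊔y _ _) φ≤κ)) (≤-trans (x≤y⊔x _ _) (≤-trans (x≤x⊔y _ _) φ≤κ))
            (≤-trans (≤-reflexive 256κ≈m) (proj₂ (proj₂ (proj₂ m))))
          y : Ball A 1
          y = ball (proj₁ p) (≤-trans (‖projection‖≤1 (proj₁ (proj₂ p))) (≤-reflexive (sym (+-identityʳ 1#))))
          x~y : Balls.distᴮ A x y ≤ proj₁ δ₂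
          x~y = ‖x-y‖-comm (≤-trans (proj₂ (proj₂ p)) (≤-trans (≤-reflexive 256κ≈m) (proj₁ (proj₂ (proj₂ m)))))
          θy≤c : eval A (θ Δ) (y ∷ b) ≤ c
          θy≤c = ≤-trans (∣x-y∣≤⇒y≤x+z (proj₂ (proj₂ θ-uc) A (x ∷ b) (y ∷ b)
                    (Within-∷ A x y b b (≤-trans x~y (proj₂ (proj₂ (proj₂ δ₂)))) (Within-refl A b (<⇒≤ 0<δ₁)))))
                 (≤-trans (+-monoˡ-≤ (half c) (≤-trans (x≤y⊔x _ _) (≤-trans φ≤η (proj₂ (proj₂ (proj₂ η))))))
                          (≤-reflexive (half+half c)))

      near : ∀ Δ δ → 0# < δ → ∃[ η ] 0# < η × (∀ A x b → eval A (projectionᶠ Δ ⊔ᶠ θ Δ) (x ∷ b) ≤ η →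
               ∃[ y ] P A (Ball.point y) × Balls.distᴮ A x y ≤ δ)
      near Δ δ 0<δ = proj₁ (η Δ δ 0<δ) , proj₁ (proj₂ (η Δ δ 0<δ)) , near-member Δ δ 0<δ

module Corner {ℓ} {ℝ : CompleteOrderedField ℓ} (lem : ExcludedMiddle ℓ) (A : CStarAlgebra ℝ)
  (p : CStarAlgebra.Carrier A) (proj : CStarAlgebra.IsProjection A p) where
  open CStarAlgebra A
  open CStarLemmas lem A
  open CompleteOrderedField ℝ using (_≤_; 1#; *-identityʳ; *-identityˡ; ≤-trans; ≤-reflexive)

  pAp : CStarAlgebra ℝ
  pAp = corner A p proj

  compress : Carrier → Carrier
  compress a = p ∙ a ∙ p

  unit : CStarAlgebra.Carrier pAp
  unit = p , p , ≈ᴹ-sym (≈ᴹ-trans (∙-congʳ (proj₁ proj)) (proj₁ proj))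

  compressed : Carrier → CStarAlgebra.Carrier pAp
  compressed a = compress a , a , ≈ᴹ-refl

  pp[_]≈ : ∀ a → p ∙ compress a ≈ᴹ compress a
  pp[ a ]≈ = ≈ᴹ-trans (≈ᴹ-sym (∙-assoc p (p ∙ a) p))
    (∙-congʳ (≈ᴹ-trans (≈ᴹ-sym (∙-assoc p p a)) (∙-congʳ (proj₁ proj))))

  []pp≈ : ∀ a → compress a ∙ p ≈ᴹ compress a
  []pp≈ a = ≈ᴹ-trans (∙-assoc (p ∙ a) p p) (∙-congˡ (proj₁ proj))

  unitˡ : ∀ x → CStarAlgebra._≈ᴹ_ pAp (CStarAlgebra._∙_ pAp unit x) x
  unitˡ (x , a , x≈) = ≈ᴹ-trans (∙-congˡ x≈) (≈ᴹ-trans pp[ a ]≈ (≈ᴹ-sym x≈))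

  unitʳ : ∀ x → CStarAlgebra._≈ᴹ_ pAp (CStarAlgebra._∙_ pAp x unit) x
  unitʳ (x , a , x≈) = ≈ᴹ-trans (∙-congʳ x≈) (≈ᴹ-trans ([]pp≈ a) (≈ᴹ-sym x≈))

  compress-id : ∀ ((x , _) : CStarAlgebra.Carrier pAp) → compress x ≈ᴹ x
  compress-id z@(x , _) = ≈ᴹ-trans (∙-congʳ (unitˡ z)) (unitʳ z)

  ‖compress‖≤1 : ∀ {x} → ‖ x ‖ ≤ 1# → ‖ compress x ‖ ≤ 1#
  ‖compress‖≤1 q = ≤-trans (‖‖-∙ (‖‖-∙ p≤1 q) p≤1)
    (≤-reflexive (CompleteOrderedField.trans ℝ (*-identityʳ _) (*-identityˡ 1#)))
    where p≤1 = ‖projection‖≤1 proj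

  open UnitalAlgebra lem pAp unit unitˡ unitʳ public
    using (commutative; infinite⇒nonunitary-isometry; near-infinite)

module Projections {ℓ} (ℝ : CompleteOrderedField ℓ) (lem : ExcludedMiddle ℓ) where
  open CompleteOrderedField ℝ hiding (isRingWithoutOne) renaming (Carrier to R; zero to *-zero)
  open RealAnalysis ℝ lem
  open ContinuousLogic ℝ lem
  open Formulas ℝ lem
  open Definability ℝ lem

  norm≤1 : ∀ (A : CStarAlgebra ℝ) (x : Ball A 1) → CStarAlgebra.‖_‖ A (Ball.point x) ≤ 1#
  norm≤1 A x = ≤-trans (Ball.bound x) (≤-reflexive (+-identityʳ 1#))

  toBall : ∀ (A : CStarAlgebra ℝ) {x} → CStarAlgebra.‖_‖ A x ≤ 1# → Ball A 1
  toBall A {x} p = ball x (≤-trans p (≤-reflexive (sym (+-identityʳ 1#))))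

  compressᵗ : ∀ {Γ} → Term Γ 1 → Term Γ 1 → Term Γ 1
  compressᵗ p x = p ∙ᵗ x ∙ᵗ p

  commutatorᶠ : ∀ Δ → Formula (1 ∷ 1 ∷ 1 ∷ Δ)
  commutatorᶠ Δ = dist (y ∙ᵗ z) (z ∙ᵗ y)
    where
    p = var (there (there (here ≡.refl)))
    y = compressᵗ p (var (there (here ≡.refl)))
    z = compressᵗ p (var (here ≡.refl))

  abelianᶠ : ∀ Δ → Formula (1 ∷ Δ)
  abelianᶠ Δ = sup 1 (sup 1 (commutatorᶠ Δ))

  abelian-vanishes : ∀ Δ A p b → IsAbelianProjection A (Ball.point p) → eval A (abelianᶠ Δ) (p ∷ b) ≤ 0#
  abelian-vanishes Δ A p b (proj , abelian) = eval-sup-least A (sup 1 (commutatorᶠ Δ)) (p ∷ b) λ y →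
    eval-sup-least A (commutatorᶠ Δ) (y ∷ p ∷ b) λ z →
      CStarLemmas.x≈y⇒‖x-y‖≤ lem A ≤-refl (abelian (compressed (Ball.point y)) (compressed (Ball.point z)))
    where open Corner lem A (Ball.point p) proj

  abelian-gap : ∀ Δ A p b → CStarAlgebra.IsProjection A (Ball.point p) → eval A (abelianᶠ Δ) (p ∷ b) ≤ ½ →
                IsAbelianProjection A (Ball.point p)
  abelian-gap Δ A p b proj small = proj , commutative λ x y ‖x‖≤1 ‖y‖≤1 →
    let u = toBall A ‖x‖≤1
        v = toBall A ‖y‖≤1
        xy≈ = ∙-cong (≈ᴹ-sym (compress-id x)) (≈ᴹ-sym (compress-id y))
        yx≈ = ∙-cong (≈ᴹ-sym (compress-id y)) (≈ᴹ-sym (compress-id x))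
    in ‖‖≤-cong (+ᴹ-cong xy≈ (-ᴹ‿cong yx≈))
      (≤-trans (eval-sup-upper A (commutatorᶠ Δ) (u ∷ p ∷ b) v)
      (≤-trans (eval-sup-upper A (sup 1 (commutatorᶠ Δ)) (p ∷ b) u) small))
    where
    open CStarAlgebra A
    open CStarLemmas lem A
    open Corner lem A (Ball.point p) proj

  -- If w is an isometry of pAp, then p - ww⋆ is a projection, of norm 0 or 1.
  isometryᶠ : ∀ Δ → Formula (1 ∷ 1 ∷ Δ)
  isometryᶠ Δ = dist (w ⋆ᵗ ∙ᵗ w) p ⊔ᶠ (constᶠ 1# -ᶠ dist p (w ∙ᵗ w ⋆ᵗ))
    where
    p = var (there (here ≡.refl))
    w = compressᵗ p (var (here ≡.refl))

  infiniteᶠ : ∀ Δ → Formula (1 ∷ Δ)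
  infiniteᶠ Δ = inf 1 (isometryᶠ Δ)

  ⅟₁₆ : R
  ⅟₁₆ = half ⅛

  0<⅟₁₆ : 0# < ⅟₁₆
  0<⅟₁₆ = 0<half (0<half (0<half 0<½))

  infinite-vanishes : ∀ Δ A p b → IsInfiniteProjection A (Ball.point p) → eval A (infiniteᶠ Δ) (p ∷ b) ≤ 0#
  infinite-vanishes Δ A p b (proj , ¬finite) with lem {CStarAlgebra.IsInfinite (corner A (Ball.point p) proj)}
  ... | no  finite = contradiction finite ¬finite
  ... | yes infinite = ≤-trans (eval-inf-lower A (isometryᶠ Δ) (p ∷ b) (toBall A ‖v‖≤1))
      (⊔-lub (x≈y⇒‖x-y‖≤ ≤-refl (≈ᴹ-trans (∙-cong (⋆-cong w≈v) w≈v) v⋆v≈p))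
             (x≤y+z⇒x-y≤z (≤-trans 1≤ (≤-reflexive (trans
               (‖‖-cong (+ᴹ-congˡ (-ᴹ‿cong (∙-cong (≈ᴹ-sym w≈v) (⋆-cong (≈ᴹ-sym w≈v))))))
               (sym (+-identityʳ _)))))))
    where
    open CStarAlgebra A
    open CStarLemmas lem A
    open Corner lem A (Ball.point p) proj
    v = proj₁ (infinite⇒nonunitary-isometry infinite)
    v⋆v≈p = proj₁ (proj₂ (infinite⇒nonunitary-isometry infinite))
    1≤ = proj₂ (proj₂ (infinite⇒nonunitary-isometry infinite))
    w≈v = compress-id v
    ‖v‖≤1 : ‖ proj₁ v ‖ ≤ 1#
    ‖v‖≤1 = UnitalAlgebra.‖isometry‖≤1 lem pAp unit unitˡ unitʳ {v} v⋆v≈p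

  infinite-gap : ∀ Δ A p b → CStarAlgebra.IsProjection A (Ball.point p) → eval A (infiniteᶠ Δ) (p ∷ b) ≤ ⅟₁₆ →
                 IsInfiniteProjection A (Ball.point p)
  infinite-gap Δ A p b proj small =
    let v , value≤ = eval-inf-witness A (isometryᶠ Δ) (p ∷ b) small 0<⅟₁₆
        value≤⅛ = ≤-trans value≤ (≤-reflexive (half+half ⅛))
    in proj , λ finite → finite (near-infinite (compressed (Ball.point v)) (‖compress‖≤1 (norm≤1 A v))
         (≤-trans (x≤x⊔y _ _) value≤⅛)
         (x-y≤z⇒x≤y+z (≤-trans (x≤y⊔x _ _) value≤⅛)))
    where open Corner lem A (Ball.point p) proj

  finiteᶠ : ∀ Δ → Formula (1 ∷ Δ)
  finiteᶠ Δ = constᶠ ⅟₁₆ -ᶠ infiniteᶠ Δ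

  finite-vanishes : ∀ Δ A p b → IsFiniteProjection A (Ball.point p) → eval A (finiteᶠ Δ) (p ∷ b) ≤ 0#
  finite-vanishes Δ A p b (proj , finite) = x≤y+z⇒x-y≤z (≤-trans
    (≰⇒≥ λ small → proj₂ (infinite-gap Δ A p b proj small) finite) (≤-reflexive (sym (+-identityʳ _))))

  finite-gap : ∀ Δ A p b → CStarAlgebra.IsProjection A (Ball.point p) → eval A (finiteᶠ Δ) (p ∷ b) ≤ half ⅟₁₆ →
               IsFiniteProjection A (Ball.point p)
  finite-gap Δ A p b proj small = proj , λ infinite → <⇒≰ (0<half 0<⅟₁₆)
    (≤-by (≤-trans (x-y≤z⇒x≤y+z small) (+-monoˡ-≤ _ (infinite-vanishes Δ A p b (proj , λ finite → finite infinite))))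
      (trans (+-congˡ (+-identityˡ _)) (trans (half+half ⅟₁₆) (sym (+-identityˡ _)))))

  abelian-zeroSet : IsZeroSet AbelianProjections _
  abelian-zeroSet =
    projections-zeroSet IsAbelianProjection (λ A p → proj₁) abelianᶠ 0<½ abelian-vanishes abelian-gap

  finite-zeroSet : IsZeroSet FiniteProjections _
  finite-zeroSet =
    projections-zeroSet IsFiniteProjection (λ A p → proj₁) finiteᶠ (0<half 0<⅟₁₆) finite-vanishes finite-gap

  infinite-zeroSet : IsZeroSet InfiniteProjections _
  infinite-zeroSet =
    projections-zeroSet IsInfiniteProjection (λ A p → proj₁) infiniteᶠ 0<⅟₁₆ infinite-vanishes infinite-gap

  existence-elementary : ∀ (P : ∀ (A : CStarAlgebra ℝ) → Pred (CStarAlgebra.Carrier A) ℓ) →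
    (∀ A p → P A p → CStarAlgebra.IsProjection A p) →
    ∀ {φ} → IsZeroSet (inUnitBall P) φ → IsElementary (λ A → ∃ (P A))
  existence-elementary P P⇒projection zeroSet = nonempty-elementary zeroSet
    (λ A (p , Pp) → toBall A (CStarLemmas.‖projection‖≤1 lem A (P⇒projection A p Pp)) , Pp)
    (λ A x Px → Ball.point x , Px)

proposition3p13p5 : ∀ {ℓ} (ℝ : CompleteOrderedField ℓ) (lem : ExcludedMiddle ℓ) →
    let open ContinuousLogic ℝ lem in
    (IsDefinableSet AllAlgebras AbelianProjections ×
    IsDefinableSet AllAlgebras FiniteProjections ×
    IsDefinableSet AllAlgebras InfiniteProjections) ×
    (IsElementary HasAbelianProjection ×
    IsElementary HasFiniteProjection ×
    IsElementary HasInfiniteProjection)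
proposition3p13p5 ℝ lem =
  (zeroSet-definable abelian-zeroSet , zeroSet-definable finite-zeroSet , zeroSet-definable infinite-zeroSet) ,
  (existence-elementary IsAbelianProjection (λ A p → proj₁) abelian-zeroSet ,
   existence-elementary IsFiniteProjection (λ A p → proj₁) finite-zeroSet ,
   existence-elementary IsInfiniteProjection (λ A p → proj₁) infinite-zeroSet)
  where
  open ContinuousLogic ℝ lem
  open Definability ℝ lem
  open Projections ℝ lem
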